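{- Let $g\ge 5$ be an integer and let $G$ be a finite graph (multiple edges allowed, no loops) with girth $g(G)\ge g$ and $\mu(G)\ge \lfloor g/2\rfloor+1$. If $\chi'(G)=\Delta(G)+\lceil \mu(G)/\lfloor g/2\rfloor\rceil$, then $G$ contains (as a subgraph) a ring graph $R$ with $\chi'(R)=\chi'(G)$.
   Context: Graphs may have parallel edges but no loops. $\chi'(G)$ is the chromatic index (least $k$ such that the edges can be colored with $k$ colors so that edges sharing a vertex receive distinct colors), $\Delta(G)$ is the maximum degree, and $\mu(G)$ is the multiplicity, i.e. the maximum number of parallel edges joining two vertices. The girth $g(G)$ is the smallest integer $g\ge 3$ such that $G$ has a cycle of length $g$ (so parallel edges do not count as cycles), and $g(G)=\infty$ if no such cycle exists. A ring graph is a graph obtained from a cycle by duplicating some of its edges (i.e. replacing some edges by several parallel edges). -}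

module Defs where

open import Data.Nat using (ℕ; zero; suc; _+_; _∸_; _≤_; _<_; _⊔_)
open import Data.Nat.DivMod using (_/_)
open import Data.Fin using (Fin; toℕ) renaming (_≟_ to _≟ᶠ_)
open import Data.Fin.Properties using ()
open import Data.List using (List; length; map; foldr; filterᵇ; allFin; concatMap)
open import Data.Bool using (Bool; _∧_; _∨_)
open import Data.Product using (Σ; _×_; _,_; ∃; ∃-syntax)
open import Data.Sum using (_⊎_)
open import Relation.Nullary using (¬_; does)
open import Relation.Binary.PropositionalEquality using (_≡_; _≢_)
open import Function.Definitions using (Injective; Surjective)

-- A finite multigraph without loops: vertices Fin nV, edges Fin nE,
-- each edge e joins the two distinct vertices src e and tgt e
-- (the orientation is irrelevant; edges are treated as unordered).
record Multigraph : Set where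
  field
    nV   : ℕ
    nE   : ℕ
    src  : Fin nE → Fin nV
    tgt  : Fin nE → Fin nV
    loopless : ∀ e → src e ≢ tgt e
open Multigraph public

Vert : Multigraph → Set
Vert G = Fin (nV G)

Edge : Multigraph → Set
Edge G = Fin (nE G)

Joins : (G : Multigraph) → Edge G → Vert G → Vert G → Set
Joins G e u v = (src G e ≡ u × tgt G e ≡ v) ⊎ (src G e ≡ v × tgt G e ≡ u)

Incident : (G : Multigraph) → Edge G → Vert G → Set
Incident G e v = (src G e ≡ v) ⊎ (tgt G e ≡ v)

_==_ : ∀ {n} → Fin n → Fin n → Bool
a == b = does (a ≟ᶠ b)

deg : (G : Multigraph) → Vert G → ℕ
deg G v = length (filterᵇ (λ e → (src G e == v) ∨ (tgt G e == v)) (allFin (nE G)))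

mult : (G : Multigraph) → Vert G → Vert G → ℕ
mult G u v = length (filterᵇ
  (λ e → ((src G e == u) ∧ (tgt G e == v)) ∨ ((src G e == v) ∧ (tgt G e == u)))
  (allFin (nE G)))

maxList : List ℕ → ℕ
maxList = foldr _⊔_ 0

-- maximum degree Δ(G) (0 for the empty graph)
Δ : Multigraph → ℕ
Δ G = maxList (map (deg G) (allFin (nV G)))

μ : Multigraph → ℕ
μ G = maxList (concatMap (λ u → map (mult G u) (allFin (nV G))) (allFin (nV G)))

ProperEdgeColouring : (G : Multigraph) (k : ℕ) → (Edge G → Fin k) → Set
ProperEdgeColouring G k c =
  ∀ e e' v → e ≢ e' → Incident G e v → Incident G e' v → c e ≢ c e'

Colourable : Multigraph → ℕ → Set
Colourable G k = Σ (Edge G → Fin k) (ProperEdgeColouring G k)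

IsChromaticIndex : Multigraph → ℕ → Set
IsChromaticIndex G k = Colourable G k × (∀ j → Colourable G j → k ≤ j)

next : ∀ {ℓ} → Fin (suc ℓ) → Fin (suc ℓ)
next {ℓ} i with toℕ i Data.Nat.<? ℓ
  where open import Data.Nat using (_<?_)
... | Relation.Nullary.yes p = Data.Fin.fromℕ< (Data.Nat.s≤s p)
... | Relation.Nullary.no _  = Data.Fin.zero

Adjacent : (G : Multigraph) → Vert G → Vert G → Set
Adjacent G u v = ∃[ e ] Joins G e u v

-- G contains a cycle of length ℓ+1 : distinct vertices x₀,…,x_ℓ with
-- x_i adjacent to x_{i+1 mod (ℓ+1)}.  (Used only for ℓ+1 ≥ 3, so parallel
-- edges do not count as cycles.)
HasCycleOfLength : Multigraph → ℕ → Set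
HasCycleOfLength G zero = Data.Empty.⊥
  where import Data.Empty
HasCycleOfLength G (suc ℓ) =
  Σ (Fin (suc ℓ) → Vert G) λ x → Injective _≡_ _≡_ x × (∀ i → Adjacent G (x i) (x (next i)))

GirthAtLeast : Multigraph → ℕ → Set
GirthAtLeast G g = ∀ ℓ → 3 ≤ ℓ → ℓ < g → ¬ HasCycleOfLength G ℓ

-- ring graph: obtained from a cycle of length ℓ+1 ≥ 3 by replacing edges by
-- (≥ 1) parallel edges.  The vertices are enumerated cyclically by a bijection
-- x : Fin (ℓ+1) → V(R); every edge joins some x i and x (next i), and every such
-- consecutive pair is joined by at least one edge.
IsRing : Multigraph → Set
IsRing R = ∃[ ℓ ] (2 ≤ ℓ × Σ (Fin (suc ℓ) → Vert R) λ x →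
   Injective _≡_ _≡_ x × Surjective _≡_ _≡_ x
   × (∀ e → ∃[ i ] Joins R e (x i) (x (next i)))
   × (∀ i → Adjacent R (x i) (x (next i))))

SubgraphOf : Multigraph → Multigraph → Set
SubgraphOf R G = Σ (Vert R → Vert G) λ φ → Σ (Edge R → Edge G) λ ψ →
  Injective _≡_ _≡_ φ × Injective _≡_ _≡_ ψ
  × (∀ e → Joins G (ψ e) (φ (src R e)) (φ (tgt R e)))

-- ceiling division ⌈a / b⌉ (for b ≥ 1; 0 when b = 0, never used)
⌈_/_⌉ : ℕ → ℕ → ℕ
⌈ a / zero ⌉ = 0
⌈ a / suc k ⌉ = (a + k) / suc k

{-# OPTIONS --safe #-}
module Submission where

-- Put h = ⌊g/2⌋, s = ⌈μ/h⌉ ≥ 2 and k = Δ + s − 1.  Delete edges from G until the graph H that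
-- remains, after the deletion of a last edge e = xy, has a k-colouring.  As k > Δ, every vertex
-- misses a colour, and Tashkinov's theorem applies: no colour is missed twice by a tree that
-- grows from e along edges whose colours are missed by earlier vertices.  If the tree is as large
-- as possible, then each missed colour matches all but one of its 2m + 1 vertices, so the edges in
-- the missed colours form an overfull weighted graph.  A count of non-backtracking walks shows
-- that an overfull graph with girth at least g and multiplicities at most s h has no vertex with
-- three neighbours.  Hence the vertex set of the tree is that of a cycle formed by e and a chain in
-- two colours.  The freedom of all other colours now forces the colours missed by no vertex of the
-- cycle to leave it only once, since otherwise Kempe changes would produce a larger tree.  So all k
-- colours match all but one vertex of the cycle; by the same count the graph induced by its vertices
-- is, up to multiplicities, the cycle itself, and with more than k m edges it has no k-colouring.

open import Defs
open import Data.Bool using (Bool; if_then_else_; T?)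
open import Data.Empty using (⊥; ⊥-elim)
open import Data.Fin using (Fin; zero; suc; toℕ; fromℕ; fromℕ<; inject₁) renaming (_≟_ to _≟ᶠ_)
open import Data.Fin.Permutation.Components using (transpose; transpose-inverse)
open import Data.Fin.Properties using (any?; all?; toℕ-injective; toℕ-fromℕ<; toℕ-fromℕ; toℕ-inject₁; toℕ<n) renaming (suc-injective to sucᶠ-injective)
open import Data.List using (List; []; _∷_; [_]; _∷ʳ_; _++_; length; map; lookup; filter; concatMap; tabulate; allFin)
open import Data.List.Membership.Propositional using (_∈_; _∉_; lose)
open import Data.List.Membership.Propositional.Properties using (∈-map⁺; ∈-map⁻; ∈-++⁺ˡ; ∈-++⁺ʳ; ∈-++⁻; ∈-∃++; ∈-filter⁺; ∈-filter⁻; ∈-concatMap⁺; ∈-lookup; ∈-allFin)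
open import Data.List.Properties using (length-++; length-map; length-tabulate; map-++; ++-assoc; ++-identityʳ; ∷ʳ-++; ∷-injectiveʳ; filter-all)
open import Data.List.Relation.Unary.All using (All; []; _∷_)
open import Data.List.Relation.Unary.AllPairs using ([]; _∷_)
open import Data.List.Relation.Unary.Any using (here; there; index)
open import Data.List.Relation.Unary.Any.Properties using (lookup-index)
open import Data.List.Relation.Unary.Linked using (Linked; []; [-]; _∷_)
open import Data.List.Relation.Unary.Unique.Propositional using (Unique)
open import Data.List.Reverse using (Reverse; []; _∶_∶ʳ_; reverseView)
open import Data.Nat using (ℕ; zero; suc; _+_; _*_; _∸_; _^_; _≤_; _<_; _≤?_; _<?_; z≤n; s≤s)
open import Data.Nat.DivMod using (_/_; _%_; m/n*n≤m; m≡m%n+[m/n]*n; m%n<n; /-monoˡ-≤)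
open import Data.Nat.ListAction using (sum)
open import Data.Nat.Properties
open import Data.Nat.Tactic.RingSolver using (solve-∀)
open import Data.Product using (Σ; _×_; _,_; ∃; ∃-syntax; proj₁; proj₂)
open import Data.Sum using (_⊎_; inj₁; inj₂; [_,_]′)
open import Data.Unit using (⊤; tt)
open import Function using (_∘_; case_of_; id)
open import Function.Definitions using (Injective)
open import Relation.Binary.PropositionalEquality hiding ([_])
open import Relation.Nullary using (¬_; Dec; yes; no; does; ¬?)
open import Relation.Nullary.Decidable using (_⊎-dec_; _×-dec_; _→-dec_; dec-true; dec-false; map′)
import Data.List.Relation.Unary.All as All
import Data.List.Relation.Unary.All.Properties as All
import Data.List.Relation.Unary.Linked as Linked
import Data.List.Relation.Unary.Linked.Properties as Linked
import Data.List.Relation.Unary.Unique.Propositional.Properties as Unique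

∉⇒≢ : ∀ {A : Set} {u v : A} {xs} → v ∉ xs → u ∈ xs → v ≢ u
∉⇒≢ v∉ u∈ refl = v∉ u∈

-- Pigeonhole for lists without repetition

module _ {n : ℕ} where

  open import Data.List.Membership.DecPropositional (_≟ᶠ_ {n}) public using (_∈?_)

  pick-outside : ∀ (xs ys : List (Fin n)) → Unique xs → length ys < length xs →
                 ∃[ v ] (v ∈ xs × v ∉ ys)
  pick-outside (v ∷ xs) ys (v∉ ∷ u) lt with v ∈? ys
  ... | no v∉ys = v , here refl , v∉ys
  ... | yes v∈ys with ∈-∃++ v∈ys
  ... | as , bs , refl with pick-outside xs (as ++ bs) u
          (≤-pred (subst (_< suc (length xs))
            (trans (length-++ as) (trans (+-suc (length as) (length bs)) (cong suc (sym (length-++ as))))) lt))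
  ... | w , w∈ , w∉ = w , there w∈ , λ w∈ys → case ∈-++⁻ as w∈ys of λ where
          (inj₁ p) → w∉ (∈-++⁺ˡ p)
          (inj₂ (here refl)) → All.lookup v∉ w∈ refl
          (inj₂ (there p)) → w∉ (∈-++⁺ʳ as p)

  unique-⊆-length : ∀ (xs ys : List (Fin n)) → Unique xs → (∀ {v} → v ∈ xs → v ∈ ys) →
                    length xs ≤ length ys
  unique-⊆-length xs ys u sub with length xs ≤? length ys
  ... | yes p = p
  ... | no p with pick-outside xs ys u (≰⇒> p)
  ... | v , v∈ , v∉ = ⊥-elim (v∉ (sub v∈))

  unique-length : ∀ (xs : List (Fin n)) → Unique xs → length xs ≤ n
  unique-length xs u = subst (length xs ≤_) (length-tabulate {n = n} (λ i → i))
    (unique-⊆-length xs (allFin n) u (λ {v} _ → ∈-allFin v))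

unique-map : ∀ {A B : Set} (f : A → B) {xs : List A} →
             (∀ {p q} → p ∈ xs → q ∈ xs → f p ≡ f q → p ≡ q) → Unique xs → Unique (map f xs)
unique-map f inj [] = []
unique-map f {p ∷ xs} inj (p∉ ∷ u) =
  All.map⁺ (All.tabulate λ q∈ e → All.lookup p∉ q∈ (inj (here refl) (there q∈) e)) ∷
  unique-map f (λ p∈ q∈ → inj (there p∈) (there q∈)) u

data EndsIn {A : Set} (z : A) : List A → Set where
  end  : EndsIn z (z ∷ [])
  skip : ∀ {y ys} → EndsIn z ys → EndsIn z (y ∷ ys)

ends-∈ : ∀ {A : Set} {z : A} {zs} → EndsIn z zs → z ∈ zs
ends-∈ end = here refl
ends-∈ (skip e) = there (ends-∈ e)

transpose-ˡ : ∀ {n} (a b : Fin n) → transpose a b a ≡ b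
transpose-ˡ a b rewrite dec-true (a ≟ᶠ a) refl = refl

transpose-ʳ : ∀ {n} (a b : Fin n) → transpose a b b ≡ a
transpose-ʳ a b with b ≟ᶠ a
... | yes p = p
... | no _ rewrite dec-true (b ≟ᶠ b) refl = refl

transpose-≢ : ∀ {n} {a b c : Fin n} → c ≢ a → c ≢ b → transpose a b c ≡ c
transpose-≢ {a = a} {b} {c} p q rewrite dec-false (c ≟ᶠ a) p | dec-false (c ≟ᶠ b) q = refl

transpose-injective : ∀ {n} (a b : Fin n) {c d} → transpose a b c ≡ transpose a b d → c ≡ d
transpose-injective a b {c} {d} eq =
  trans (sym (transpose-inverse b a)) (trans (cong (transpose b a) eq) (transpose-inverse b a))

-- Kempe chains

module Colourings (H : Multigraph) (k : ℕ) where

  V E Colour : Set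
  V = Vert H
  E = Edge H
  Colour = Fin k

  private variable
    φ ψ : E → Colour
    a b c d : Colour
    u v w : V
    f : E

  Proper : (E → Colour) → Set
  Proper = ProperEdgeColouring H k

  Miss : (E → Colour) → Colour → V → Set
  Miss φ c v = ∀ f → Incident H f v → φ f ≢ c

  Sees : (E → Colour) → Colour → V → Set
  Sees φ c v = ∃[ f ] (Incident H f v × φ f ≡ c)

  incident? : ∀ f v → Dec (Incident H f v)
  incident? f v = (src H f ≟ᶠ v) ⊎-dec (tgt H f ≟ᶠ v)

  miss⊎sees : ∀ φ c v → Miss φ c v ⊎ Sees φ c v
  miss⊎sees φ c v with any? (λ f → incident? f v ×-dec (φ f ≟ᶠ c))
  ... | yes p = inj₂ p
  ... | no p = inj₁ (λ f i e → p (f , i , e))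

  opaque
    miss? : ∀ φ c v → Dec (Miss φ c v)
    miss? φ c v with miss⊎sees φ c v
    ... | inj₁ m = yes m
    ... | inj₂ (f , i , e) = no (λ m → m f i e)

  same-edge : Proper φ → ∀ {f f'} → Incident H f v → Incident H f' v → φ f ≡ φ f' → f ≡ f'
  same-edge p {f} {f'} i i' e with f ≟ᶠ f'
  ... | yes q = q
  ... | no q = ⊥-elim (p f f' _ q i i' e)

  other : Incident H f u → ∃[ v ] Joins H f u v
  other {f} (inj₁ e) = tgt H f , inj₁ (e , refl)
  other {f} (inj₂ e) = src H f , inj₂ (refl , e)

  joins-sym : Joins H f u v → Joins H f v u
  joins-sym (inj₁ (p , q)) = inj₂ (p , q)
  joins-sym (inj₂ (p , q)) = inj₁ (p , q)

  joins-incˡ : Joins H f u v → Incident H f u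
  joins-incˡ (inj₁ (p , q)) = inj₁ p
  joins-incˡ (inj₂ (p , q)) = inj₂ q

  joins-incʳ : Joins H f u v → Incident H f v
  joins-incʳ j = joins-incˡ (joins-sym j)

  joins-functional : Joins H f u v → Joins H f u w → v ≡ w
  joins-functional (inj₁ (p , q)) (inj₁ (p' , q')) = trans (sym q) q'
  joins-functional {f} (inj₁ (p , q)) (inj₂ (p' , q')) = ⊥-elim (loopless H f (trans p (sym q')))
  joins-functional {f} (inj₂ (p , q)) (inj₁ (p' , q')) = ⊥-elim (loopless H f (trans p' (sym q)))
  joins-functional (inj₂ (p , q)) (inj₂ (p' , q')) = trans (sym p) p'

  incident-end : Joins H f u v → Incident H f w → w ≡ u ⊎ w ≡ v
  incident-end (inj₁ (p , q)) (inj₁ e) = inj₁ (trans (sym e) p)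
  incident-end (inj₁ (p , q)) (inj₂ e) = inj₂ (trans (sym e) q)
  incident-end (inj₂ (p , q)) (inj₁ e) = inj₂ (trans (sym e) p)
  incident-end (inj₂ (p , q)) (inj₂ e) = inj₁ (trans (sym e) q)

  joins-≢ : Joins H f u v → u ≢ v
  joins-≢ {f} (inj₁ (p , q)) refl = loopless H f (trans p (sym q))
  joins-≢ {f} (inj₂ (p , q)) refl = loopless H f (trans p (sym q))

  One-of : Colour → Colour → Colour → Set
  One-of a b c = c ≡ a ⊎ c ≡ b

  one-of? : ∀ a b c → Dec (One-of a b c)
  one-of? a b c = (c ≟ᶠ a) ⊎-dec (c ≟ᶠ b)

  Closed : (E → Colour) → Colour → Colour → (V → Set) → Set
  Closed φ a b P = ∀ f u v → Joins H f u v → One-of a b (φ f) → P u → P v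

  -- What every exchange of `a` and `b` preserves, wherever it takes place; the transport of trees
  -- between colourings uses only this.
  record Similar (a b : Colour) (φ ψ : E → Colour) : Set where
    field
      agree : ∀ f → φ f ≢ a → φ f ≢ b → ψ f ≡ φ f
      within : ∀ f → One-of a b (φ f) → One-of a b (ψ f)

    miss-other : ∀ {c v} → c ≢ a → c ≢ b → Miss φ c v → Miss ψ c v
    miss-other c≢a c≢b m f i e with one-of? a b (φ f)
    ... | yes p = [ c≢a , c≢b ]′ (subst (One-of a b) e (within f p))
    ... | no p = m f i (trans (sym (agree f (p ∘ inj₁) (p ∘ inj₂))) e)

  open Similar public

  -- Testing the source alone suffices: a set closed along `a`- and `b`-edges contains both ends of
  -- such an edge or neither, and the transposition fixes all other colours.
  swap-on : (E → Colour) → Colour → Colour → {P : V → Set} → (∀ v → Dec (P v)) → E → Colour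
  swap-on φ a b P? f = if does (P? (src H f)) then transpose a b (φ f) else φ f

  module SwapOn (φ : E → Colour) (a b : Colour) {P : V → Set} (P? : ∀ v → Dec (P v))
                (closed : Closed φ a b P) where

    swapped : E → Colour
    swapped = swap-on φ a b P?

    inside : Incident H f v → P v → swapped f ≡ transpose a b (φ f)
    inside {f} (inj₁ refl) pv with P? (src H f)
    ... | yes _ = refl
    ... | no p = ⊥-elim (p pv)
    inside {f} (inj₂ refl) pv with P? (src H f)
    ... | yes _ = refl
    ... | no p with one-of? a b (φ f)
    ...   | yes q = ⊥-elim (p (closed f _ _ (inj₂ (refl , refl)) q pv))
    ...   | no q = sym (transpose-≢ (q ∘ inj₁) (q ∘ inj₂))

    outside : Incident H f v → ¬ P v → swapped f ≡ φ f
    outside {f} (inj₁ refl) pv with P? (src H f)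
    ... | yes p = ⊥-elim (pv p)
    ... | no p = refl
    outside {f} (inj₂ refl) pv with P? (src H f)
    ... | no p = refl
    ... | yes p with one-of? a b (φ f)
    ...   | yes q = ⊥-elim (pv (closed f _ _ (inj₁ (refl , refl)) q p))
    ...   | no q = transpose-≢ (q ∘ inj₁) (q ∘ inj₂)

    swapped-proper : Proper φ → Proper swapped
    swapped-proper pr f f' v f≢f' i i' e with P? v
    ... | yes pv = pr f f' v f≢f' i i' (transpose-injective a b
                     (trans (sym (inside i pv)) (trans e (inside i' pv))))
    ... | no pv = pr f f' v f≢f' i i' (trans (sym (outside i pv)) (trans e (outside i' pv)))

    similar : Similar a b φ swapped
    similar .agree f p q with P? (src H f)
    ... | yes _ = transpose-≢ p q
    ... | no _ = refl
    similar .within f p with P? (src H f) | p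
    ... | no _ | q = q
    ... | yes _ | inj₁ refl = inj₂ (transpose-ˡ a b)
    ... | yes _ | inj₂ refl = inj₁ (transpose-ʳ a b)

    miss-inside : P v → Miss φ c v → Miss swapped (transpose a b c) v
    miss-inside pv m f i e = m f i (transpose-injective a b (trans (sym (inside i pv)) e))

    miss-insideˡ : P v → Miss φ a v → Miss swapped b v
    miss-insideˡ pv m = subst (λ c → Miss swapped c _) (transpose-ˡ a b) (miss-inside pv m)

    miss-insideʳ : P v → Miss φ b v → Miss swapped a v
    miss-insideʳ pv m = subst (λ c → Miss swapped c _) (transpose-ʳ a b) (miss-inside pv m)

    miss-outside : ¬ P v → Miss φ c v → Miss swapped c v
    miss-outside pv m f i e = m f i (trans (sym (outside i pv)) e)

  Inside : (E → Colour) → ∀ {t} → (Fin t → V) → Colour → V → Set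
  Inside φ pt c u = ∃[ f ] ∃[ j ] (Joins H f u (pt j) × φ f ≡ c)

  Step : (E → Colour) → Colour → Colour → V → V → Set
  Step φ a b u v = ∃[ f ] (Joins H f u v × One-of a b (φ f))

  -- The initial part, from u to h, of the (a,b)-chain that starts at u.  The vertices are
  -- listed from h back to u; the chain entered h by colour d and would leave it by colour c.
  record Front (Q : V → Set) (φ : E → Colour) (a b : Colour) (u h : V) (ts : List V)
               (c d : Colour) : Set where
    field
      colours : (c ≡ a × d ≡ b) ⊎ (c ≡ b × d ≡ a)
      unique  : Unique (h ∷ ts)
      before  : ∀ f t v → t ∈ ts → Joins H f t v → One-of a b (φ f) → v ∈ h ∷ ts
      entered : ∀ f t → t ∈ ts → Joins H f h t → One-of a b (φ f) → φ f ≡ d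
      enters  : ∀ f v → Joins H f h v → φ f ≡ d → v ∈ ts
      interior : ∀ t → t ∈ ts → t ≡ u ⊎ (¬ Miss φ a t × ¬ Miss φ b t)
      entry   : h ≡ u ⊎ ¬ Miss φ d h
      linked  : Linked (Step φ a b) (h ∷ ts)
      start   : EndsIn u (h ∷ ts)
      avoids  : All (λ v → ¬ Q v) ts

    next-colour : One-of a b c
    next-colour with colours
    ... | inj₁ (p , _) = inj₁ p
    ... | inj₂ (p , _) = inj₂ p

  -- `Q` is a stopping condition: empty to obtain a whole chain, membership in a tree or cycle to
  -- stop where the chain first meets it.
  module Grow {Q : V → Set} (Q? : ∀ v → Dec (Q v)) (φ : E → Colour) (proper : Proper φ)
              (a b : Colour) (a≢b : a ≢ b) (u : V) where

    extend : ∀ {h ts c d} → Front Q φ a b u h ts c d → ¬ Q h → Sees φ c h →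
             ∃[ v ] Front Q φ a b u v (h ∷ ts) d c
    extend {h} {ts} {c} {d} F ¬q (f , i , e) = v⁺ , record
      { colours = [ (λ (p , q) → inj₂ (q , p)) , (λ (p , q) → inj₁ (q , p)) ]′ colours
      ; unique = ((λ v≡h → joins-≢ j (sym v≡h)) ∷ All.tabulate fresh) ∷ unique
      ; before = bef
      ; entered = ent
      ; enters = λ f' w j' e' → subst (_∈ h ∷ ts)
          (joins-functional (joins-sym j) (subst (λ g → Joins H g v⁺ w)
             (same-edge proper (joins-incˡ j') (joins-incʳ j) (trans e' (sym e))) j'))
          (here refl)
      ; interior = int
      ; entry = inj₂ (λ m → m f (joins-incʳ j) e)
      ; linked = (f , joins-sym j , subst (One-of a b) (sym e) next-colour) ∷ linked
      ; start = skip start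
      ; avoids = ¬q ∷ avoids
      }
      where
      open Front F
      v⁺ = proj₁ (other i)
      j : Joins H f h v⁺
      j = proj₂ (other i)
      c≢d : c ≢ d
      c≢d with colours
      ... | inj₁ (refl , refl) = a≢b
      ... | inj₂ (refl , refl) = a≢b ∘ sym
      -- The new edge leaves `h` by `c`, whereas every `a`- or `b`-edge from `h` back to an earlier
      -- vertex has colour `d`.
      fresh : ∀ {t} → t ∈ ts → v⁺ ≢ t
      fresh t∈ refl = c≢d (trans (sym e) (entered f v⁺ t∈ j (subst (One-of a b) (sym e) next-colour)))
      split : ∀ {x} → One-of a b x → x ≡ c ⊎ x ≡ d
      split o with colours
      ... | inj₁ (refl , refl) = o
      ... | inj₂ (refl , refl) = [ inj₂ , inj₁ ]′ o
      bef : ∀ f' t w → t ∈ h ∷ ts → Joins H f' t w → One-of a b (φ f') → w ∈ v⁺ ∷ h ∷ ts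
      bef f' t w (there t∈) j' o = there (before f' t w t∈ j' o)
      bef f' t w (here refl) j' o with split o
      ... | inj₂ q = there (there (enters f' w j' q))
      ... | inj₁ q = here (joins-functional (subst (λ g → Joins H g h w)
                       (same-edge proper (joins-incˡ j') (joins-incˡ j) (trans q (sym e))) j') j)
      ent : ∀ f' t → t ∈ h ∷ ts → Joins H f' v⁺ t → One-of a b (φ f') → φ f' ≡ c
      ent f' t (here refl) j' o with split o
      ... | inj₁ q = q
      ... | inj₂ q = ⊥-elim (fresh (enters f' v⁺ (joins-sym j') q) refl)
      ent f' t (there t∈) j' o with before f' t v⁺ t∈ (joins-sym j') o
      ... | here v≡h = ⊥-elim (joins-≢ j (sym v≡h))
      ... | there v∈ = ⊥-elim (fresh v∈ refl)
      int : ∀ t → t ∈ h ∷ ts → t ≡ u ⊎ (¬ Miss φ a t × ¬ Miss φ b t)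
      int t (there t∈) = interior t t∈
      int t (here refl) with entry
      ... | inj₁ h≡u = inj₁ h≡u
      ... | inj₂ ¬md with colours
      ...   | inj₁ (refl , refl) = inj₂ ((λ m → m f i e) , ¬md)
      ...   | inj₂ (refl , refl) = inj₂ (¬md , (λ m → m f i e))

    Stopped : Set
    Stopped = ∃[ h ] ∃[ ts ] ∃[ c ] ∃[ d ]
      (Front Q φ a b u h ts c d × (Q h ⊎ (¬ Q h × Miss φ c h)))

    -- Fuel and listed vertices together exceed `nV H`; the listed vertices are distinct, so the
    -- fuel outlasts the chain.
    run : ∀ fuel {h ts c d} → nV H < fuel + length (h ∷ ts) → Front Q φ a b u h ts c d → Stopped
    run zero {h} {ts} lt F = ⊥-elim (<⇒≱ lt (unique-length (h ∷ ts) (Front.unique F)))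
    run (suc fuel) {h} {ts} {c} lt F with Q? h | miss⊎sees φ c h
    ... | yes q | _ = h , ts , _ , _ , F , inj₁ q
    ... | no q | inj₁ m = h , ts , _ , _ , F , inj₂ (q , m)
    ... | no q | inj₂ s = run fuel (subst (nV H <_) (sym (+-suc fuel (length (h ∷ ts)))) lt)
                            (proj₂ (extend F q s))

    initial : Miss φ a u → Front Q φ a b u u [] b a
    initial m = record
      { colours = inj₂ (refl , refl) ; unique = [] ∷ []
      ; before = λ f t v () ; entered = λ f t () ; enters = λ f v j e → ⊥-elim (m f (joins-incˡ j) e)
      ; interior = λ t () ; entry = inj₁ refl ; linked = [-] ; start = end ; avoids = [] }

    grow : Miss φ a u → Stopped
    grow m = run (nV H) (m<m+n (nV H) (s≤s z≤n)) (initial m)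

  module _ {Q : V → Set} {h : V} {ts : List V} (F : Front Q φ a b u h ts c d) where
    open Front F

    front-closed : Miss φ c h → Closed φ a b (_∈ h ∷ ts)
    front-closed m f v w j o (there v∈) = before f v w v∈ j o
    front-closed m f v w j o (here refl) with colours | o
    ... | inj₁ (refl , refl) | inj₁ q = ⊥-elim (m f (joins-incˡ j) q)
    ... | inj₁ (refl , refl) | inj₂ q = there (enters f w j q)
    ... | inj₂ (refl , refl) | inj₁ q = there (enters f w j q)
    ... | inj₂ (refl , refl) | inj₂ q = ⊥-elim (m f (joins-incˡ j) q)

    front-ends : v ∈ h ∷ ts → Miss φ a v ⊎ Miss φ b v → v ≡ u ⊎ v ≡ h
    front-ends (here p) _ = inj₂ p
    front-ends (there v∈) m with interior _ v∈ | m
    ... | inj₁ p | _ = inj₁ p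
    ... | inj₂ (p , q) | inj₁ m' = ⊥-elim (p m')
    ... | inj₂ (p , q) | inj₂ m' = ⊥-elim (q m')

  record Chain (φ : E → Colour) (a b : Colour) (u : V) : Set where
    field
      last   : V
      body   : List V
      start  : EndsIn u (last ∷ body)
      unique : Unique (last ∷ body)
      linked : Linked (Step φ a b) (last ∷ body)
      last-misses : Miss φ a last ⊎ Miss φ b last
      closed : Closed φ a b (_∈ last ∷ body)
      ends   : ∀ {v} → v ∈ last ∷ body → Miss φ a v ⊎ Miss φ b v → v ≡ u ⊎ v ≡ last

    in? : ∀ v → Dec (v ∈ last ∷ body)
    in? v = v ∈? (last ∷ body)

  opaque
    chain : Proper φ → a ≢ b → Miss φ a u → Chain φ a b u
    chain {φ} {a} {b} {u} pr a≢b m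
      with Grow.grow {Q = λ _ → ⊥} (λ _ → no (λ ())) φ pr a b a≢b u m
    ... | h , ts , c , d , F , inj₂ (_ , mc) = record
      { last = h ; body = ts ; start = start ; unique = unique ; linked = linked
      ; last-misses = last-misses ; closed = front-closed F mc ; ends = front-ends F }
      where
      open Front F
      last-misses : Miss φ a h ⊎ Miss φ b h
      last-misses with colours
      ... | inj₁ (refl , _) = inj₁ mc
      ... | inj₂ (refl , _) = inj₂ mc

  linked-closed : ∀ {P : V → Set} {vs} → Closed φ a b P → Linked (Step φ a b) vs →
                  v ∈ vs → P v → ∀ {w} → w ∈ vs → P w
  linked-closed cl [-] (here refl) pv (here refl) = pv
  linked-closed cl (s ∷ l) (here refl) pv (here refl) = pv
  linked-closed cl ((f , j , o) ∷ l) (here refl) pv (there w∈) =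
    linked-closed cl l (here refl) (cl f _ _ j o pv) w∈
  linked-closed cl (s ∷ l) (there v∈) pv (there w∈) = linked-closed cl l v∈ pv w∈
  linked-closed cl ((f , j , o) ∷ l) (there v∈) pv (here refl) =
    cl f _ _ (joins-sym j) o (linked-closed cl l v∈ pv (here refl))

-- Tashkinov trees

module TashkinovTrees (H : Multigraph) (k : ℕ) (x y : Vert H) (x≢y : x ≢ y) where

  open Colourings H k

  private variable
    φ ψ : E → Colour
    a b c γ θ : Colour
    u v w z : V

  record Item : Set where
    constructor item
    field
      parent : V
      edge   : E
      vertex : V
  open Item public

  private variable
    i j : Item
    B L R S T : List Item

  -- Trees are listed with the newest vertex first; the root is the uncoloured edge xy.
  verts : List Item → List V
  verts T = map vertex T ++ x ∷ y ∷ []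

  MissedBy : (E → Colour) → List Item → Colour → Set
  MissedBy φ T c = ∃[ v ] (v ∈ verts T × Miss φ c v)

  data Tash (φ : E → Colour) : List Item → Set where
    []  : Tash φ []
    add : parent i ∈ verts T → vertex i ∉ verts T → Joins H (edge i) (parent i) (vertex i) →
          MissedBy φ T (φ (edge i)) → Tash φ T → Tash φ (i ∷ T)

  Elementary : (E → Colour) → List Item → Set
  Elementary φ T = ∀ {u v c} → u ∈ verts T → v ∈ verts T → Miss φ c u → Miss φ c v → u ≡ v

  Unused : (E → Colour) → Colour → List Item → Set
  Unused φ c = All (λ i → φ (edge i) ≢ c)

  data Path : List Item → Set where
    []   : Path []
    [-]  : Path [ i ]
    _∷_  : parent i ≡ vertex j → Path (j ∷ S) → Path (i ∷ j ∷ S)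

  -- All colourings are quantified over because the induction hypothesis is applied after Kempe
  -- changes.
  Robust : List Item → Set
  Robust T = ∀ φ → Proper φ → Tash φ T → Elementary φ T

  verts-++ʳ : ∀ L → v ∈ verts R → v ∈ verts (L ++ R)
  verts-++ʳ [] v∈ = v∈
  verts-++ʳ (i ∷ L) v∈ = there (verts-++ʳ L v∈)

  missed-++ʳ : ∀ L → MissedBy φ R c → MissedBy φ (L ++ R) c
  missed-++ʳ L (v , v∈ , m) = v , verts-++ʳ L v∈ , m

  verts-++⁻ : ∀ L → v ∈ verts (L ++ R) → (∃[ i ] (i ∈ L × v ≡ vertex i)) ⊎ v ∈ verts R
  verts-++⁻ [] v∈ = inj₂ v∈
  verts-++⁻ (i ∷ L) (here e) = inj₁ (i , here refl , e)
  verts-++⁻ (i ∷ L) (there v∈) with verts-++⁻ L v∈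
  ... | inj₁ (j , j∈ , e) = inj₁ (j , there j∈ , e)
  ... | inj₂ p = inj₂ p

  x∈ : ∀ T → x ∈ verts T
  x∈ [] = here refl
  x∈ (i ∷ T) = there (x∈ T)

  y∈ : ∀ T → y ∈ verts T
  y∈ [] = there (here refl)
  y∈ (i ∷ T) = there (y∈ T)

  tash-++ʳ : ∀ L → Tash φ (L ++ R) → Tash φ R
  tash-++ʳ [] t = t
  tash-++ʳ (i ∷ L) (add _ _ _ _ t) = tash-++ʳ L t

  path-++ʳ : ∀ L → Path (L ++ S) → Path S
  path-++ʳ [] p = p
  path-++ʳ (i ∷ []) [-] = []
  path-++ʳ (i ∷ []) (_ ∷ p) = p
  path-++ʳ (i ∷ j ∷ L) (_ ∷ p) = path-++ʳ (j ∷ L) p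

  verts-unique : Tash φ T → Unique (verts T)
  verts-unique [] = (x≢y ∷ []) ∷ [] ∷ []
  verts-unique (add _ z∉ _ _ t) = All.tabulate (λ v∈ e → z∉ (subst (_∈ _) (sym e) v∈)) ∷ verts-unique t

  verts-length : ∀ T → length (verts T) ≡ length T + 2
  verts-length T = trans (length-++ (map vertex T)) (cong (_+ 2) (length-map vertex T))

  item-joins : Tash φ T → i ∈ T →
    parent i ∈ verts T × vertex i ∈ verts T × Joins H (edge i) (parent i) (vertex i)
  item-joins (add p _ j _ t) (here refl) = there p , here refl , j
  item-joins (add _ _ _ _ t) (there i∈) with item-joins t i∈
  ... | p , q , j = there p , there q , j

  item-colour : Tash φ T → i ∈ T → MissedBy φ T (φ (edge i))
  item-colour {T = l ∷ _} (add _ _ _ m t) (here refl) = missed-++ʳ [ l ] m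
  item-colour {T = l ∷ _} (add _ _ _ m t) (there i∈) = missed-++ʳ [ l ] (item-colour t i∈)

  -- A colour used on the tree is missed by a vertex older than the top; if the top missed it too,
  -- the tree would not be elementary.
  top-unused : Elementary φ (i ∷ T) → Tash φ (i ∷ T) → Miss φ θ (vertex i) → Unused φ θ (i ∷ T)
  top-unused {φ} {i} {T} {θ} el (add _ z∉ j _ t) m = m (edge i) (joins-incʳ j) ∷ All.tabulate rest
    where
    rest : ∀ {l} → l ∈ T → φ (edge l) ≢ θ
    rest l∈ e with item-colour t l∈
    ... | v , v∈ , mv = z∉ (subst (_∈ verts T)
            (el (there v∈) (here refl) (subst (λ c → Miss φ c v) e mv) m) v∈)

  similar-unused : Similar a b φ ψ → Unused φ a T → Unused φ b T →
                   All (λ i → ψ (edge i) ≡ φ (edge i)) T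
  similar-unused sim [] [] = []
  similar-unused sim (p ∷ ps) (q ∷ qs) = agree sim _ p q ∷ similar-unused sim ps qs

  unused-cong : All (λ i → ψ (edge i) ≡ φ (edge i)) T → Unused φ c T → Unused ψ c T
  unused-cong [] [] = []
  unused-cong (e ∷ es) (u ∷ us) = (λ q → u (trans (sym e) q)) ∷ unused-cong es us

  tash-similar : Similar a b φ ψ → Unused φ a R → Unused φ b R → Tash φ R → Tash ψ R
  tash-similar sim [] [] [] = []
  tash-similar {ψ = ψ} sim (p ∷ ps) (q ∷ qs) (add pa z∉ j (v , v∈ , m) t) =
    add pa z∉ j (v , v∈ , subst (λ c → Miss ψ c v) (sym (agree sim _ p q)) (miss-other sim p q m))
      (tash-similar sim ps qs t)

  -- The lower part `R` avoids both colours and is unaffected. Above it edges may change between `a`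
  -- and `b`, which is harmless as both are missed in `R` afterwards.
  tash-similar-++ : ∀ L → Similar a b φ ψ → Unused φ a R → Unused φ b R →
                    MissedBy ψ R a → MissedBy ψ R b → Tash φ (L ++ R) → Tash ψ (L ++ R)
  tash-similar-++ [] sim ua ub ma mb t = tash-similar sim ua ub t
  tash-similar-++ {a} {b} {φ} {ψ} {R} (i ∷ L) sim ua ub ma mb (add pa z∉ j (v , v∈ , m) t) =
    add pa z∉ j missed (tash-similar-++ L sim ua ub ma mb t)
    where
    missed : MissedBy ψ (L ++ R) (ψ (edge i))
    missed with one-of? a b (φ (edge i))
    ... | no p = v , v∈ , subst (λ c → Miss ψ c v) (sym (agree sim _ (p ∘ inj₁) (p ∘ inj₂)))
                   (miss-other sim (p ∘ inj₁) (p ∘ inj₂) m)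
    ... | yes p with within sim _ p
    ...   | inj₁ e = subst (MissedBy ψ (L ++ R)) (sym e) (missed-++ʳ L ma)
    ...   | inj₂ e = subst (MissedBy ψ (L ++ R)) (sym e) (missed-++ʳ L mb)

  tash-cong : (∀ {i} → i ∈ T → ψ (edge i) ≡ φ (edge i)) →
              (∀ {i v} → i ∈ T → v ∈ verts T → Miss φ (φ (edge i)) v → Miss ψ (φ (edge i)) v) →
              Tash φ T → Tash ψ T
  tash-cong e m [] = []
  tash-cong {ψ = ψ} e m (add pa z∉ j (v , v∈ , mv) t) =
    add pa z∉ j (v , v∈ , subst (λ c → Miss ψ c v) (sym (e (here refl))) (m (here refl) (there v∈) mv))
      (tash-cong (e ∘ there) (λ i∈ v∈ → m (there i∈) (there v∈)) t)

  -- The edge of `i` is a whole Kempe chain, so it may receive γ. Then `w` misses its old colour,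
  -- and so does the older vertex `o` that allowed the edge. As `T` is elementary, `o` is `w`; but
  -- `w` is an end of that edge.
  recolour : Robust T → Proper φ → Tash φ (i ∷ T) → parent i ≡ w → Unused φ γ T →
             Miss φ γ w → Miss φ γ (vertex i) → ⊥
  recolour {T} {φ} {i} {w} {γ} rob pr (add w∈ z∉ j (o , o∈ , mo) t) refl unused mw mz =
    mo f (subst (Incident H f) (sym o≡w) (joins-incˡ j)) refl
    where
    f = edge i
    P : V → Set
    P v = v ≡ w ⊎ v ≡ vertex i
    P? : ∀ v → Dec (P v)
    P? v = (v ≟ᶠ w) ⊎-dec (v ≟ᶠ vertex i)
    closed : Closed φ γ (φ f) P
    closed g _ v j' (inj₁ e) (inj₁ refl) = ⊥-elim (mw g (joins-incˡ j') e)
    closed g _ v j' (inj₁ e) (inj₂ refl) = ⊥-elim (mz g (joins-incˡ j') e)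
    closed g _ v j' (inj₂ e) (inj₁ refl) with same-edge pr (joins-incˡ j') (joins-incˡ j) e
    ... | refl = inj₂ (joins-functional j' j)
    closed g _ v j' (inj₂ e) (inj₂ refl) with same-edge pr (joins-incˡ j') (joins-incʳ j) e
    ... | refl = inj₁ (joins-functional j' (joins-sym j))
    open SwapOn φ γ (φ f) P? closed
    not-z : ∀ {v} → v ∈ verts T → v ≢ vertex i
    not-z v∈ refl = z∉ v∈
    out : ∀ {v} → v ∈ verts T → v ≢ w → ¬ P v
    out v∈ v≢w (inj₁ e) = v≢w e
    out v∈ v≢w (inj₂ e) = not-z v∈ e
    unchanged : ∀ {l} → l ∈ T → swapped (edge l) ≡ φ (edge l)
    unchanged {l} l∈ with item-joins t l∈
    ... | p∈ , v∈ , jl with incident? (edge l) w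
    ... | no ¬i = outside (joins-incˡ jl) (out p∈ λ { refl → ¬i (joins-incˡ jl) })
    ... | yes il = agree similar _ (All.lookup unused l∈) λ e →
            case same-edge pr il (joins-incˡ j) e of λ where
              refl → case incident-end jl (joins-incʳ j) of λ where
                (inj₁ z≡) → z∉ (subst (_∈ verts T) (sym z≡) p∈)
                (inj₂ z≡) → z∉ (subst (_∈ verts T) (sym z≡) v∈)
    still : ∀ {l v} → l ∈ T → v ∈ verts T → Miss φ (φ (edge l)) v → Miss swapped (φ (edge l)) v
    still {l} {v} l∈ v∈ m with v ≟ᶠ w
    ... | no v≢w = miss-outside (out v∈ v≢w) m
    ... | yes refl = miss-other similar (All.lookup unused l∈) (λ e → m f (joins-incˡ j) (sym e)) m
    o≢w : o ≢ w
    o≢w refl = mo f (joins-incˡ j) refl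
    o≡w : o ≡ w
    o≡w = rob swapped (swapped-proper pr) (tash-cong unchanged still t) o∈ w∈
            (miss-outside (out o∈ o≢w) mo) (miss-insideˡ (inj₁ refl) mw)

  record Moved (φ : E → Colour) (γ θ : Colour) (u w : V) : Set where
    field
      new    : E → Colour
      proper : Proper new
      sim    : Similar γ θ φ new
      miss-w : Miss new γ w
      miss-u : Miss new θ u
      keep   : ∀ {v c} → v ≢ u → v ≢ w → Miss φ c v → Miss new c v
      fixed  : ∀ {v f} → v ≢ u → v ≢ w → Miss φ γ v → Incident H f v → new f ≡ φ f

  -- The (γ,θ)-chain from `u` must end at `w`, since otherwise its exchange would leave θ missed by
  -- both. Hence the exchange passes γ from `u` to `w` and affects the missed colours of no other
  -- vertex.
  move : Robust R → Proper φ → Tash φ R → u ∈ verts R → w ∈ verts R → u ≢ w →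
         Miss φ γ u → Miss φ θ w → Unused φ γ R → Unused φ θ R → Moved φ γ θ u w
  move {R} {φ} {u} {w} {γ} {θ} rob pr t u∈ w∈ u≢w mu mw uγ uθ
    with chain pr (λ { refl → u≢w (rob φ pr t u∈ w∈ mu mw) }) mu
  ... | ch with Chain.last ch ≟ᶠ w
  ...   | no l≢w = ⊥-elim (u≢w (rob swapped (swapped-proper pr) (tash-similar similar uγ uθ t) u∈ w∈
                      (miss-insideˡ (ends-∈ start) mu) (miss-outside w∉ mw)))
    where
    open Chain ch
    open SwapOn φ γ θ in? closed
    w∉ : w ∉ last ∷ body
    w∉ w∈c with ends w∈c (inj₂ mw)
    ... | inj₁ e = u≢w (sym e)
    ... | inj₂ e = l≢w (sym e)
  ...   | yes refl = record
    { new = swapped ; proper = swapped-proper pr ; sim = similar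
    ; miss-w = miss-insideʳ (here refl) mw
    ; miss-u = miss-insideˡ (ends-∈ start) mu
    ; keep = keep
    ; fixed = λ v≢u v≢w m i → outside i (λ v∈ → [ v≢u , v≢w ]′ (ends v∈ (inj₁ m)))
    }
    where
    open Chain ch
    open SwapOn φ γ θ in? closed
    keep : ∀ {v c} → v ≢ u → v ≢ last → Miss φ c v → Miss swapped c v
    keep {v} {c} v≢u v≢w m with in? v
    ... | no v∉ = miss-outside v∉ m
    ... | yes v∈ = miss-other similar
          (λ { refl → [ v≢u , v≢w ]′ (ends v∈ (inj₁ m)) })
          (λ { refl → [ v≢u , v≢w ]′ (ends v∈ (inj₂ m)) }) m

  data Tip : List Item → V → Set where
    bare : Tip [] v
    tip  : Tip (i ∷ S) (vertex i)

  attach : ∀ {p f q} → Path S → Tip S p → Path (item p f q ∷ S)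
  attach [] bare = [-]
  attach [-] tip = refl ∷ [-]
  attach (e ∷ p) tip = refl ∷ (e ∷ p)

  follow : ∀ S {p ts} → MissedBy φ R a → MissedBy φ R b → Path S → Tip S p → p ∈ verts (S ++ R) →
           Tash φ (S ++ R) → Linked (Step φ a b) (p ∷ ts) → Unique ts → All (_∉ verts (S ++ R)) ts →
           EndsIn z (p ∷ ts) →
           ∃[ S' ] (Path S' × Tash φ (S' ++ R) × z ∈ verts (S' ++ R))
  follow S ma mb ps tp p∈ t [-] _ _ end = S , ps , t , p∈
  follow {φ = φ} {R} S {p} {q ∷ ts} ma mb ps tp p∈ t ((f , j , o) ∷ l) (q∉ ∷ uq) (q∉S ∷ os) (skip e) =
    follow (item p f q ∷ S) ma mb (attach ps tp) tip (here refl)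
      (add p∈ q∉S j
        ([ (λ { refl → missed-++ʳ S ma }) , (λ { refl → missed-++ʳ S mb }) ]′ o) t)
      l uq (All.zipWith (λ { (q≢ , ∉S) (here refl) → q≢ refl ; (q≢ , ∉S) (there r) → ∉S r }) (q∉ , os)) e

  -- The (γ,θ)-chain starting at a vertex z outside the tree R never meets R, since otherwise the
  -- part of it between R and z would extend R by a path to a tree that is not elementary.
  record Away (φ : E → Colour) (R : List Item) (γ θ : Colour) (z : V) : Set where
    field
      new    : E → Colour
      proper : Proper new
      sim    : Similar γ θ φ new
      miss-z : Miss new θ z
      keep   : ∀ {v c} → v ∈ verts R → Miss φ c v → Miss new c v
      fixed  : ∀ {v f} → v ∈ verts R → Incident H f v → new f ≡ φ f

  away : (∀ S → Path S → Robust (S ++ R)) → Proper φ → Tash φ R → z ∉ verts R → γ ≢ θ →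
         MissedBy φ R γ → MissedBy φ R θ → Miss φ γ z → Away φ R γ θ z
  away {R} {φ} {z} {γ} {θ} rob pr t z∉ γ≢θ mγ mθ mz
    with Grow.grow {Q = _∈ verts R} (_∈? verts R) φ pr γ θ γ≢θ z mz
  ... | h , ts , c , d , F , inj₁ h∈ with Front.unique F
  ...   | _ ∷ uq with follow [] mγ mθ [] bare h∈ t (Front.linked F) uq (Front.avoids F) (Front.start F)
  ...     | S , ps , tS , z∈ with mγ
  ...       | w , w∈ , mw = ⊥-elim (z∉ (subst (_∈ verts R)
                (rob S ps φ pr tS (verts-++ʳ S w∈) z∈ mw mz) w∈))
  away {R} {φ} {z} {γ} {θ} rob pr t z∉ γ≢θ mγ mθ mz
      | h , ts , c , d , F , inj₂ (h∉ , mc) = record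
    { new = swapped ; proper = swapped-proper pr ; sim = similar
    ; miss-z = miss-insideˡ (ends-∈ (Front.start F)) mz
    ; keep = λ v∈ → miss-outside (out v∈)
    ; fixed = λ v∈ i → outside i (out v∈) }
    where
    open SwapOn φ γ θ (λ v → v ∈? (h ∷ ts)) (front-closed F mc)
    out : ∀ {v} → v ∈ verts R → v ∉ h ∷ ts
    out v∈ (here refl) = h∉ v∈
    out v∈ (there v∈ts) = All.lookup (Front.avoids F) v∈ts v∈

  topv : List Item → Item → V
  topv [] j = vertex j
  topv (i ∷ _) j = vertex i

  top-fresh : ∀ L → Tash φ (L ++ j ∷ R) → topv L j ∉ verts R
  top-fresh [] (add _ z∉ _ _ _) = z∉
  top-fresh {j = j} (i ∷ L) (add _ z∉ _ _ _) z∈ = z∉ (verts-++ʳ L (there z∈))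

  top-∈ : ∀ L → topv L j ∈ verts (L ++ j ∷ R)
  top-∈ [] = here refl
  top-∈ (i ∷ L) = here refl

  path-∷ʳ : ∀ L {l} → Path (L ++ [ j ]) → parent j ≡ vertex l → Path (L ++ j ∷ l ∷ [])
  path-∷ʳ [] [-] e = e ∷ [-]
  path-∷ʳ (i ∷ []) (e' ∷ p) e = e' ∷ path-∷ʳ [] p e
  path-∷ʳ (i ∷ i' ∷ L) (e' ∷ p) e = e' ∷ path-∷ʳ (i' ∷ L) p e

  snoc : ∀ i S → ∃[ L ] ∃[ j ] (i ∷ S ≡ L ++ [ j ] × topv L j ≡ vertex i × length L ≡ length S)
  snoc i [] = [] , i , refl , refl , refl
  snoc i (i' ∷ S) with snoc i' S
  ... | L , j , e , _ , el = i ∷ L , j , cong (i ∷_) e , refl , cong suc el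

-- Tashkinov's theorem

module TashkinovTheorem (H : Multigraph) (k : ℕ) (x y : Vert H) (x≢y : x ≢ y)
  (some : ∀ φ → ProperEdgeColouring H k φ → ∀ v → ∃[ c ] Colourings.Miss H k φ c v)
  (two : ∀ φ → ProperEdgeColouring H k φ → ∀ v → v ∈ x ∷ y ∷ [] →
    ∃[ c ] ∃[ d ] (c ≢ d × Colourings.Miss H k φ c v × Colourings.Miss H k φ d v))
  (no-common : ∀ φ → ProperEdgeColouring H k φ → ∀ c → Colourings.Miss H k φ c x → Colourings.Miss H k φ c y → ⊥)
  where

  open Colourings H k
  open TashkinovTrees H k x y x≢y

  private variable
    φ : E → Colour
    c : Colour
    B T : List Item

  second : ∀ φ → Proper φ → ∀ v → v ∈ x ∷ y ∷ [] → ∀ e → ∃[ c ] (Miss φ c v × c ≢ e)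
  second φ pr v v∈ e with two φ pr v v∈
  ... | c , d , c≢d , mc , md with c ≟ᶠ e
  ...   | no c≢e = c , mc , c≢e
  ...   | yes refl = d , md , c≢d ∘ sym

  -- There is room because an elementary tree with t vertices misses at least t + 2 colours:
  -- both ends of the uncoloured edge miss two.
  pick : Proper φ → Tash φ T → Elementary φ T → ∀ (forbidden : List Colour) →
         length forbidden < length T + 4 → ∃[ δ ] (MissedBy φ T δ × δ ∉ forbidden)
  pick {φ} {T} pr t el forbidden lt
    with pick-outside (cx ∷ cy ∷ map choice (verts T)) forbidden uq
           (subst (length forbidden <_) (sym len) lt)
    where
    choice : V → Colour
    choice v = proj₁ (some φ pr v)
    choice-miss : ∀ v → Miss φ (choice v) v
    choice-miss v = proj₂ (some φ pr v)
    sx = second φ pr x (here refl) (choice x)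
    sy = second φ pr y (there (here refl)) (choice y)
    cx = proj₁ sx
    cy = proj₁ sy
    len : length (cx ∷ cy ∷ map choice (verts T)) ≡ length T + 4
    len = trans (cong (2 +_) (trans (length-map choice (verts T)) (verts-length T)))
            (trans (+-comm 2 (length T + 2)) (+-assoc (length T) 2 2))
    new-at : ∀ {v c} → v ∈ verts T → Miss φ c v → c ≢ choice v → All (c ≢_) (map choice (verts T))
    new-at v∈ m c≢ = All.map⁺ (All.tabulate λ {q} q∈ e →
      c≢ (trans e (cong choice (el q∈ v∈ (choice-miss q) (subst (λ c → Miss φ c _) e m)))))
    uq : Unique (cx ∷ cy ∷ map choice (verts T))
    uq = ((λ e → no-common φ pr cx (proj₁ (proj₂ sx)) (subst (λ c → Miss φ c y) (sym e) (proj₁ (proj₂ sy))))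
           ∷ new-at (x∈ T) (proj₁ (proj₂ sx)) (proj₂ (proj₂ sx)))
         ∷ new-at (y∈ T) (proj₁ (proj₂ sy)) (proj₂ (proj₂ sy))
         ∷ unique-map choice (λ {p} {q} p∈ q∈ e → el p∈ q∈ (choice-miss p)
             (subst (λ c → Miss φ c q) (sym e) (choice-miss q))) (verts-unique t)
  ... | δ , here refl , δ∉ = δ , (x , x∈ T , proj₁ (proj₂ (second φ pr x (here refl) _))) , δ∉
  ... | δ , there (here refl) , δ∉ =
          δ , (y , y∈ T , proj₁ (proj₂ (second φ pr y (there (here refl)) _))) , δ∉
  ... | δ , there (there δ∈) , δ∉ with ∈-map⁻ _ δ∈
  ...   | v , v∈ , refl = δ , (v , v∈ , proj₂ (some φ pr v)) , δ∉

  colours-of : (E → Colour) → List Item → List Colour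
  colours-of φ = map (φ ∘ edge)

  not-used : ∀ T → c ∉ colours-of φ T → Unused φ c T
  not-used [] c∉ = []
  not-used (i ∷ T) c∉ = (λ e → c∉ (here (sym e))) ∷ not-used T (c∉ ∘ there)

  robust-root : Robust []
  robust-root φ pr t (here refl) (here refl) mu mv = refl
  robust-root φ pr t (here refl) (there (here refl)) mu mv = ⊥-elim (no-common φ pr _ mu mv)
  robust-root φ pr t (there (here refl)) (here refl) mu mv = ⊥-elim (no-common φ pr _ mv mu)
  robust-root φ pr t (there (here refl)) (there (here refl)) mu mv = refl

  -- Each round passes γ from `j` to its successor `l` on the path, by a chain in γ and a colour
  -- missed by `l`, until the two vertices that miss γ are parent and child and `recolour` applies.
  path-clash : ∀ {m U} → (∀ S → length S ≤ m → Path S → Robust (S ++ B)) → Reverse U →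
    ∀ {φ i j S γ} → Proper φ → Path (i ∷ U ++ j ∷ S) → length (U ++ j ∷ S) ≤ m →
    Tash φ (i ∷ U ++ j ∷ S ++ B) → Miss φ γ (vertex j) → Miss φ γ (vertex i) → ⊥
  path-clash {B} ih [] {φ} {i} {j} {S} pr (e ∷ p) le t@(add _ _ _ _ t') mj mi =
    recolour rob pr t e (top-unused (rob φ pr t') t' mj) mj mi
    where rob = ih (j ∷ S) le p
  path-clash {B} {m} ih (U ∶ rs ∶ʳ l) {φ} {i} {j} {S} {γ} pr p le t mj mi =
    path-clash ih rs (proper mv) p' le' (tash-similar-++ (i ∷ U) (sim mv) uγ uθ
        (vertex l , here refl , miss-w mv) (vertex j , there (here refl) , miss-u mv) t')
      (miss-w mv) (keep mv (∉⇒≢ z∉ (verts-++ʳ U (there (here refl))))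
                           (∉⇒≢ z∉ (verts-++ʳ U (here refl))) mi)
    where
    open Moved
    tree = l ∷ j ∷ S ++ B
    p' : Path (i ∷ U ++ l ∷ j ∷ S)
    p' = subst (λ W → Path (i ∷ W)) (∷ʳ-++ U l (j ∷ S)) p
    le' : length (U ++ l ∷ j ∷ S) ≤ m
    le' = subst (λ W → length W ≤ m) (∷ʳ-++ U l (j ∷ S)) le
    t' : Tash φ (i ∷ U ++ tree)
    t' = subst (λ W → Tash φ (i ∷ W)) (∷ʳ-++ U l (j ∷ S ++ B)) t
    z∉ : vertex i ∉ verts (U ++ tree)
    z∉ with add _ q _ _ _ ← t' = q
    pR : Path (l ∷ j ∷ S)
    pR = path-++ʳ (i ∷ U) p'
    leR : length (l ∷ j ∷ S) ≤ m
    leR = ≤-trans (≤-trans (m≤n+m _ (length U)) (≤-reflexive (sym (length-++ U)))) le'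
    robR : Robust tree
    robR = ih (l ∷ j ∷ S) leR pR
    rob : Robust (j ∷ S ++ B)
    rob = ih (j ∷ S) (≤-trans (n≤1+n _) leR) (path-++ʳ [ l ] pR)
    tR : Tash φ tree
    tR = tash-++ʳ (i ∷ U) t'
    tj : Tash φ (j ∷ S ++ B)
    tj = tash-++ʳ [ l ] tR
    l-ok : parent l ≡ vertex j × Joins H (edge l) (parent l) (vertex l) × vertex l ∉ verts (j ∷ S ++ B)
    l-ok with pR | tR
    ... | e ∷ _ | add _ q jn _ _ = e , jn , q
    ϑ = proj₁ (some φ pr (vertex l))
    mθ = proj₂ (some φ pr (vertex l))
    uγ : Unused φ γ tree
    uγ = mj (edge l) (subst (Incident H (edge l)) (proj₁ l-ok) (joins-incˡ (proj₁ (proj₂ l-ok))))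
         ∷ top-unused (rob φ pr tj) tj mj
    uθ : Unused φ ϑ tree
    uθ = top-unused (robR φ pr tR) tR mθ
    mv = move robR pr tR (there (here refl)) (here refl)
           (λ e → proj₂ (proj₂ l-ok) (subst (_∈ verts (j ∷ S ++ B)) e (here refl))) mj mθ uγ uθ

  -- A colour missed in the base is passed to the first vertex of the path, which turns the clash
  -- into one within the path.
  enter-path : ∀ L {j φ γ w} → (∀ S → length S ≤ length L → Path S → Robust (S ++ B)) → Proper φ →
    Path (L ++ [ j ]) → 1 ≤ length L → Tash φ (L ++ j ∷ B) → Unused φ γ (j ∷ B) → w ∈ verts B →
    Miss φ γ w → Miss φ γ (topv L j) → ⊥
  enter-path {B} (i ∷ L) {j} {φ} {γ} {w} ih pr p le t@(add _ z∉ _ _ _) uγ w∈ mw mz =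
    path-clash ih (reverseView L) (proper mv) p (≤-reflexive (trans (length-++ L) (+-comm (length L) 1)))
      (tash-similar-++ (i ∷ L) (sim mv) uγ uθ (vertex j , here refl , miss-w mv)
        (w , there w∈ , miss-u mv) t)
      (miss-w mv) (keep mv (∉⇒≢ z∉ (verts-++ʳ L (there w∈)))
                           (∉⇒≢ z∉ (verts-++ʳ L (here refl))) mz)
    where
    open Moved
    rob : Robust (j ∷ B)
    rob = ih [ j ] (s≤s z≤n) [-]
    tj : Tash φ (j ∷ B)
    tj = tash-++ʳ (i ∷ L) t
    ϑ = proj₁ (some φ pr (vertex j))
    mθ = proj₂ (some φ pr (vertex j))
    uθ : Unused φ ϑ (j ∷ B)
    uθ = top-unused (rob φ pr tj) tj mθ
    w≢ : w ≢ vertex j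
    w≢ with add _ q _ _ _ ← tj = λ e → q (subst (_∈ verts B) e w∈)
    mv = move rob pr tj (there w∈) (here refl) w≢ mw mθ uγ uθ

  parent-clash : ∀ L {j φ γ} → (∀ S → length S ≤ length L → Path S → Robust (S ++ [])) → Proper φ →
    Path (L ++ [ j ]) → Tash φ (L ++ j ∷ []) → Miss φ γ (parent j) → Miss φ γ (topv L j) → ⊥
  parent-clash [] ih pr p t mp mz = recolour robust-root pr t refl [] mp mz
  parent-clash (i ∷ L) {j} ih pr p t mp mz with tash-++ʳ (i ∷ L) t
  ... | add p∈ _ jn _ _ =
          enter-path (i ∷ L) ih pr p (s≤s z≤n) t (mp (edge j) (joins-incˡ jn) ∷ []) p∈ mp mz

  -- If the path starts at the other end of the uncoloured edge, γ is first passed there; the root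
  -- has no coloured edges that could obstruct the exchange.
  root-clash : ∀ L {j φ γ w} → (∀ S → length S ≤ length L → Path S → Robust (S ++ [])) → Proper φ →
    Path (L ++ [ j ]) → Tash φ (L ++ j ∷ []) → w ∈ verts [] → Miss φ γ w → Miss φ γ (topv L j) → ⊥
  root-clash L {j} {φ} {γ} {w} ih pr p t w∈ mw mz with parent j ≟ᶠ w
  ... | yes refl = parent-clash L ih pr p t mw mz
  ... | no ne = parent-clash L ih (proper mv) p t' (miss-w mv)
          (keep mv (∉⇒≢ z∉ w∈) (∉⇒≢ z∉ b∈) mz)
    where
    open Moved
    b∈ : parent j ∈ verts []
    b∈ with add q _ _ _ _ ← tash-++ʳ L t = q
    mv = move robust-root pr [] w∈ b∈ (ne ∘ sym) mw (proj₂ (some φ pr (parent j))) [] []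
    t' : Tash (new mv) (L ++ j ∷ [])
    t' = subst (Tash (new mv)) (++-assoc L [ j ] []) (tash-similar-++ (L ++ [ j ]) (sim mv) [] []
           (parent j , b∈ , miss-w mv) (w , w∈ , miss-u mv) (subst (Tash φ) (sym (++-assoc L [ j ] [])) t))
    z∉ = top-fresh L t

  -- The base of the tree is l ∷ B, and j is the item that joins the path part to the base.
  module Attached {n : ℕ} (l : Item) (B : List Item) (j : Item)
    (len : length B ≤ n)
    (ihB : ∀ B S → length B ≤ n → Path S → Robust (S ++ B))
    (j∈ : parent j ∈ verts B)
    where

    base : List Item
    base = l ∷ B

    robust-base : Robust base
    robust-base = ihB B [ l ] len [-]

    record Spare (φ : E → Colour) (γ c : Colour) : Set where
      field
        δ      : Colour
        owner  : V
        owner∈ : owner ∈ verts B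
        missed : Miss φ δ owner
        unused : Unused φ δ base
        δ≢γ    : δ ≢ γ
        δ≢c    : δ ≢ c

    spare : ∀ φ γ c → Proper φ → Tash φ base → Spare φ γ c
    spare φ γ c pr (add _ _ _ _ t)
      with pick pr t (ihB B [] len [] φ pr t) (γ ∷ c ∷ colours-of φ base)
             -- Forbidden are `γ`, `c` and the colours of the `length B + 1` edges of the base: one
             -- colour below the limit of `pick`.
             (subst₂ _<_ (cong (3 +_) (sym (length-map (φ ∘ edge) B))) (+-comm 4 (length B)) ≤-refl)
    ... | δ , (v , v∈ , m) , δ∉ = record
      { owner∈ = v∈ ; missed = m ; unused = not-used base (δ∉ ∘ there ∘ there)
      ; δ≢γ = λ e → δ∉ (here e) ; δ≢c = λ e → δ∉ (there (here e)) }

    -- Here j can be attached to B already, and j ∷ B is elementary by induction.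
    clash-early : ∀ {φ γ w} → Proper φ → Tash φ (j ∷ base) → MissedBy φ B (φ (edge j)) →
      Unused φ γ base → φ (edge j) ≢ γ → w ∈ verts base → Miss φ γ w → Miss φ γ (vertex j) → ⊥
    clash-early {φ} pr (add _ z∉ jn _ (add _ _ _ _ t)) mc uγ c≢γ (there w∈) mw mz =
      z∉ (there (subst (_∈ verts B)
        (ihB B [ j ] len [-] φ pr (add j∈ (z∉ ∘ there) jn mc t) (there w∈) (here refl) mw mz) w∈))
    clash-early {φ} {γ} pr (add _ z∉ jn _ tl@(add _ l∉ _ _ t)) (o , o∈ , mo) uγ@(_ ∷ uγB) c≢γ (here refl) mw mz =
      z∉ (there (subst (_∈ verts B)
        (ihB B [ j ] len [-] (new mv) (proper mv) (add j∈ (z∉ ∘ there) jn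
           (o , o∈ , subst (λ c → Miss (new mv) c o) (sym same) (miss-other (sim mv) c≢γ (δ≢c ∘ sym) mo))
           (tash-similar (sim mv) uγB (All.tail unused) t))
          (there owner∈) (here refl) (miss-w mv) (keep mv z≢l z≢o mz)) owner∈))
      where
      open Moved
      open Spare (spare φ γ (φ (edge j)) pr tl)
      z≢l : vertex j ≢ vertex l
      z≢l = ∉⇒≢ z∉ (here refl)
      z≢o : vertex j ≢ owner
      z≢o = ∉⇒≢ z∉ (there owner∈)
      mv = move robust-base pr tl (here refl) (there owner∈)
             (∉⇒≢ l∉ owner∈) mw missed uγ unused
      same : new mv (edge j) ≡ φ (edge j)
      same = fixed mv z≢l z≢o mz (joins-incʳ jn)

    -- Exchanging γ with the colour of the edge of `j` between `w` and `l` makes `w` in `B` miss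
    -- that colour, so that `j` could have been attached before `l`; γ is then missed by `l`.
    clash-late : ∀ {φ γ w} → Proper φ → Tash φ (j ∷ base) → Miss φ (φ (edge j)) (vertex l) →
      Unused φ γ base → w ∈ verts B → Miss φ γ w → Miss φ γ (vertex j) → ⊥
    clash-late {φ} {γ} {w} pr t@(add _ z∉ jn _ tl@(add _ l∉ _ _ _)) mc uγ w∈ mw mz =
      clash-early (proper mv)
        (tash-similar-++ [ j ] (sim mv) uγ uc (vertex l , here refl , miss-w mv) (w , there w∈ , miss-u mv) t)
        (w , w∈ , subst (λ c → Miss (new mv) c w) (sym same) (miss-u mv))
        (unused-cong (similar-unused (sim mv) uγ uc) uγ)
        (λ e → mz (edge j) (joins-incʳ jn) (trans (sym same) e))
        (here refl) (miss-w mv) (keep mv z≢w z≢l mz)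
      where
      open Moved
      uc : Unused φ (φ (edge j)) base
      uc = top-unused (robust-base φ pr tl) tl mc
      z≢l : vertex j ≢ vertex l
      z≢l = ∉⇒≢ z∉ (here refl)
      z≢w : vertex j ≢ w
      z≢w = ∉⇒≢ z∉ (there w∈)
      mv = move robust-base pr tl (there w∈) (here refl)
             (λ e → l∉ (subst (_∈ verts B) e w∈)) mw mc uγ uc
      same : new mv (edge j) ≡ φ (edge j)
      same = fixed mv z≢w z≢l mz (joins-incʳ jn)

    -- The cases ask whether `l` or a vertex of `B` misses the colour of the edge of `j`, and which
    -- of them misses γ. If `l` misses both, γ is first passed to the owner of a spare colour in
    -- `B`.
    clash-single : ∀ {φ γ w} → Proper φ → Tash φ (j ∷ base) →
      Unused φ γ base → φ (edge j) ≢ γ → w ∈ verts base → Miss φ γ w → Miss φ γ (vertex j) → ⊥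
    clash-single pr t@(add _ _ _ (o , there o∈ , mo) _) uγ c≢γ w∈ mw mz =
      clash-early pr t (o , o∈ , mo) uγ c≢γ w∈ mw mz
    clash-single pr t@(add _ _ _ (o , here refl , mo) _) uγ c≢γ (there w∈) mw mz =
      clash-late pr t mo uγ w∈ mw mz
    clash-single {φ} {γ} pr t@(add _ z∉ jn (o , here refl , mo) tl@(add _ l∉ _ _ _)) uγ c≢γ (here refl) mw mz =
      clash-late (proper mv)
        (tash-similar-++ [ j ] (sim mv) uγ unused (owner , there owner∈ , miss-w mv)
          (vertex l , here refl , miss-u mv) t)
        (subst (λ c → Miss (new mv) c (vertex l)) (sym same) (miss-other (sim mv) c≢γ (δ≢c ∘ sym) mo))
        (unused-cong (similar-unused (sim mv) uγ unused) uγ)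
        owner∈ (miss-w mv) (keep mv z≢l z≢o mz)
      where
      open Moved
      open Spare (spare φ γ (φ (edge j)) pr tl)
      z≢l : vertex j ≢ vertex l
      z≢l = ∉⇒≢ z∉ (here refl)
      z≢o : vertex j ≢ owner
      z≢o = ∉⇒≢ z∉ (there owner∈)
      mv = move robust-base pr tl (here refl) (there owner∈)
             (∉⇒≢ l∉ owner∈) mw missed uγ unused
      same : new mv (edge j) ≡ φ (edge j)
      same = fixed mv z≢l z≢o mz (joins-incʳ jn)

    module WithPath (L : List Item) (path : Path (L ++ [ j ]))
      (ihS : ∀ S → length S ≤ length L → Path S → Robust (S ++ base))
      where

      top : V
      top = topv L j

      module _ {φ : E → Colour} (t : Tash φ (L ++ j ∷ base)) where

        tj : Tash φ (j ∷ base)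
        tj = tash-++ʳ L t

        tbase : Tash φ base
        tbase = tash-++ʳ [ j ] tj

        z∉base : top ∉ verts base
        z∉base = top-fresh L t

      clash-unused : ∀ {φ γ w} → Proper φ → Tash φ (L ++ j ∷ base) →
        Unused φ γ base → φ (edge j) ≢ γ → w ∈ verts base → Miss φ γ w → Miss φ γ top → ⊥
      clash-unused pr t uγ c≢γ w∈ mw mz = by-cases L path ihS t mz
        where
        by-cases : ∀ L → Path (L ++ [ j ]) → (∀ S → length S ≤ length L → Path S → Robust (S ++ base)) →
                   Tash _ (L ++ j ∷ base) → Miss _ _ (topv L j) → ⊥
        by-cases [] _ _ t mz = clash-single pr t uγ c≢γ w∈ mw mz
        by-cases (i ∷ L) p ih t mz = enter-path (i ∷ L) ih pr p (s≤s z≤n) t (c≢γ ∷ uγ) w∈ mw mz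

      to-base : ∀ {R} → (∃[ L' ] L' ++ R ≡ base) → ∃[ L' ] L' ++ R ≡ L ++ j ∷ base
      to-base {R} (L' , e) = L ++ j ∷ L' , trans (++-assoc L (j ∷ L') R) (cong (λ W → L ++ j ∷ W) e)

      verts-base : ∀ {R v} → (∃[ L' ] L' ++ R ≡ base) → v ∈ verts R → v ∈ verts base
      verts-base (L' , e) v∈ = subst (λ W → _ ∈ verts W) e (verts-++ʳ L' v∈)

      -- By `away` the chain from `top` does not meet `R`, so `top` trades γ for δ while `R` keeps
      -- its colours. Uses of either colour above `R` stay legal because `R` still misses both.
      replace : ∀ {φ γ δ R} → Proper φ → Tash φ (L ++ j ∷ base) → (∃[ L' ] L' ++ R ≡ base) →
        length R ≤ n → MissedBy φ R γ → MissedBy φ R δ → Unused φ γ R → Unused φ δ R → γ ≢ δ →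
        Miss φ γ top → Σ (Away φ R γ δ top) λ aw → Tash (Away.new aw) (L ++ j ∷ base)
      replace {φ} {R = R} pr t sub lenR mγ mδ uγ uδ γ≢δ mz
        with away (λ S → ihB R S lenR) pr (tash-++ʳ (proj₁ (to-base sub)) t'')
               (z∉base t ∘ verts-base sub) γ≢δ mγ mδ mz
        where t'' = subst (Tash φ) (sym (proj₂ (to-base sub))) t
      ... | aw = aw , subst (Tash new) (proj₂ (to-base sub))
              (tash-similar-++ (proj₁ (to-base sub)) sim uγ uδ (kept mγ) (kept mδ)
                (subst (Tash φ) (sym (proj₂ (to-base sub))) t))
        where
        open Away aw
        kept : ∀ {c} → MissedBy φ R c → MissedBy new R c
        kept (v , v∈ , m) = v , v∈ , keep v∈ m

      -- If the edge of `j` itself has colour γ, `top` trades γ for a spare δ. That edge has an end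
      -- in `B`, which the chain avoids, so it keeps γ and is now different from the clashing colour
      -- δ.
      clash-below : ∀ {φ γ w} → Proper φ → Tash φ (L ++ j ∷ base) →
        Unused φ γ base → w ∈ verts B → Miss φ γ w → Miss φ γ top → ⊥
      clash-below {φ} {γ} {w} pr t uγ w∈ mw mz with φ (edge j) ≟ᶠ γ
      ... | no c≢γ = clash-unused pr t uγ c≢γ (there w∈) mw mz
      ... | yes refl = clash-unused proper (proj₂ rep)
              (unused-cong (agree sim _ (All.head uγ) (All.head unused) ∷ similar-unused sim (All.tail uγ) (All.tail unused)) unused)
              (λ e → δ≢γ (trans (sym e) (fixed j∈ (joins-incˡ (item-edge (tj t))))))
              (there owner∈) (keep owner∈ missed) miss-z
        where
        open Spare (spare φ γ γ pr (tbase t))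
        item-edge : Tash φ (j ∷ base) → Joins H (edge j) (parent j) (vertex j)
        item-edge (add _ _ jn _ _) = jn
        rep = replace pr t ([ l ] , refl) len (w , w∈ , mw) (owner , owner∈ , missed)
                (All.tail uγ) (All.tail unused) (δ≢γ ∘ sym) mz
        open Away (proj₁ rep)

      clash-base : ∀ {φ γ w} → Proper φ → Tash φ (L ++ j ∷ base) →
        Unused φ γ base → w ∈ verts base → Miss φ γ w → Miss φ γ top → ⊥
      clash-base pr t uγ (there w∈) mw mz = clash-below pr t uγ w∈ mw mz
      clash-base {φ} {γ} pr t uγ (here refl) mw mz =
        clash-below (proper mv)
          (subst (Tash (new mv)) (++-assoc L [ j ] base) (tash-similar-++ (L ++ [ j ]) (sim mv) uγ unused
            (owner , there owner∈ , miss-w mv) (vertex l , here refl , miss-u mv)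
            (subst (Tash φ) (sym (++-assoc L [ j ] base)) t)))
          (unused-cong (similar-unused (sim mv) uγ unused) uγ)
          owner∈ (miss-w mv)
          (keep mv (λ e → z∉base t (here e)) (∉⇒≢ (z∉base t) (there owner∈)) mz)
        where
        open Moved
        open Spare (spare φ γ γ pr (tbase t))
        l∉ : vertex l ∉ verts B
        l∉ with add _ q _ _ _ ← tbase t = q
        mv = move robust-base pr (tbase t) (here refl) (there owner∈)
               (∉⇒≢ l∉ owner∈) mw missed uγ unused

      suffix-length : ∀ U {i R} → U ∷ʳ i ++ R ≡ base → length R ≤ n
      suffix-length U {i} {R} e = ≤-trans (≤-pred (≤-trans (s≤s (m≤n+m (length R) (length U)))
        (≤-reflexive (trans (sym (trans (length-++ U) (+-suc (length U) (length R))))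
          (cong length (trans (sym (∷ʳ-++ U i R)) e)))))) len

      -- Each round replaces γ by a colour whose first use in the base occurs later.
      clash-any : ∀ {U} → Reverse U → ∀ {R φ γ w} → U ++ R ≡ base → Proper φ → Tash φ (L ++ j ∷ base) →
        Unused φ γ R → w ∈ verts base → Miss φ γ w → Miss φ γ top → ⊥
      clash-any [] refl pr t uγ w∈ mw mz = clash-base pr t uγ w∈ mw mz
      clash-any (U ∶ rs ∶ʳ i) {R} {φ} {γ} e pr t uγ w∈ mw mz with φ (edge i) ≟ᶠ γ
      ... | no c≢γ = clash-any rs (trans (sym (∷ʳ-++ U i R)) e) pr t (c≢γ ∷ uγ) w∈ mw mz
      ... | yes refl with tash-++ʳ U (subst (Tash φ) (sym (trans (sym (∷ʳ-++ U i R)) e)) (tbase t))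
      ...   | add p∈ _ jn mγ tR with pick pr tR (ihB R [] (suffix-length U e) [] φ pr tR) (γ ∷ colours-of φ R)
                 (subst₂ _<_ (cong suc (sym (length-map (φ ∘ edge) R))) (+-comm 4 (length R))
                   (s≤s (s≤s (≤-trans (n≤1+n _) (n≤1+n _)))))
      ...     | δ , mδ@(o , o∈ , mo) , δ∉ =
        clash-any rs (trans (sym (∷ʳ-++ U i R)) e) proper (proj₂ rep)
          ((λ e' → δ∉ (here (trans (sym e') (fixed p∈ (joins-incˡ jn)))))
            ∷ unused-cong (similar-unused sim uγ uδ) uδ)
          (verts-base (U ∷ʳ i , e) o∈) (keep o∈ mo) miss-z
        where
        uδ : Unused φ δ R
        uδ = not-used R (δ∉ ∘ there)
        rep = replace pr t (U ∷ʳ i , e) (suffix-length U e) mγ mδ uγ uδ (λ e' → δ∉ (here (sym e'))) mz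
        open Away (proj₁ rep)

  base-clash : ∀ {n} L {j} B → length B ≤ suc n → (∀ B S → length B ≤ n → Path S → Robust (S ++ B)) →
    (∀ S → length S ≤ length L → Path S → Robust (S ++ B)) → Path (L ++ [ j ]) →
    ∀ {φ γ w} → Proper φ → Tash φ (L ++ j ∷ B) → w ∈ verts B → Miss φ γ w → Miss φ γ (topv L j) → ⊥
  base-clash L [] le ihB ihS p pr t w∈ mw mz = root-clash L ihS pr p t w∈ mw mz
  base-clash L {j} (l ∷ B) (s≤s le) ihB ihS p {φ} pr t w∈ mw mz with tash-++ʳ L t
  ... | add (there j∈) _ _ _ _ =
          Attached.WithPath.clash-any l B j le ihB j∈ L p ihS (reverseView (l ∷ B))
            (++-identityʳ (l ∷ B)) pr t [] w∈ mw mz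
  -- Here `j` hangs on `l`, so `l` can be counted to the path, which leaves a shorter base.
  ... | add (here e) _ _ _ _ = top-fresh L t (subst (_∈ verts (l ∷ B))
          (ihB B (L ++ j ∷ l ∷ []) le (path-∷ʳ L p e) φ pr
            (subst (Tash φ) (sym assoc) t) (subst (λ W → _ ∈ verts W) (sym assoc) (verts-++ʳ L (there w∈)))
            (subst (λ W → topv L j ∈ verts W) (sym assoc) (top-∈ L)) mw mz) w∈)
    where
    assoc : (L ++ j ∷ l ∷ []) ++ B ≡ L ++ j ∷ l ∷ B
    assoc = ++-assoc L (j ∷ l ∷ []) B

  extend-path : ∀ B {i S φ} → (∀ S' → length S' ≤ length S → Path S' → Robust (S' ++ B)) →
    (∀ L j → length L ≡ length S → Path (L ++ [ j ]) → Tash φ (L ++ j ∷ B) →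
      ∀ {w c} → w ∈ verts B → Miss φ c w → Miss φ c (topv L j) → ⊥) →
    Path (i ∷ S) → Proper φ → Tash φ (i ∷ S ++ B) → Elementary φ (i ∷ S ++ B)
  extend-path B {i} {S} {φ} rob base-case p pr t = elem
    where
    clash : ∀ {w c} → w ∈ verts (S ++ B) → Miss φ c w → Miss φ c (vertex i) → ⊥
    clash {w} {c} w∈ mw mz with verts-++⁻ S w∈
    ... | inj₁ (j , j∈ , refl) with ∈-∃++ j∈
    ...   | U , S' , eq = path-clash rob (reverseView U) pr
              (subst (λ W → Path (i ∷ W)) eq p) (≤-reflexive (cong length (sym eq)))
              (subst (λ W → Tash φ (i ∷ W)) (trans (cong (_++ B) eq) (++-assoc U (j ∷ S') B)) t) mw mz
    clash {w} {c} w∈ mw mz | inj₂ w∈B with snoc i S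
    ... | L , j , eq , top≡ , len = base-case L j len (subst Path eq p)
            (subst (Tash φ) (trans (cong (_++ B) eq) (++-assoc L [ j ] B)) t) w∈B mw
            (subst (Miss φ c) (sym top≡) mz)
    elem : Elementary φ (i ∷ S ++ B)
    elem (here refl) (here refl) mu mv = refl
    elem (here refl) (there v∈) mu mv = ⊥-elim (clash v∈ mv mu)
    elem (there u∈) (here refl) mu mv = ⊥-elim (clash u∈ mu mv)
    elem (there u∈) (there v∈) mu mv =
      rob S ≤-refl (path-++ʳ [ i ] p) φ pr (tash-++ʳ [ i ] t) u∈ v∈ mu mv

  -- The tree is split into a final path `S` and a base `B`. The induction is on the length of the
  -- base, then on that of the path; an empty path borrows the last item of the base.
  robust : ∀ n m B S → length B ≤ n → length S ≤ m → Path S → Robust (S ++ B)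
  robust n m [] [] leB leS p = robust-root
  robust (suc n) m (l ∷ B) [] (s≤s leB) leS p = robust n 1 B [ l ] leB (s≤s z≤n) [-]
  robust zero (suc m) [] (i ∷ S) leB (s≤s leS) p φ pr t =
    extend-path [] (λ S' le → robust zero m [] S' z≤n (≤-trans le leS))
      (λ L j eq p' t' → root-clash L
        (λ S' le → robust zero m [] S' z≤n (≤-trans (subst (_ ≤_) eq le) leS)) pr p' t') p pr t
  robust (suc n) (suc m) B (i ∷ S) leB (s≤s leS) p φ pr t =
    extend-path B (λ S' le → robust (suc n) m B S' leB (≤-trans le leS))
      (λ L j eq p' t' → base-clash L B leB
        (λ B' S' le → robust n (length S') B' S' le ≤-refl)
        (λ S' le → robust (suc n) m B S' leB (≤-trans (subst (_ ≤_) eq le) leS)) p' pr t') p pr t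

  tashkinov : ∀ {φ} T → Proper φ → Tash φ T → Elementary φ T
  tashkinov T pr t = robust (length T) 0 T [] ≤-refl z≤n [] _ pr t

-- Finite sums

bit : Bool → ℕ
bit b = if b then 1 else 0

⟦_⟧ : ∀ {p} {P : Set p} → Dec P → ℕ
⟦ d ⟧ = bit (does d)

⟦⟧-yes : {P : Set} (d : Dec P) → P → ⟦ d ⟧ ≡ 1
⟦⟧-yes (yes _) p = refl
⟦⟧-yes (no ¬p) p = ⊥-elim (¬p p)

⟦⟧-no : {P : Set} (d : Dec P) → ¬ P → ⟦ d ⟧ ≡ 0
⟦⟧-no (yes p) ¬p = ⊥-elim (¬p p)
⟦⟧-no (no _) ¬p = refl

⟦⟧≤1 : {P : Set} (d : Dec P) → ⟦ d ⟧ ≤ 1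
⟦⟧≤1 (yes _) = ≤-refl
⟦⟧≤1 (no _) = z≤n

⟦⟧≥1 : {P : Set} (d : Dec P) → 1 ≤ ⟦ d ⟧ → P
⟦⟧≥1 (yes p) _ = p

⟦⟧-mono : {P Q : Set} (d : Dec P) (e : Dec Q) → (P → Q) → ⟦ d ⟧ ≤ ⟦ e ⟧
⟦⟧-mono (yes p) e f = ≤-reflexive (sym (⟦⟧-yes e (f p)))
⟦⟧-mono (no _) e f = z≤n

⟦⟧-cong : {P Q : Set} (d : Dec P) (e : Dec Q) → (P → Q) → (Q → P) → ⟦ d ⟧ ≡ ⟦ e ⟧
⟦⟧-cong d e f g = ≤-antisym (⟦⟧-mono d e f) (⟦⟧-mono e d g)

opaque
  ∑ : ∀ {n} → (Fin n → ℕ) → ℕ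
  ∑ {zero} f = 0
  ∑ {suc n} f = f zero + ∑ (f ∘ suc)

opaque
  unfolding ∑

  ∑-suc : ∀ {n} (f : Fin (suc n) → ℕ) → ∑ f ≡ f zero + ∑ (f ∘ suc)
  ∑-suc f = refl

opaque
  unfolding ∑

  ∑-cong : ∀ {n} {f g : Fin n → ℕ} → (∀ i → f i ≡ g i) → ∑ f ≡ ∑ g
  ∑-cong {zero} e = refl
  ∑-cong {suc n} e = cong₂ _+_ (e zero) (∑-cong (e ∘ suc))

opaque
  unfolding ∑

  ∑-distrib-+ : ∀ {n} (f g : Fin n → ℕ) → ∑ (λ i → f i + g i) ≡ ∑ f + ∑ g
  ∑-distrib-+ {zero} f g = refl
  ∑-distrib-+ {suc n} f g = trans (cong (f zero + g zero +_) (∑-distrib-+ (f ∘ suc) (g ∘ suc)))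
    (regroup (f zero) (g zero) (∑ (f ∘ suc)) (∑ (g ∘ suc)))
    where
    regroup : ∀ a b c d → a + b + (c + d) ≡ (a + c) + (b + d)
    regroup = solve-∀

opaque
  unfolding ∑

  ∑-*ʳ : ∀ {n} (f : Fin n → ℕ) c → ∑ (λ i → f i * c) ≡ ∑ f * c
  ∑-*ʳ {zero} f c = refl
  ∑-*ʳ {suc n} f c = trans (cong (f zero * c +_) (∑-*ʳ (f ∘ suc) c)) (sym (*-distribʳ-+ c (f zero) _))

∑-*ˡ : ∀ {n} c (f : Fin n → ℕ) → ∑ (λ i → c * f i) ≡ c * ∑ f
∑-*ˡ c f = trans (∑-cong (λ i → *-comm c (f i))) (trans (∑-*ʳ f c) (*-comm (∑ f) c))

opaque
  unfolding ∑

  ∑-mono : ∀ {n} {f g : Fin n → ℕ} → (∀ i → f i ≤ g i) → ∑ f ≤ ∑ g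
  ∑-mono {zero} le = z≤n
  ∑-mono {suc n} le = +-mono-≤ (le zero) (∑-mono (le ∘ suc))

opaque
  unfolding ∑

  ∑-const : ∀ n c → ∑ {n} (λ _ → c) ≡ n * c
  ∑-const zero c = refl
  ∑-const (suc n) c = cong (c +_) (∑-const n c)

∑-zero : ∀ {n} {f : Fin n → ℕ} → (∀ i → f i ≡ 0) → ∑ f ≡ 0
∑-zero {n} z = trans (∑-cong z) (trans (∑-const n 0) (*-zeroʳ n))

opaque
  unfolding ∑

  ∑-swap : ∀ {m n} (f : Fin m → Fin n → ℕ) → ∑ (λ i → ∑ (f i)) ≡ ∑ (λ j → ∑ (λ i → f i j))
  ∑-swap {zero} {n} f = sym (∑-zero {n} (λ _ → refl))
  ∑-swap {suc m} f = trans (cong (∑ (f zero) +_) (∑-swap (f ∘ suc))) (sym (∑-distrib-+ (f zero) _))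

opaque
  unfolding ∑

  term≤∑ : ∀ {n} (f : Fin n → ℕ) i → f i ≤ ∑ f
  term≤∑ f zero = m≤m+n _ _
  term≤∑ f (suc i) = ≤-trans (term≤∑ (f ∘ suc) i) (m≤n+m _ _)

opaque
  unfolding ∑

  ∑≥1 : ∀ {n} (f : Fin n → ℕ) → 1 ≤ ∑ f → ∃[ i ] 1 ≤ f i
  ∑≥1 {suc n} f le with f zero in eq
  ... | suc _ = zero , ≤-trans (s≤s z≤n) (≤-reflexive (sym eq))
  ... | zero with ∑≥1 (f ∘ suc) le
  ...   | i , p = suc i , p

opaque
  unfolding ∑

  ∑≤1 : ∀ {n} {f : Fin n → ℕ} → (∀ i → f i ≤ 1) → (∀ i j → 1 ≤ f i → 1 ≤ f j → i ≡ j) → ∑ f ≤ 1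
  ∑≤1 {zero} le one = z≤n
  ∑≤1 {suc n} {f} le one with f zero in eq
  ... | zero = ∑≤1 (le ∘ suc) (λ i j p q → sucᶠ-injective (one (suc i) (suc j) p q))
  ... | suc k = subst (λ s → suc k + s ≤ 1) (sym (∑-zero rest))
                  (subst (_≤ 1) (sym (+-identityʳ (suc k))) (subst (_≤ 1) eq (le zero)))
    where
    rest : ∀ i → f (suc i) ≡ 0
    rest i with f (suc i) in eq'
    ... | zero = refl
    ... | suc _ with one zero (suc i) (subst (1 ≤_) (sym eq) (s≤s z≤n)) (subst (1 ≤_) (sym eq') (s≤s z≤n))
    ...   | ()

opaque
  unfolding ∑

  ∑-point : ∀ {n} (v : Fin n) (f : Fin n → ℕ) → ∑ (λ i → ⟦ i ≟ᶠ v ⟧ * f i) ≡ f v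
  ∑-point {suc n} zero f = trans (cong₂ _+_ (+-identityʳ (f zero)) (∑-zero {n} (λ _ → refl))) (+-identityʳ (f zero))
  ∑-point {suc n} (suc v) f = trans (∑-cong same) (∑-point v (f ∘ suc))
    where
    same : ∀ i → ⟦ suc i ≟ᶠ suc v ⟧ * f (suc i) ≡ ⟦ i ≟ᶠ v ⟧ * f (suc i)
    same i with i ≟ᶠ v
    ... | yes _ = refl
    ... | no _ = refl

∑-point₁ : ∀ {n} (v : Fin n) → ∑ (λ i → ⟦ i ≟ᶠ v ⟧) ≡ 1
∑-point₁ v = trans (∑-cong (λ i → sym (*-identityʳ _))) (∑-point v (λ _ → 1))

opaque
  unfolding ∑

  length-filter : ∀ {A : Set} {n} {P : A → Set} (P? : ∀ i → Dec (P i)) (f : Fin n → A) →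
    length (filter P? (tabulate f)) ≡ ∑ (λ i → ⟦ P? (f i) ⟧)
  length-filter {n = zero} P? f = refl
  length-filter {n = suc n} P? f with P? (f zero)
  ... | yes _ = cong suc (length-filter P? (f ∘ suc))
  ... | no _ = length-filter P? (f ∘ suc)

opaque
  unfolding ∑

  sum-filter : ∀ {A : Set} {n} {P : A → Set} (P? : ∀ i → Dec (P i)) (g : A → ℕ) (f : Fin n → A) →
    sum (map g (filter P? (tabulate f))) ≡ ∑ (λ i → ⟦ P? (f i) ⟧ * g (f i))
  sum-filter {n = zero} P? g f = refl
  sum-filter {n = suc n} P? g f with P? (f zero)
  ... | yes _ = cong₂ _+_ (sym (+-identityʳ (g (f zero)))) (sum-filter P? g (f ∘ suc))
  ... | no _ = sum-filter P? g (f ∘ suc)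

length≤∑∈ : ∀ {n} {L : List (Fin n)} → Unique L → length L ≤ ∑ (λ i → ⟦ i ∈? L ⟧)
length≤∑∈ [] = z≤n
length≤∑∈ {n} {v ∷ L} (v∉ ∷ u) = ≤-trans
  (subst (λ s → suc (length L) ≤ s + ∑ (λ i → ⟦ i ∈? L ⟧)) (sym (∑-point₁ v)) (s≤s (length≤∑∈ u)))
  (≤-trans (≤-reflexive (sym (∑-distrib-+ (λ i → ⟦ i ≟ᶠ v ⟧) (λ i → ⟦ i ∈? L ⟧)))) (∑-mono pointwise))
  where
  pointwise : ∀ i → ⟦ i ≟ᶠ v ⟧ + ⟦ i ∈? L ⟧ ≤ ⟦ i ∈? (v ∷ L) ⟧
  pointwise i with i ≟ᶠ v | i ∈? L | i ∈? (v ∷ L)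
  ... | yes refl | yes i∈ | _ = ⊥-elim (All.lookup v∉ i∈ refl)
  ... | yes refl | no _ | yes _ = ≤-refl
  ... | yes refl | no _ | no p = ⊥-elim (p (here refl))
  ... | no _ | yes i∈ | yes _ = ≤-refl
  ... | no _ | yes i∈ | no p = ⊥-elim (p (there i∈))
  ... | no _ | no _ | _ = z≤n

opaque
  unfolding ∑

  handshake : ∀ {n} (f : Fin n → Fin n → ℕ) → (∀ i j → f i j ≡ f j i) → (∀ i → f i i ≡ 0) →
              ∃[ e ] ∑ (λ i → ∑ (f i)) ≡ e + e
  handshake {zero} f sy di = 0 , refl
  handshake {suc n} f sy di with handshake (λ i j → f (suc i) (suc j)) (λ i j → sy (suc i) (suc j)) (di ∘ suc)
  ... | e , eq = row + e , (begin
    (f zero zero + row) + ∑ (λ i → f (suc i) zero + ∑ (λ j → f (suc i) (suc j)))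
      ≡⟨ cong₂ _+_ (cong (_+ row) (di zero)) (∑-distrib-+ (λ i → f (suc i) zero) (λ i → ∑ (λ j → f (suc i) (suc j)))) ⟩
    row + (∑ (λ i → f (suc i) zero) + ∑ (λ i → ∑ (λ j → f (suc i) (suc j))))
      ≡⟨ cong (row +_) (cong₂ _+_ (∑-cong (λ i → sy (suc i) zero)) eq) ⟩
    row + (row + (e + e)) ≡⟨ regroup row e ⟩
    (row + e) + (row + e) ∎)
    where
    open ≡-Reasoning
    row : ℕ
    row = ∑ (λ j → f zero (suc j))
    regroup : ∀ r e → r + (r + (e + e)) ≡ (r + e) + (r + e)
    regroup = solve-∀

-- Non-backtracking walks

unique-prefix : ∀ {A : Set} (pre : List A) {u post} → Unique (pre ++ u ∷ post) → Unique (u ∷ pre)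
unique-prefix [] _ = [] ∷ []
unique-prefix (v ∷ pre) (v∉ ∷ uq) with unique-prefix pre uq
... | u∉ ∷ uq' = ((λ e → All.head (All.++⁻ʳ pre v∉) (sym e)) ∷ u∉) ∷ All.++⁻ˡ pre v∉ ∷ uq'

unique-concatMap : ∀ {A B : Set} (f : A → List B) {ws} → (∀ w → Unique (f w)) →
  (∀ {w w' z} → z ∈ f w → z ∈ f w' → w ≡ w') → Unique ws → Unique (concatMap f ws)
unique-concatMap f uf disj [] = []
unique-concatMap f {w ∷ ws} uf disj (w∉ ∷ u) =
  Unique.++⁺ (uf w) (unique-concatMap f uf disj u) λ (z∈ , z∈') →
    let w' , w'∈ , z∈w' = find ws z∈' in All.lookup w∉ w'∈ (disj z∈ z∈w')
  where
  find : ∀ ws {z} → z ∈ concatMap f ws → ∃[ w' ] (w' ∈ ws × z ∈ f w')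
  find (w ∷ ws) z∈ with ∈-++⁻ (f w) z∈
  ... | inj₁ p = w , here refl , p
  ... | inj₂ p with find ws p
  ...   | w' , w'∈ , q = w' , there w'∈ , q

all-concatMap : ∀ {A B : Set} {P : A → Set} {Q : B → Set} (f : A → List B) {ws} →
  (∀ w → P w → All Q (f w)) → All P ws → All Q (concatMap f ws)
all-concatMap f h [] = []
all-concatMap f h (p ∷ ps) = All.++⁺ (h _ p) (all-concatMap f h ps)

concatMap-length : ∀ {A B : Set} {P : A → Set} (f : A → List B) κ {ws} → (∀ w → P w → κ ≤ length (f w)) →
  All P ws → κ * length ws ≤ length (concatMap f ws)
concatMap-length f κ h [] = ≤-reflexive (*-zeroʳ κ)
concatMap-length f κ {w ∷ ws} h (p ∷ ps) = ≤-trans (≤-reflexive (*-suc κ (length ws)))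
  (≤-trans (+-mono-≤ (h w p) (concatMap-length f κ h ps)) (≤-reflexive (sym (length-++ (f w)))))

filter-≢-length : ∀ {n} (u : Fin n) xs → Unique xs →
  length xs ≤ suc (length (filter (λ v → ¬? (v ≟ᶠ u)) xs))
filter-≢-length u [] _ = z≤n
filter-≢-length u (v ∷ xs) (v∉ ∷ uq) with v ≟ᶠ u
... | yes refl = s≤s (≤-reflexive (cong length (sym (filter-all _ (All.map (λ p q → p (sym q)) v∉)))))
... | no _ = s≤s (filter-≢-length u xs uq)

module NonBacktracking {t : ℕ} (N : Fin t → List (Fin t)) (N-unique : ∀ v → Unique (N v))
  (N-sym : ∀ {u v} → u ∈ N v → v ∈ N u) (N-irrefl : ∀ {v} → v ∉ N v) (g : ℕ)
  (no-cycle : ∀ u (pre : List (Fin t)) → Unique (u ∷ pre) → Linked (λ a b → a ∈ N b) (u ∷ pre ++ [ u ]) →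
              2 ≤ length pre → suc (length pre) < g → ⊥)
  where

  private
    V = Fin t

  data NB : List V → Set where
    one  : ∀ {v} → NB [ v ]
    two  : ∀ {u v} → u ∈ N v → NB (u ∷ v ∷ [])
    more : ∀ {u v z p} → u ∈ N v → u ≢ z → NB (v ∷ z ∷ p) → NB (u ∷ v ∷ z ∷ p)

  nb-tail : ∀ {u v p} → NB (u ∷ v ∷ p) → NB (v ∷ p)
  nb-tail (two _) = one
  nb-tail (more _ _ nb) = nb

  nb-linked : ∀ pre {u v post} → NB (u ∷ pre ++ v ∷ post) → Linked (λ a b → a ∈ N b) (u ∷ pre ++ [ v ])
  nb-linked [] (two a) = a ∷ [-]
  nb-linked [] (more a _ _) = a ∷ [-]
  nb-linked (w ∷ []) (more a _ nb) = a ∷ nb-linked [] nb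
  nb-linked (w ∷ w' ∷ pre) (more a _ nb) = a ∷ nb-linked (w' ∷ pre) nb

  -- A return to `u` would close a cycle shorter than `g`; lengths one and two are excluded by
  -- irreflexivity and by non-backtracking.
  nb-fresh : ∀ u p → NB (u ∷ p) → Unique p → length (u ∷ p) ≤ g → u ∉ p
  nb-fresh u p nb uq le u∈ with ∈-∃++ u∈
  ... | pre , post , refl = bad pre nb uq le
    where
    bad : ∀ pre {post} → NB (u ∷ pre ++ u ∷ post) → Unique (pre ++ u ∷ post) →
          length (u ∷ pre ++ u ∷ post) ≤ g → ⊥
    bad [] (two a) _ _ = N-irrefl a
    bad [] (more a _ _) _ _ = N-irrefl a
    bad (w ∷ []) (more _ u≢u _) _ _ = u≢u refl
    bad (w ∷ w' ∷ pre) {post} nb' uq le' = no-cycle u (w ∷ w' ∷ pre) (unique-prefix (w ∷ w' ∷ pre) uq)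
      (nb-linked (w ∷ w' ∷ pre) nb') (s≤s (s≤s z≤n))
      (≤-trans (s≤s (s≤s (s≤s (≤-trans (s≤s (m≤m+n (length pre) (length post)))
        (≤-reflexive (sym (trans (length-++ pre) (+-suc (length pre) (length post))))))))) le')

  nb-unique : ∀ p → NB p → length p ≤ g → Unique p
  nb-unique (u ∷ []) nb le = [] ∷ []
  nb-unique (u ∷ v ∷ p) nb le with nb-unique (v ∷ p) (nb-tail nb) (≤-trans (n≤1+n _) le)
  ... | rest = All.tabulate (λ w∈ e → nb-fresh u (v ∷ p) nb rest le (subst (_∈ v ∷ p) (sym e) w∈)) ∷ rest

  data HeadNot (v : V) : List V → Set where
    none   : HeadNot v []
    differ : ∀ {u p} → v ≢ u → HeadNot v (u ∷ p)

  nb-cons : ∀ {u v p} → u ∈ N v → HeadNot u p → NB (v ∷ p) → NB (u ∷ v ∷ p)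
  nb-cons a none one = two a
  nb-cons a (differ u≢) nb = more a u≢ nb

  nb-adj : ∀ {u v p} → NB (u ∷ v ∷ p) → u ∈ N v
  nb-adj (two a) = a
  nb-adj (more a _ _) = a

  -- Two walks leaving u in different directions and ending in x make a closed walk through x.
  nb-fork : ∀ p u p₁ q x → NB (u ∷ p₁ ∷ p) → EndsIn x (p₁ ∷ p) → NB (u ∷ q) → HeadNot p₁ q → x ∈ u ∷ q →
            length p + length q + 2 ≤ g → ⊥
  nb-fork [] u p₁ q .p₁ nb end nbq hn x∈ le
    with nb-unique (p₁ ∷ u ∷ q) (nb-cons (N-sym (nb-adj nb)) hn nbq) (≤-trans (≤-reflexive (+-comm 2 (length q))) le)
  ... | x∉ ∷ _ = All.lookup x∉ x∈ refl
  nb-fork (p₂ ∷ p) u p₁ q x nb (skip e) nbq hn x∈ le =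
    nb-fork p p₁ p₂ (u ∷ q) x (nb-tail nb) e (nb-cons (N-sym (nb-adj nb)) hn nbq) (away nb) (there x∈)
      (≤-trans (≤-reflexive (cong (_+ 2) (+-suc (length p) (length q)))) le)
    where
    away : NB (u ∷ p₁ ∷ p₂ ∷ p) → HeadNot p₂ (u ∷ q)
    away (more _ u≢ _) = differ (u≢ ∘ sym)

  -- After the common beginning is removed, two different walks would fork and meet again at `x`,
  -- contrary to `nb-fork`.
  walk-unique : ∀ p q z x → NB (z ∷ p) → NB (z ∷ q) → EndsIn x (z ∷ p) → EndsIn x (z ∷ q) →
                length p + length q < g → p ≡ q
  walk-unique [] [] z x _ _ _ _ _ = refl
  walk-unique [] (w ∷ q) z .z _ nb end (skip e) le with nb-unique _ nb le
  ... | z∉ ∷ _ = ⊥-elim (All.lookup z∉ (ends-∈ e) refl)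
  walk-unique (w ∷ p) [] z .z nb _ (skip e) end le
    with nb-unique _ nb (≤-trans (s≤s (s≤s (m≤m+n (length p) 0))) le)
  ... | z∉ ∷ _ = ⊥-elim (All.lookup z∉ (ends-∈ e) refl)
  walk-unique (w ∷ p) (w' ∷ q) z x nb nb' (skip e) (skip e') le with w ≟ᶠ w'
  ... | yes refl = cong (w ∷_) (walk-unique p q w x (nb-tail nb) (nb-tail nb') e e'
                     (≤-trans (s≤s (+-monoʳ-≤ (length p) (n≤1+n (length q)))) (≤-trans (n≤1+n _) le)))
  ... | no w≢ = ⊥-elim (nb-fork p z w (w' ∷ q) x nb e nb' (differ w≢) (there (ends-∈ e'))
                  (≤-trans (≤-reflexive (+-comm _ 2)) le))

  module From (x : V) where

    record Walk (n : ℕ) (p : List V) : Set where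
      constructor walk
      field
        nb   : NB p
        ends : EndsIn x p
        len  : length p ≡ suc n

    ext : List V → List (List V)
    ext [] = []
    ext (v ∷ []) = map (_∷ v ∷ []) (N v)
    ext (v ∷ u ∷ p) = map (_∷ v ∷ u ∷ p) (filter (λ a → ¬? (a ≟ᶠ u)) (N v))

    opaque
      walks : ℕ → List (List V)
      walks zero = [ [ x ] ]
      walks (suc n) = concatMap ext (walks n)

    ext-tail : ∀ w {z} → z ∈ ext w → ∃[ a ] z ≡ a ∷ w
    ext-tail (v ∷ []) z∈ with ∈-map⁻ _ z∈
    ... | a , _ , e = a , e
    ext-tail (v ∷ u ∷ p) z∈ with ∈-map⁻ _ z∈
    ... | a , _ , e = a , e

    ext-unique : ∀ w → Unique (ext w)
    ext-unique [] = []
    ext-unique (v ∷ []) = unique-map _ (λ { _ _ refl → refl }) (N-unique v)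
    ext-unique (v ∷ u ∷ p) = unique-map _ (λ { _ _ refl → refl }) (Unique.filter⁺ _ (N-unique v))

    ext-injective : ∀ {w w' z} → z ∈ ext w → z ∈ ext w' → w ≡ w'
    ext-injective {w} {w'} z∈ z∈' with ext-tail w z∈ | ext-tail w' z∈'
    ... | a , refl | b , e = ∷-injectiveʳ e

    opaque
      unfolding walks

      walks-unique : ∀ n → Unique (walks n)
      walks-unique zero = [] ∷ []
      walks-unique (suc n) = unique-concatMap ext ext-unique
        (λ {w} {w'} → ext-injective {w} {w'}) (walks-unique n)

    ext-walk : ∀ n p → Walk n p → All (Walk (suc n)) (ext p)
    ext-walk n (v ∷ []) (walk nb e l) = All.map⁺ (All.tabulate λ a∈ → walk (two a∈) (skip e) (cong suc l))
    ext-walk n (v ∷ u ∷ p) (walk nb e l) = All.map⁺ (All.tabulate λ a∈ →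
      let a∈N , a≢u = ∈-filter⁻ (λ a → ¬? (a ≟ᶠ u)) {xs = N v} a∈ in walk (more a∈N a≢u nb) (skip e) (cong suc l))

    opaque
      unfolding walks

      walks-walk : ∀ n → All (Walk n) (walks n)
      walks-walk zero = walk one end refl ∷ []
      walks-walk (suc n) = all-concatMap ext (ext-walk n) (walks-walk n)

    ext-length : ∀ v u p → length (N v) ∸ 1 ≤ length (ext (v ∷ u ∷ p))
    ext-length v u p = subst (length (N v) ∸ 1 ≤_) (sym (length-map _ (filter _ (N v))))
      (∸-monoˡ-≤ 1 (filter-≢-length u (N v) (N-unique v)))

    ext-length≥ : ∀ {n κ} → (∀ v → κ < length (N v)) → ∀ p → Walk (suc n) p → κ ≤ length (ext p)
    ext-length≥ h (v ∷ u ∷ p) w = ≤-trans (∸-monoˡ-≤ 1 (h v)) (ext-length v u p)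
    ext-length≥ h [] (walk _ _ ())
    ext-length≥ h (v ∷ []) (walk _ _ ())

    opaque
      unfolding walks

      walks-grow : ∀ {κ} → (∀ v → κ < length (N v)) → ∀ n →
                   κ * length (walks (suc n)) ≤ length (walks (2 + n))
      walks-grow {κ} h n = concatMap-length ext κ (ext-length≥ h) (walks-walk (suc n))

    opaque
      -- Walks of length two counted by their middle vertices: the form in which they appear in sums
      -- of weights over `N x`.
      second-layer : ℕ
      second-layer = sum (map (λ y → length (N y) ∸ 1) (N x))

      second-layer-sum : second-layer ≡ sum (map (λ y → length (N y) ∸ 1) (N x))
      second-layer-sum = refl

    opaque
      unfolding walks

      length-walks₀ : length (walks 0) ≡ 1
      length-walks₀ = refl

      length-walks₁ : length (walks 1) ≡ length (N x)
      length-walks₁ = trans (length-++ (map (_∷ x ∷ []) (N x))) (trans (+-identityʳ _) (length-map _ (N x)))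

    opaque
      unfolding walks second-layer

      second-layer≤ : second-layer ≤ length (walks 2)
      second-layer≤ = ≤-trans (go (N x)) (≤-reflexive (cong (length ∘ concatMap ext) (sym (++-identityʳ (map (_∷ x ∷ []) (N x))))))
        where
        go : ∀ ys → sum (map (λ y → length (N y) ∸ 1) ys) ≤ length (concatMap ext (map (_∷ x ∷ []) ys))
        go [] = z≤n
        go (y ∷ ys) = ≤-trans (+-mono-≤ (ext-length y x []) (go ys)) (≤-reflexive (sym (length-++ (ext (y ∷ x ∷ [])))))

    hd : List V → V
    hd [] = x
    hd (v ∷ _) = v

    heads-unique : ∀ {ws} r → All (λ p → ∃[ n ] (Walk n p × n ≤ r)) ws → Unique ws → r + r < g →
                   Unique (map hd ws)
    heads-unique {ws} r all uq lt = unique-map hd inj uq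
      where
      inj : ∀ {p q} → p ∈ ws → q ∈ ws → hd p ≡ hd q → p ≡ q
      inj {[]} p∈ q∈ e with All.lookup all p∈
      ... | _ , walk () _ _ , _
      inj {_ ∷ _} {[]} p∈ q∈ e with All.lookup all q∈
      ... | _ , walk () _ _ , _
      inj {v ∷ p} {.v ∷ q} p∈ q∈ refl with All.lookup all p∈ | All.lookup all q∈
      ... | n , walk nb en refl , le | n' , walk nb' en' refl , le' =
              cong (v ∷_) (walk-unique p q v x nb nb' en en' (≤-trans (s≤s (+-mono-≤ le le')) lt))

    -- The walks of lengths `b`, `b + 2`, ..., `b + 2i`; one parity makes their ends an independent
    -- set.
    alternate : ℕ → ℕ → List (List V)
    alternate b zero = walks b
    alternate b (suc i) = walks (b + (suc i + suc i)) ++ alternate b i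

    Alternate : ℕ → ℕ → List V → Set
    Alternate b i p = ∃[ j ] (j ≤ i × Walk (b + (j + j)) p)

    alternate-walk : ∀ b i → All (Alternate b i) (alternate b i)
    alternate-walk b zero = All.map (λ w → 0 , z≤n , subst (λ n → Walk n _) (sym (+-identityʳ b)) w) (walks-walk b)
    alternate-walk b (suc i) = All.++⁺ (All.map (λ w → suc i , ≤-refl , w) (walks-walk (b + (suc i + suc i))))
      (All.map (λ { (j , le , w) → j , ≤-trans le (n≤1+n i) , w }) (alternate-walk b i))

    alternate-unique : ∀ b i → Unique (alternate b i)
    alternate-unique b zero = walks-unique b
    alternate-unique b (suc i) = Unique.++⁺ (walks-unique (b + (suc i + suc i))) (alternate-unique b i)
        λ (z∈ , z∈') → longer (All.lookup (walks-walk (b + (suc i + suc i))) z∈) (All.lookup (alternate-walk b i) z∈')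
      where
      longer : ∀ {p} → Walk (b + (suc i + suc i)) p → Alternate b i p → ⊥
      longer (walk _ _ l) (j , le , walk _ _ l') =
        <⇒≢ (s≤s (+-monoʳ-< b (+-mono-< (s≤s le) (s≤s le)))) (trans (sym l') l)

    length-alternate : ∀ b i a → (∀ n → a ≤ length (walks (2 + n))) →
                       length (walks b) + i * a ≤ length (alternate b i)
    length-alternate b zero a h = ≤-reflexive (+-identityʳ _)
    length-alternate b (suc i) a h = ≤-trans (≤-reflexive (regroup (length (walks b)) a (i * a)))
      (≤-trans (+-mono-≤ (subst (λ n → a ≤ length (walks n)) (shift b i) (h (b + (i + i)))) (length-alternate b i a h))
        (≤-reflexive (sym (length-++ (walks (b + (suc i + suc i)))))))
      where
      regroup : ∀ w a r → w + (a + r) ≡ a + (w + r)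
      regroup = solve-∀
      shift : ∀ b i → 2 + (b + (i + i)) ≡ b + (suc i + suc i)
      shift = solve-∀

    last≤alternate : ∀ b i → length (walks (b + (i + i))) ≤ length (alternate b i)
    last≤alternate b zero = ≤-reflexive (cong (length ∘ walks) (+-identityʳ b))
    last≤alternate b (suc i) = ≤-trans (m≤m+n _ _) (≤-reflexive (sym (length-++ (walks (b + (suc i + suc i))))))

    -- Adjacent ends would give two different walks to the same vertex, since the lengths
    -- of the walks have the same parity.
    alternate-independent : ∀ b i {p q} → Alternate b i p → Alternate b i q →
      suc ((b + (i + i)) + (b + (i + i))) < g → hd q ∉ N (hd p)
    alternate-independent b i {v ∷ p} {w ∷ q} (j , le , walk nb en l) (j' , le' , walk nb' en' l') lt a =
      by-cases p (suc-injective l) nb en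
      where
      lq : length q ≡ b + (j' + j')
      lq = suc-injective l'
      q≤ : length q ≤ b + (i + i)
      q≤ = subst (_≤ b + (i + i)) (sym lq) (+-monoʳ-≤ b (+-mono-≤ le' le'))
      parity : ∀ m n → b + (m + m) ≢ suc (b + (n + n))
      parity m n e = even≢odd m n (trans (cong (m +_) (+-identityʳ m)) (trans
        (+-cancelˡ-≡ b (m + m) (suc (n + n)) (trans e (sym (+-suc b (n + n))))) (cong (λ k → suc (n + k)) (sym (+-identityʳ n)))))
      step : ∀ p → length p ≡ b + (j + j) → NB (v ∷ p) → EndsIn x (v ∷ p) → HeadNot w p → ⊥
      step p lp nb en hn = parity j' j (trans (sym lq) (trans (cong length
        (walk-unique q (v ∷ p) w x nb' (nb-cons a hn nb) en' (skip en)
          (≤-trans (s≤s (≤-trans (+-mono-≤ q≤ (s≤s p≤)) (≤-reflexive (+-suc _ _)))) lt))) (cong suc lp)))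
        where
        p≤ : length p ≤ b + (i + i)
        p≤ = subst (_≤ b + (i + i)) (sym lp) (+-monoʳ-≤ b (+-mono-≤ le le))
      by-cases : ∀ p → length p ≡ b + (j + j) → NB (v ∷ p) → EndsIn x (v ∷ p) → ⊥
      by-cases [] lp nb en = step [] lp nb en none
      by-cases (u ∷ p) lp nb (skip en) with w ≟ᶠ u
      ... | no w≢u = step (u ∷ p) lp nb (skip en) (differ w≢u)
      ... | yes refl = parity j j' (trans (sym lp) (cong suc (trans (cong length
              (walk-unique p q w x (nb-tail nb) nb' en en'
                (≤-trans (s≤s (+-mono-≤ (≤-trans (n≤1+n _) p≤) q≤)) (≤-trans (n≤1+n _) lt)))) lq)))
        where
        p≤ : suc (length p) ≤ b + (i + i)
        p≤ = subst (_≤ b + (i + i)) (sym lp) (+-monoʳ-≤ b (+-mono-≤ le le))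

-- Overfull weighted graphs

half-positive : ∀ m → 4 ≤ m + m → 1 ≤ m
half-positive (suc m) _ = s≤s z≤n

-- The difference of the two sides is (m - 1)(s - 1).
weight-bound : ∀ m s → 1 ≤ m → 1 ≤ s → suc m * suc s ≤ (m + m) * s + 2
weight-bound (suc m) (suc s) _ _ = ≤-trans (m≤m+n _ (m * s)) (≤-reflexive (e m s))
  where
  e : ∀ m s → suc (suc m) * suc (suc s) + m * s ≡ (suc m + suc m) * suc s + 2
  e = solve-∀

-- The number `h − 1` is written as `b + 2i` with `b` its parity, so that the longest walks of
-- `alternate b i` have length `h − 1`.
decompose : ∀ h → 3 ≤ h → ∃[ b ] ∃[ i ] (b ≤ 1 × 1 ≤ i × suc (b + (i + i)) ≡ h)
decompose 3 _ = 0 , 1 , z≤n , ≤-refl , refl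
decompose 4 _ = 1 , 1 , ≤-refl , ≤-refl , refl
decompose (suc (suc h@(suc (suc (suc _))))) _ with decompose h (s≤s (s≤s (s≤s z≤n)))
... | b , i , b≤1 , 1≤i , eq = b , suc i , b≤1 , s≤s z≤n ,
      trans (cong suc (trans (cong (b +_) (cong suc (+-suc i i))) (trans (+-suc b _) (cong suc (+-suc b _))))) (cong (2 +_) eq)
decompose 1 (s≤s ())
decompose 2 (s≤s (s≤s ()))

-- As `h` is `b + 2i + 1`, twice the lower bound on `m` and the upper bound on `m + 1` leave 4(b +
-- 1) ≤ a(b + 1). With a ≥ 4 the lower bound then reads m + 1 ≥ 2 + 2b + 4i = 2h, and equality
-- leaves no room for a > 4.
layer-arith : ∀ m h b i a → suc (b + (i + i)) ≡ h → 1 ≤ i → 1 + 2 * b + i * a ≤ m →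
  2 * suc m ≤ a * h → 4 ≤ a × h + h ≤ suc m × (suc m ≤ h + h → a ≤ 4)
layer-arith m _ b i a refl 1≤i lo up = 4≤a , 2h≤ , a≤4
  where
  open ≤-Reasoning
  4≤a : 4 ≤ a
  4≤a = *-cancelʳ-≤ 4 a (suc b) (+-cancelˡ-≤ (2 * (i * a) + 2 * m) _ _ (begin
    2 * (i * a) + 2 * m + 4 * suc b ≡⟨ e₁ (i * a) m b ⟩
    2 * suc m + 2 * (1 + 2 * b + i * a) ≤⟨ +-mono-≤ up (*-monoʳ-≤ 2 lo) ⟩
    a * suc (b + (i + i)) + 2 * m ≡⟨ e₂ a b i m ⟩
    2 * (i * a) + 2 * m + a * suc b ∎))
    where
    e₁ : ∀ ia m b → 2 * ia + 2 * m + 4 * suc b ≡ 2 * suc m + 2 * (1 + 2 * b + ia)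
    e₁ = solve-∀
    e₂ : ∀ a b i m → a * suc (b + (i + i)) + 2 * m ≡ 2 * (i * a) + 2 * m + a * suc b
    e₂ = solve-∀
  2h≤ : suc (b + (i + i)) + suc (b + (i + i)) ≤ suc m
  2h≤ = begin
    suc (b + (i + i)) + suc (b + (i + i)) ≡⟨ e₃ b i ⟩
    suc (1 + 2 * b + i * 4) ≤⟨ s≤s (+-monoʳ-≤ (1 + 2 * b) (*-monoʳ-≤ i 4≤a)) ⟩
    suc (1 + 2 * b + i * a) ≤⟨ s≤s lo ⟩
    suc m ∎
    where
    e₃ : ∀ b i → suc (b + (i + i)) + suc (b + (i + i)) ≡ suc (1 + 2 * b + i * 4)
    e₃ = solve-∀
  a≤4 : suc m ≤ suc (b + (i + i)) + suc (b + (i + i)) → a ≤ 4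
  a≤4 le = cancel i 1≤i (+-cancelˡ-≤ (suc (1 + 2 * b)) _ _ (begin
    suc (1 + 2 * b) + i * a ≤⟨ s≤s lo ⟩
    suc m ≤⟨ le ⟩
    suc (b + (i + i)) + suc (b + (i + i)) ≡⟨ e₃ b i ⟩
    suc (1 + 2 * b) + i * 4 ∎))
    where
    e₃ : ∀ b i → suc (b + (i + i)) + suc (b + (i + i)) ≡ suc (1 + 2 * b) + i * 4
    e₃ = solve-∀
    cancel : ∀ i → 1 ≤ i → i * a ≤ i * 4 → a ≤ 4
    cancel (suc i) _ = *-cancelˡ-≤ (suc i)

tight-layer : ∀ m h a d → suc m ≡ h + h → 2 ≤ h → a ≤ 4 → (2 + d) * suc m ≤ a * h → a ≡ 4 × d ≡ 0
tight-layer m h@(suc _) a d eq _ a≤4 le = a≡4 , d≡0 d le'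
  where
  a≡4 : a ≡ 4
  a≡4 = ≤-antisym a≤4 (*-cancelʳ-≤ 4 a h (≤-trans (≤-reflexive (e h)) (≤-trans
    (subst (λ k → 2 * k ≤ (2 + d) * suc m) eq (*-monoˡ-≤ (suc m) (m≤m+n 2 d))) le)))
    where
    e : ∀ h → 4 * h ≡ 2 * (h + h)
    e = solve-∀
  le' : (2 + d) * (h + h) ≤ 2 * (h + h)
  le' = ≤-trans (subst (λ k → (2 + d) * k ≤ a * h) eq le) (≤-trans (*-monoˡ-≤ h a≤4) (≤-reflexive (e h)))
    where
    e : ∀ h → 4 * h ≡ 2 * (h + h)
    e = solve-∀
  d≡0 : ∀ d → (2 + d) * (h + h) ≤ 2 * (h + h) → d ≡ 0
  d≡0 d le = n≤0⇒n≡0 (+-cancelˡ-≤ 2 d 0 (*-cancelʳ-≤ (2 + d) 2 (h + h) le))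

-- Replacing `D` by the smaller 2ms + 2 turns the last hypothesis into (h - 1)(s - 1) ≤ 0, as m + 1
-- = 2h.
tight-weights : ∀ m h s D → suc m ≡ h + h → 2 ≤ h → 1 ≤ s → (m + m) * s + 2 ≤ D →
  D + ((m + m) * s + 2) ≤ 4 * (suc s * h) → s ≡ 1 × 4 * h ≡ (m + m) * s + 2 × D ≤ 4 * h
tight-weights m 1 s D eq (s≤s ()) _ _ _
tight-weights m (suc (suc h)) 1 D refl _ _ W≤D le = refl , e h , +-cancelʳ-≤ (4 * (2 + h)) D (4 * (2 + h))
    (≤-trans (≤-reflexive (cong (D +_) (e h))) (≤-trans le (≤-reflexive (e' h))))
  where
  e : ∀ h → 4 * (2 + h) ≡ ((1 + h + (2 + h)) + (1 + h + (2 + h))) * 1 + 2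
  e = solve-∀
  e' : ∀ h → 4 * (2 * (2 + h)) ≡ 4 * (2 + h) + 4 * (2 + h)
  e' = solve-∀
tight-weights m (suc (suc h)) (suc (suc s)) D refl _ _ W≤D le = ⊥-elim (<⇒≱ strict (≤-trans (+-monoˡ-≤ W W≤D) le))
  where
  M = 1 + h + (2 + h)
  W = (M + M) * suc (suc s) + 2
  strict : 4 * (suc (suc (suc s)) * (2 + h)) < W + W
  strict = ≤-trans (m≤m+n _ (3 + 4 * (h + s + h * s))) (≤-reflexive (e h s))
    where
    e : ∀ h s → suc (4 * ((3 + s) * (2 + h))) + (3 + 4 * (h + s + h * s)) ≡
          ((1 + h + (2 + h) + (1 + h + (2 + h))) * (2 + s) + 2) + ((1 + h + (2 + h) + (1 + h + (2 + h))) * (2 + s) + 2)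
    e = solve-∀

-- For e = 1 the last hypothesis says w ≥ 2h; for e ≥ 2 already w ≥ 1 suffices.
tight-point : ∀ h e w → 1 ≤ h → 1 ≤ e → 1 ≤ w → 4 * h ≤ w + e * (2 * h) → 4 * h + e ≤ w + (e * (2 * h) + 1)
tight-point h 1 w _ _ _ le = ≤-trans (+-monoˡ-≤ 1 le) (≤-reflexive (+-assoc w (1 * (2 * h)) 1))
tight-point h@(suc _) (suc (suc e)) (suc w) _ _ _ _ = begin
  4 * h + (2 + e) ≤⟨ m≤m+n _ (w + e * (2 * h ∸ 1)) ⟩
  4 * h + (2 + e) + (w + e * (2 * h ∸ 1)) ≡⟨ regroup h e w (e * (2 * h ∸ 1)) ⟩
  suc w + (2 * (2 * h) + (e + e * (2 * h ∸ 1)) + 1) ≡⟨ cong (λ k → suc w + (2 * (2 * h) + k + 1)) (sym (*-suc e (2 * h ∸ 1))) ⟩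
  suc w + (2 * (2 * h) + e * (2 * h) + 1) ≡⟨ cong (λ k → suc w + (k + 1)) (sym (*-distribʳ-+ (2 * h) 2 e)) ⟩
  suc w + (suc (suc e) * (2 * h) + 1) ∎
  where
  open ≤-Reasoning
  regroup : ∀ h e w r → 4 * h + (2 + e) + (w + r) ≡ suc w + (2 * (2 * h) + (e + r) + 1)
  regroup = solve-∀

-- The case h = 2. Eliminating `a` gives (2 + d)(m + 1) + 2(3 + d) ≤ 4m: d = 0 needs m ≥ 4, d = 1
-- needs m ≥ 11, and d ≥ 2 is impossible.
small-arith : ∀ m d D a → D ≡ 3 + d → suc (D + a) ≤ suc (m + m) → (2 + d) * suc m ≤ a * 2 →
  4 ≤ m × (D ≡ 3 ⊎ 11 ≤ m × D ≡ 4)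
small-arith m d _ a refl (s≤s ball) up = by-cases d ball up
  where
  open ≤-Reasoning
  combined : ∀ d → 3 + d + a ≤ m + m → (2 + d) * suc m ≤ a * 2 → (2 + d) * suc m + 2 * (3 + d) ≤ 4 * m
  combined d ball up = begin
    (2 + d) * suc m + 2 * (3 + d) ≤⟨ +-monoˡ-≤ (2 * (3 + d)) up ⟩
    a * 2 + 2 * (3 + d) ≡⟨ e₁ a d ⟩
    2 * (3 + d + a) ≤⟨ *-monoʳ-≤ 2 ball ⟩
    2 * (m + m) ≡⟨ e₂ m ⟩
    4 * m ∎
    where
    e₁ : ∀ a d → a * 2 + 2 * (3 + d) ≡ 2 * (3 + d + a)
    e₁ = solve-∀
    e₂ : ∀ m → 2 * (m + m) ≡ 4 * m
    e₂ = solve-∀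
  by-cases : ∀ d → 3 + d + a ≤ m + m → (2 + d) * suc m ≤ a * 2 → 4 ≤ m × (3 + d ≡ 3 ⊎ 11 ≤ m × 3 + d ≡ 4)
  by-cases 0 ball up = *-cancelˡ-≤ 2 (+-cancelˡ-≤ (2 * m) 8 (2 * m) (begin
      2 * m + 8 ≡⟨ e m ⟩
      2 * suc m + 6 ≤⟨ combined 0 ball up ⟩
      4 * m ≡⟨ e' m ⟩
      2 * m + 2 * m ∎)) , inj₁ refl
    where
    e : ∀ m → 2 * m + 8 ≡ 2 * suc m + 6
    e = solve-∀
    e' : ∀ m → 4 * m ≡ 2 * m + 2 * m
    e' = solve-∀
  by-cases 1 ball up = ≤-trans (m≤m+n 4 7) 11≤m , inj₂ (11≤m , refl)
    where
    e : ∀ m → 3 * m + 11 ≡ 3 * suc m + 8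
    e = solve-∀
    e' : ∀ m → 4 * m ≡ 3 * m + m
    e' = solve-∀
    11≤m : 11 ≤ m
    11≤m = +-cancelˡ-≤ (3 * m) 11 m (begin
      3 * m + 11 ≡⟨ e m ⟩
      3 * suc m + 8 ≤⟨ combined 1 ball up ⟩
      4 * m ≡⟨ e' m ⟩
      3 * m + m ∎)
  by-cases (suc (suc d)) ball up = ⊥-elim (<⇒≱ (begin-strict
      4 * m <⟨ m<m+n (4 * m) (s≤s z≤n) ⟩
      4 * m + (14 + (d * suc m + 2 * d)) ≡⟨ e m d ⟩
      (4 + d) * suc m + 2 * (5 + d) ∎) (combined (suc (suc d)) ball up))
    where
    e : ∀ m d → 4 * m + (14 + (d * suc m + 2 * d)) ≡ (4 + d) * suc m + 2 * (5 + d)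
    e = solve-∀

-- The case h = 3: a valency above three would give 3(m + 1) ≤ 3a, against a < m.
three-arith : ∀ m d D a → D ≡ 3 + d → suc a ≤ m → (2 + d) * suc m ≤ a * 3 → D ≡ 3
three-arith m zero D a eq _ _ = eq
three-arith m (suc d) D a eq a<m up = ⊥-elim (<⇒≱ a<m (≤-trans (n≤1+n m)
  (*-cancelʳ-≤ (suc m) a 3 (≤-trans (≤-reflexive (*-comm (suc m) 3)) (≤-trans (*-monoˡ-≤ (suc m) (m≤m+n 3 d)) up)))))

-- The hypotheses conflict because h ≤ 2^(h - 2) for h ≥ 4: when every walk can branch, the last
-- layer alone is too large.
big-arith : ∀ m h a → 4 ≤ h → 2 ^ (h ∸ 3) * a ≤ m → 2 * suc m ≤ a * h → ⊥
big-arith m 1 a (s≤s ()) _ _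
big-arith m 2 a (s≤s (s≤s ())) _ _
big-arith m 3 a (s≤s (s≤s (s≤s ()))) _ _
big-arith m (suc (suc (suc (suc n)))) a _ lo up = <⇒≱ (≤-trans (*-monoʳ-< 2 (s≤s lo)) up)
    (≤-trans (*-monoʳ-≤ a (power n)) (≤-reflexive (regroup a (2 ^ suc n))))
  where
  regroup : ∀ a p → a * (2 * p) ≡ 2 * (p * a)
  regroup = solve-∀
  power : ∀ n → 4 + n ≤ 2 * 2 ^ suc n
  power zero = ≤-refl
  power (suc n) = ≤-trans (≤-trans (s≤s (power n)) (+-monoˡ-≤ (2 * 2 ^ suc n) (≤-trans (s≤s z≤n) (power n))))
    (≤-reflexive (cong (2 * 2 ^ suc n +_) (sym (+-identityʳ _))))

-- In an overfull graph of large girth every vertex has at most two neighbours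

module Dense {m : ℕ} (s' h D g : ℕ) (w : Fin (suc (m + m)) → Fin (suc (m + m)) → ℕ)
  (w-sym : ∀ i j → w i j ≡ w j i) (w-irrefl : ∀ i → w i i ≡ 0) (w≤ : ∀ i j → w i j ≤ suc s' * h)
  (1≤s' : 1 ≤ s') (2≤h : 2 ≤ h) (5≤g : 5 ≤ g) (2h≤g : h + h ≤ g) (g≤t : g ≤ suc (m + m))
  (c≤D : ∀ i → ∑ (w i) ≤ D) (total : (m + m) * (D + s') + 2 ≤ ∑ (λ i → ∑ (w i)))
  (no-cycle : ∀ u (pre : List (Fin (suc (m + m)))) → Unique (u ∷ pre) →
     Linked (λ a b → 1 ≤ w a b) (u ∷ pre ++ [ u ]) → 2 ≤ length pre → suc (length pre) < g → ⊥)
  where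

  private
    t s W B : ℕ
    t = suc (m + m)
    s = suc s'
    W = (m + m) * s' + 2
    B = s * h
    V = Fin t

  c : V → ℕ
  c v = ∑ (w v)

  opaque
    adjacent? : ∀ v u → Dec (1 ≤ w v u)
    adjacent? v u = 1 ≤? w v u

  opaque
    N : V → List V
    N v = filter (adjacent? v) (allFin t)

    ∈N : ∀ {u v} → u ∈ N v → 1 ≤ w v u
    ∈N {u} {v} u∈ = proj₂ (∈-filter⁻ (adjacent? v) {xs = allFin t} u∈)

    N∈ : ∀ {u v} → 1 ≤ w v u → u ∈ N v
    N∈ {u} {v} = ∈-filter⁺ (adjacent? v) (∈-allFin u)

    N-unique : ∀ v → Unique (N v)
    N-unique v = Unique.filter⁺ (adjacent? v) (Unique.allFin⁺ t)

    length-N : ∀ v → length (N v) ≡ ∑ (λ u → ⟦ adjacent? v u ⟧)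
    length-N v = length-filter (adjacent? v) id

    sum-N : ∀ x (f : V → ℕ) → sum (map f (N x)) ≡ ∑ (λ y → ⟦ adjacent? x y ⟧ * f y)
    sum-N x f = sum-filter (adjacent? x) f id

  opaque
    valency : V → ℕ
    valency v = length (N v)

    valency-length : ∀ v → valency v ≡ length (N v)
    valency-length v = refl

  valency-∑ : ∀ v → valency v ≡ ∑ (λ u → ⟦ adjacent? v u ⟧)
  valency-∑ v = trans (valency-length v) (length-N v)

  N-sym : ∀ {u v} → u ∈ N v → v ∈ N u
  N-sym {u} {v} u∈ = N∈ (subst (1 ≤_) (w-sym v u) (∈N u∈))

  N-irrefl : ∀ {v} → v ∉ N v
  N-irrefl {v} v∈ = case subst (1 ≤_) (w-irrefl v) (∈N v∈) of λ ()

  N-no-cycle : ∀ u (pre : List V) → Unique (u ∷ pre) → Linked (λ a b → a ∈ N b) (u ∷ pre ++ [ u ]) →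
    2 ≤ length pre → suc (length pre) < g → ⊥
  N-no-cycle u pre uq l = no-cycle u pre uq (Linked.map (λ {a} {b} a∈ → subst (1 ≤_) (w-sym b a) (∈N a∈)) l)

  open NonBacktracking N N-unique N-sym N-irrefl g N-no-cycle

  -- The deficits D − c v are nonnegative and add up to at most D − W.
  selected : ∀ (p : V → ℕ) → (∀ v → p v ≤ 1) → ∑ p * D + W ≤ D + ∑ (λ v → p v * c v)
  selected p p≤1 = +-cancelˡ-≤ ((m + m) * D) _ _ (begin
    (m + m) * D + (∑ p * D + ((m + m) * s' + 2)) ≡⟨ e₁ (m + m) D (∑ p * D) s' ⟩
    ((m + m) * (D + s') + 2) + ∑ p * D ≤⟨ +-mono-≤ total (≤-reflexive (sym (∑-*ʳ p D))) ⟩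
    ∑ c + ∑ (λ v → p v * D) ≡⟨ sym (∑-distrib-+ c (λ v → p v * D)) ⟩
    ∑ (λ v → c v + p v * D) ≤⟨ ∑-mono pointwise ⟩
    ∑ (λ v → p v * c v + D) ≡⟨ ∑-distrib-+ (λ v → p v * c v) (λ _ → D) ⟩
    ∑ (λ v → p v * c v) + ∑ {t} (λ _ → D) ≡⟨ cong (∑ (λ v → p v * c v) +_) (∑-const t D) ⟩
    ∑ (λ v → p v * c v) + (D + (m + m) * D) ≡⟨ e₂ (∑ (λ v → p v * c v)) D ((m + m) * D) ⟩
    (m + m) * D + (D + ∑ (λ v → p v * c v)) ∎)
    where
    open ≤-Reasoning
    e₁ : ∀ n D P s → n * D + (P + (n * s + 2)) ≡ (n * (D + s) + 2) + P
    e₁ = solve-∀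
    e₂ : ∀ P D X → P + (D + X) ≡ X + (D + P)
    e₂ = solve-∀
    pointwise : ∀ v → c v + p v * D ≤ p v * c v + D
    pointwise v with p v | p≤1 v
    ... | zero | _ = ≤-trans (≤-reflexive (+-identityʳ (c v))) (c≤D v)
    ... | suc zero | _ = ≤-reflexive (cong₂ _+_ (sym (+-identityʳ (c v))) (+-identityʳ D))
    ... | suc (suc _) | s≤s ()

  W≤c : ∀ v → W ≤ c v
  W≤c v = +-cancelˡ-≤ D _ _ (begin
    D + W ≡⟨ cong (_+ W) (sym (+-identityʳ D)) ⟩
    1 * D + W ≡⟨ cong (λ k → k * D + W) (sym (∑-point₁ v)) ⟩
    ∑ (λ i → ⟦ i ≟ᶠ v ⟧) * D + W ≤⟨ selected (λ i → ⟦ i ≟ᶠ v ⟧) (λ i → ⟦⟧≤1 (i ≟ᶠ v)) ⟩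
    D + ∑ (λ i → ⟦ i ≟ᶠ v ⟧ * c i) ≡⟨ cong (D +_) (∑-point v c) ⟩
    D + c v ∎)
    where open ≤-Reasoning

  W≤D : W ≤ D
  W≤D = ≤-trans (W≤c zero) (c≤D zero)

  2m≥4 : 4 ≤ m + m
  2m≥4 = ≤-pred (≤-trans 5≤g g≤t)

  s[m+1]≤W : suc m * s ≤ W
  s[m+1]≤W = weight-bound m s' (half-positive m 2m≥4) 1≤s'

  w≤B : ∀ v u → w v u ≤ ⟦ adjacent? v u ⟧ * B
  w≤B v u with adjacent? v u
  ... | yes _ = ≤-trans (w≤ v u) (≤-reflexive (sym (+-identityʳ B)))
  ... | no p = ≤-reflexive (n<1⇒n≡0 (≰⇒> p))

  c≤valency : ∀ v → c v ≤ valency v * B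
  c≤valency v = ≤-trans (∑-mono (w≤B v)) (≤-reflexive
    (trans (∑-*ʳ (λ u → ⟦ adjacent? v u ⟧) B) (cong (_* B) (sym (valency-∑ v)))))

  cancel-s : ∀ {k l} → k * (suc m * s) ≤ l * B → k * suc m ≤ l * h
  cancel-s {k} {l} le = *-cancelʳ-≤ (k * suc m) (l * h) s
    (≤-trans (≤-reflexive (*-assoc k (suc m) s)) (≤-trans le (≤-reflexive (e l s h))))
    where
    e : ∀ l s h → l * (s * h) ≡ l * h * s
    e = solve-∀

  -- Each neighbour contributes at most sh to a weighted degree that is at least W ≥ (m + 1)s.
  m<valency*h : ∀ v → m < valency v * h
  m<valency*h v = ≤-trans (≤-reflexive (sym (+-identityʳ (suc m)))) (cancel-s {1} {valency v}
    (≤-trans (≤-reflexive (+-identityʳ _)) (≤-trans s[m+1]≤W (≤-trans (W≤c v) (c≤valency v)))))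

  h≤m : h ≤ m
  h≤m with h ≤? m
  ... | yes p = p
  ... | no p = ⊥-elim (<⇒≱ (≤-trans (≤-reflexive (cong suc (sym (+-suc m m)))) (+-mono-≤ (≰⇒> p) (≰⇒> p)))
                 (≤-trans 2h≤g g≤t))

  valency> : ∀ l v → l * h ≤ m → l < valency v
  valency> l v le = *-cancelʳ-< h l (valency v) (≤-trans (s≤s le) (m<valency*h v))

  valency≥2 : ∀ v → 1 < valency v
  valency≥2 v = valency> 1 v (≤-trans (≤-reflexive (+-identityʳ h)) h≤m)

  -- The edges to `x` keep their exact weight and only the other neighbours of `y` are charged the
  -- maximum `B`; `around` gains from the sum of these exact weights.
  neighbour-bound : ∀ x y → 1 ≤ w x y → c y ≤ w x y + (valency y ∸ 1) * B
  neighbour-bound x y a = +-cancelʳ-≤ B _ _ (begin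
    c y + B ≡⟨ cong (c y +_) (sym (∑-point x (λ _ → B))) ⟩
    c y + ∑ (λ z → ⟦ z ≟ᶠ x ⟧ * B) ≡⟨ sym (∑-distrib-+ (w y) (λ z → ⟦ z ≟ᶠ x ⟧ * B)) ⟩
    ∑ (λ z → w y z + ⟦ z ≟ᶠ x ⟧ * B) ≤⟨ ∑-mono pointwise ⟩
    ∑ (λ z → ⟦ z ≟ᶠ x ⟧ * w y z + ⟦ adjacent? y z ⟧ * B) ≡⟨ ∑-distrib-+ (λ z → ⟦ z ≟ᶠ x ⟧ * w y z) (λ z → ⟦ adjacent? y z ⟧ * B) ⟩
    ∑ (λ z → ⟦ z ≟ᶠ x ⟧ * w y z) + ∑ (λ z → ⟦ adjacent? y z ⟧ * B) ≡⟨ cong₂ _+_ (trans (∑-point x (w y)) (w-sym y x))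
        (trans (∑-*ʳ (λ z → ⟦ adjacent? y z ⟧) B) (cong (_* B) (sym (valency-∑ y)))) ⟩
    w x y + valency y * B ≡⟨ cong (w x y +_) (unfold (valency y) (<⇒≤ (valency≥2 y))) ⟩
    w x y + ((valency y ∸ 1) * B + B) ≡⟨ sym (+-assoc (w x y) _ B) ⟩
    w x y + (valency y ∸ 1) * B + B ∎)
    where
    open ≤-Reasoning
    unfold : ∀ d → 1 ≤ d → d * B ≡ (d ∸ 1) * B + B
    unfold (suc d) _ = +-comm B (d * B)
    pointwise : ∀ z → w y z + ⟦ z ≟ᶠ x ⟧ * B ≤ ⟦ z ≟ᶠ x ⟧ * w y z + ⟦ adjacent? y z ⟧ * B
    pointwise z with z ≟ᶠ x
    ... | no _ = ≤-trans (≤-reflexive (+-identityʳ _)) (w≤B y z)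
    ... | yes refl = ≤-reflexive (cong₂ _+_ (sym (+-identityʳ (w y z)))
            (cong (_* B) (sym (⟦⟧-yes (adjacent? y z) (subst (1 ≤_) (w-sym z y) a)))))

  ∑N : V → (V → ℕ) → ℕ
  ∑N x f = ∑ (λ y → ⟦ adjacent? x y ⟧ * f y)

  module _ (x : V) where
    open From x

    sum-N-mono : ∀ {f f' : V → ℕ} → (∀ y → 1 ≤ w x y → f y ≤ f' y) →
      ∑N x f ≤ ∑N x f'
    sum-N-mono {f} {f'} le = ∑-mono λ y → pointwise y (adjacent? x y)
      where
      pointwise : ∀ y (d : Dec (1 ≤ w x y)) → ⟦ d ⟧ * f y ≤ ⟦ d ⟧ * f' y
      pointwise y (yes a) = +-monoˡ-≤ 0 (le y a)
      pointwise y (no _) = z≤n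

    sum-N-w : ∑N x (w x) ≤ c x
    sum-N-w = ∑-mono λ y → ≤-trans (*-monoˡ-≤ (w x y) (⟦⟧≤1 (adjacent? x y))) (≤-reflexive (+-identityʳ _))

    sum-N-+ : ∀ (f f' : V → ℕ) → ∑N x (λ y → f y + f' y) ≡
      ∑N x f + ∑N x f'
    sum-N-+ f f' = trans (∑-cong (λ y → *-distribˡ-+ ⟦ adjacent? x y ⟧ (f y) (f' y)))
      (∑-distrib-+ (λ y → ⟦ adjacent? x y ⟧ * f y) (λ y → ⟦ adjacent? x y ⟧ * f' y))

    layer-sum : second-layer ≡ ∑N x (λ y → valency y ∸ 1)
    layer-sum = trans second-layer-sum (trans (sum-N x (λ y → length (N y) ∸ 1))
      (∑-cong (λ y → cong (λ d → ⟦ adjacent? x y ⟧ * (d ∸ 1)) (sym (valency-length y)))))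

    layer-sum-* : ∀ b → ∑N x (λ y → (valency y ∸ 1) * b) ≡ second-layer * b
    layer-sum-* b = trans (∑-cong (λ y → sym (*-assoc ⟦ adjacent? x y ⟧ (valency y ∸ 1) b)))
      (trans (∑-*ʳ (λ y → ⟦ adjacent? x y ⟧ * (valency y ∸ 1)) b) (cong (_* b) (sym layer-sum)))

    sum-N-const : ∀ b → ∑N x (λ y → b) ≡ valency x * b
    sum-N-const b = trans (∑-*ʳ (λ y → ⟦ adjacent? x y ⟧) b) (cong (_* b) (sym (valency-∑ x)))

    -- The deficits are summed over `x` and its neighbours. The weights `w x y` add up to at most
    -- `c x`, so the vertex `x` and its edges account for 2D, and `B` is charged only to the second
    -- layer.
    around : valency x * D + W ≤ 2 * D + second-layer * B
    around = +-cancelˡ-≤ D _ _ (begin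
      D + (valency x * D + W) ≡⟨ sym (+-assoc D (valency x * D) W) ⟩
      suc (valency x) * D + W ≡⟨ cong (λ k → k * D + W) (sym size) ⟩
      ∑ p * D + W ≤⟨ selected p p≤1 ⟩
      D + ∑ (λ v → p v * c v) ≡⟨ cong (D +_) (trans (∑-cong (λ v → *-distribʳ-+ (c v) ⟦ v ≟ᶠ x ⟧ _))
          (∑-distrib-+ (λ v → ⟦ v ≟ᶠ x ⟧ * c v) (λ v → ⟦ adjacent? x v ⟧ * c v))) ⟩
      D + (∑ (λ v → ⟦ v ≟ᶠ x ⟧ * c v) + ∑N x c)
          ≤⟨ +-monoʳ-≤ D (+-mono-≤ (≤-trans (≤-reflexive (∑-point x c)) (c≤D x)) neighbours) ⟩
      D + (D + (D + second-layer * B)) ≡⟨ cong (D +_) (e D (second-layer * B)) ⟩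
      D + (2 * D + second-layer * B) ∎)
      where
      open ≤-Reasoning
      e : ∀ D X → D + (D + X) ≡ 2 * D + X
      e = solve-∀
      p : V → ℕ
      p v = ⟦ v ≟ᶠ x ⟧ + ⟦ adjacent? x v ⟧
      p≤1 : ∀ v → p v ≤ 1
      p≤1 v with v ≟ᶠ x
      ... | no _ = ⟦⟧≤1 (adjacent? x v)
      ... | yes refl = ≤-reflexive (cong suc (⟦⟧-no (adjacent? v v) (λ a → case subst (1 ≤_) (w-irrefl v) a of λ ())))
      size : ∑ p ≡ suc (valency x)
      size = trans (∑-distrib-+ (λ v → ⟦ v ≟ᶠ x ⟧) (λ v → ⟦ adjacent? x v ⟧)) (cong₂ _+_ (∑-point₁ x) (sym (valency-∑ x)))
      neighbours : ∑N x c ≤ D + second-layer * B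
      neighbours = ≤-trans (sum-N-mono (neighbour-bound x)) (≤-trans (≤-reflexive
        (sum-N-+ (w x) (λ y → (valency y ∸ 1) * B))) (+-mono-≤ (≤-trans sum-N-w (c≤D x)) (≤-reflexive (layer-sum-* B))))

    around' : ∀ d₀ → valency x ≡ 2 + d₀ → d₀ * D + W ≤ second-layer * B
    around' d₀ eq = +-cancelˡ-≤ (2 * D) _ _ (≤-trans (≤-reflexive (e d₀ D W)) (subst (λ d → d * D + W ≤ 2 * D + second-layer * B) eq around))
      where
      e : ∀ d D W → 2 * D + (d * D + W) ≡ (2 + d) * D + W
      e = solve-∀

    second-layer-large : ∀ d₀ → valency x ≡ 2 + d₀ → suc d₀ * suc m ≤ second-layer * h
    second-layer-large d₀ eq = cancel-s {suc d₀} {second-layer} (≤-trans (*-monoʳ-≤ (suc d₀) s[m+1]≤W)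
      (≤-trans (≤-reflexive (+-comm W (d₀ * W))) (≤-trans (+-monoˡ-≤ W (*-monoʳ-≤ d₀ W≤D)) (around' d₀ eq))))

  -- All weight at `L` goes to the complement, whose weighted degrees are at most `D`. Together with
  -- `selected` this gives 2|L|D + W ≤ (2m + 2)D, and W is positive.
  independent : ∀ L → Unique L → (∀ {u v} → u ∈ L → v ∈ L → w u v ≡ 0) → length L ≤ m
  independent L uq ind = ≤-trans (length≤∑∈ uq) (≤-pred (*-cancelʳ-< D (∑ p) (suc m)
      (*-cancelʳ-< 2 (∑ p * D) (suc m * D) (begin-strict
    ∑ p * D * 2 ≡⟨ e₁ (∑ p * D) ⟩
    ∑ p * D + ∑ p * D <⟨ +-monoʳ-< (∑ p * D) (m<m+n (∑ p * D) {W} (≤-trans (s≤s z≤n) (m≤n+m 2 ((m + m) * s')))) ⟩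
    ∑ p * D + (∑ p * D + W) ≤⟨ +-monoʳ-≤ (∑ p * D) (selected p p≤1) ⟩
    ∑ p * D + (D + ∑ (λ v → p v * c v)) ≤⟨ +-monoʳ-≤ (∑ p * D) (+-monoʳ-≤ D outside) ⟩
    ∑ p * D + (D + ∑ (λ v → q v * c v)) ≡⟨ e₂ (∑ p * D) D _ ⟩
    D + (∑ p * D + ∑ (λ v → q v * c v)) ≡⟨ cong (D +_) (trans (cong (_+ ∑ (λ v → q v * c v)) (sym (∑-*ʳ p D)))
        (sym (∑-distrib-+ (λ v → p v * D) (λ v → q v * c v)))) ⟩
    D + ∑ (λ v → p v * D + q v * c v) ≤⟨ +-monoʳ-≤ D (∑-mono bounded) ⟩
    D + ∑ {t} (λ _ → D) ≡⟨ cong (D +_) (∑-const t D) ⟩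
    D + t * D ≡⟨ e₃ m D ⟩
    suc m * D * 2 ∎))))
    where
    open ≤-Reasoning
    p q : V → ℕ
    p v = ⟦ v ∈? L ⟧
    q v = 1 ∸ p v
    p≤1 : ∀ v → p v ≤ 1
    p≤1 v = ⟦⟧≤1 (v ∈? L)
    e₁ : ∀ X → X * 2 ≡ X + X
    e₁ = solve-∀
    e₂ : ∀ X D Y → X + (D + Y) ≡ D + (X + Y)
    e₂ = solve-∀
    e₃ : ∀ m D → D + suc (m + m) * D ≡ suc m * D * 2
    e₃ = solve-∀
    bounded : ∀ v → p v * D + q v * c v ≤ D
    bounded v with v ∈? L
    ... | yes _ = ≤-reflexive (trans (+-identityʳ _) (+-identityʳ D))
    ... | no _ = ≤-trans (≤-reflexive (+-identityʳ (c v))) (c≤D v)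
    cross : ∀ u v → p u * w u v ≤ q v * w v u
    cross u v with u ∈? L | v ∈? L
    ... | no _ | _ = z≤n
    ... | yes u∈ | yes v∈ = ≤-reflexive (trans (+-identityʳ _) (ind u∈ v∈))
    ... | yes u∈ | no _ = ≤-reflexive (cong (_+ 0) (w-sym u v))
    outside : ∑ (λ v → p v * c v) ≤ ∑ (λ v → q v * c v)
    outside = begin
      ∑ (λ u → p u * c u) ≡⟨ ∑-cong (λ u → sym (∑-*ˡ (p u) (w u))) ⟩
      ∑ (λ u → ∑ (λ v → p u * w u v)) ≡⟨ ∑-swap (λ u v → p u * w u v) ⟩
      ∑ (λ v → ∑ (λ u → p u * w u v)) ≤⟨ ∑-mono (λ v → ∑-mono (λ u → cross u v)) ⟩
      ∑ (λ v → ∑ (λ u → q v * w v u)) ≡⟨ ∑-cong (λ v → ∑-*ˡ (q v) (w v)) ⟩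
      ∑ (λ v → q v * c v) ∎

  module AtVertex (x : V) where
    open From x

    a : ℕ
    a = length (walks 2)

    layers≥a : ∀ n → a ≤ length (walks (2 + n))
    layers≥a zero = ≤-refl
    layers≥a (suc n) = ≤-trans (layers≥a n) (≤-trans (≤-reflexive (sym (+-identityʳ _))) (walks-grow (λ v → subst (1 <_) (valency-length v) (valency≥2 v)) (suc n)))

    layers≥2^n : (∀ v → 2 < valency v) → ∀ n → 2 ^ n * a ≤ length (walks (2 + n))
    layers≥2^n valency≥3 zero = ≤-reflexive (+-identityʳ a)
    layers≥2^n valency≥3 (suc n) = ≤-trans (≤-reflexive (*-assoc 2 (2 ^ n) a))
      (≤-trans (*-monoʳ-≤ 2 (layers≥2^n valency≥3 n)) (walks-grow (λ v → subst (2 <_) (valency-length v) (valency≥3 v)) (suc n)))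

    -- Walks of length at most h - 1 satisfy 2(h - 1) + 1 < 2h ≤ g, just enough for ends that are
    -- distinct and pairwise nonadjacent.
    alternate≤m : ∀ b i → suc (b + (i + i)) ≡ h → length (alternate b i) ≤ m
    alternate≤m b i eq = subst (_≤ m) (length-map hd (alternate b i)) (independent (map hd (alternate b i))
      (heads-unique r (All.map (λ (j , le , wk) → b + (j + j) , wk , +-monoʳ-≤ b (+-mono-≤ le le)) (alternate-walk b i))
        (alternate-unique b i) (≤-trans (n≤1+n _) 2r+1<g))
      ind)
      where
      r = b + (i + i)
      2r+1<g : suc (r + r) < g
      2r+1<g = ≤-trans (≤-reflexive (trans (cong suc (sym (+-suc r r))) (cong₂ _+_ eq eq))) 2h≤g
      ind : ∀ {u v} → u ∈ map hd (alternate b i) → v ∈ map hd (alternate b i) → w u v ≡ 0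
      ind {u} {v} u∈ v∈ with ∈-map⁻ hd u∈ | ∈-map⁻ hd v∈ | 1 ≤? w u v
      ... | _ | _ | no p = n<1⇒n≡0 (≰⇒> p)
      ... | p , p∈ , refl | q , q∈ , refl | yes adj = ⊥-elim (alternate-independent b i
              (All.lookup (alternate-walk b i) p∈) (All.lookup (alternate-walk b i) q∈) 2r+1<g (N∈ adj))

    module _ (d : ℕ) (valency≡ : valency x ≡ 3 + d) where

      a' : ℕ
      a' = second-layer

      a'-large : (2 + d) * suc m ≤ a' * h
      a'-large = second-layer-large x (suc d) valency≡

      a-large : (2 + d) * suc m ≤ a * h
      a-large = ≤-trans a'-large (*-monoˡ-≤ h second-layer≤)

      -- Walks of length at most two have distinct ends because 4 < g.
      ball : suc (valency x + a) ≤ t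
      ball = subst (_≤ t) size (unique-length (map hd ws) (heads-unique 2
          (All.++⁺ (All.map (λ wk → 0 , wk , z≤n) (walks-walk 0)) (All.++⁺ (All.map (λ wk → 1 , wk , s≤s z≤n) (walks-walk 1))
            (All.map (λ wk → 2 , wk , ≤-refl) (walks-walk 2))))
          (Unique.++⁺ (walks-unique 0) (Unique.++⁺ (walks-unique 1) (walks-unique 2)
              (λ (p , q) → lengths (walks-walk 1) (walks-walk 2) p q (λ ())))
            (λ (p , q) → [ (λ q → lengths (walks-walk 0) (walks-walk 1) p q (λ ()))
                         , (λ q → lengths (walks-walk 0) (walks-walk 2) p q (λ ())) ]′ (∈-++⁻ (walks 1) q)))
          5≤g))
        where
        ws = walks 0 ++ walks 1 ++ walks 2
        lengths : ∀ {n n' p} {ws ws'} → All (Walk n) ws → All (Walk n') ws' → p ∈ ws → p ∈ ws' → n ≢ n' → ⊥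
        lengths all all' p∈ q∈ n≢ with All.lookup all p∈ | All.lookup all' q∈
        ... | walk _ _ l | walk _ _ l' = n≢ (suc-injective (trans (sym l) l'))
        size : length (map hd ws) ≡ suc (valency x + a)
        size = trans (length-map hd ws) (trans (length-++ (walks 0)) (cong₂ _+_ length-walks₀
          (trans (length-++ (walks 1)) (cong (_+ a) (trans length-walks₁ (sym (valency-length x)))))))

      large : ∀ b i → 1 ≤ i → suc (b + (i + i)) ≡ h → 1 + 2 * b ≤ length (walks b) → 4 ≤ a × h + h ≤ suc m × (suc m ≤ h + h → a ≤ 4)
      large b i 1≤i eq lb = layer-arith m h b i a eq 1≤i
        (≤-trans (+-monoˡ-≤ (i * a) lb) (≤-trans (length-alternate b i a layers≥a) (alternate≤m b i eq)))
        (≤-trans (*-monoˡ-≤ (suc m) (m≤m+n 2 d)) a-large)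

      -- Three neighbours share a second layer of four. Summing `tight-point` over them gives 12h +
      -- 4 ≤ 4h + 8h + 3.
      tight-sum : valency x ≡ 3 → a' ≡ 4 → B ≡ 2 * h → 4 * h ≡ W → D ≤ 4 * h → ⊥
      tight-sum valency≡3 a'≡4 B≡ W≡ D≤ = <-irrefl refl (begin-strict
        3 * (4 * h) + 3
          <⟨ +-monoʳ-< (3 * (4 * h)) ≤-refl ⟩
        3 * (4 * h) + 4
          ≡⟨ cong₂ _+_ (cong (_* (4 * h)) (sym valency≡3)) (trans (sym a'≡4) (layer-sum x)) ⟩
        valency x * (4 * h) + ∑N x e
          ≡⟨ cong (_+ ∑N x e) (sym (sum-N-const x (4 * h))) ⟩
        ∑N x (λ y → 4 * h) + ∑N x e
          ≡⟨ sym (sum-N-+ x (λ _ → 4 * h) e) ⟩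
        ∑N x (λ y → 4 * h + e y)
          ≤⟨ sum-N-mono x (λ y adj → tight-point h (e y) (w x y) (≤-trans (s≤s z≤n) 2≤h) (∸-monoˡ-≤ 1 (valency≥2 y)) adj
               (≤-trans (≤-reflexive W≡) (≤-trans (W≤c y) (subst (λ b → c y ≤ w x y + e y * b) B≡ (neighbour-bound x y adj))))) ⟩
        ∑N x (λ y → w x y + (e y * (2 * h) + 1))
          ≡⟨ sum-N-+ x (w x) (λ y → e y * (2 * h) + 1) ⟩
        ∑N x (w x) + ∑N x (λ y → e y * (2 * h) + 1)
          ≤⟨ +-mono-≤ (≤-trans (sum-N-w x) (≤-trans (c≤D x) D≤)) (≤-reflexive (trans (sum-N-+ x (λ y → e y * (2 * h)) (λ _ → 1))
               (cong₂ _+_ (trans (layer-sum-* x (2 * h)) (cong (_* (2 * h)) a'≡4)) (trans (sum-N-const x 1) (trans (*-identityʳ _) valency≡3))))) ⟩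
        4 * h + (4 * (2 * h) + 3)
          ≡⟨ regroup h ⟩
        3 * (4 * h) + 3 ∎)
        where
        open ≤-Reasoning
        e : V → ℕ
        e y = valency y ∸ 1
        regroup : ∀ h → 4 * h + (4 * (2 * h) + 3) ≡ 3 * (4 * h) + 3
        regroup = solve-∀

      tight : suc m ≡ h + h → a ≤ 4 → ⊥
      tight eq a≤4 =
        let a'≡4 , d≡0 = tight-layer m h a' d eq 2≤h (≤-trans second-layer≤ a≤4) a'-large
            valency≡3 = trans valency≡ (cong (3 +_) d≡0)
            s'≡1 , W≡ , D≤ = tight-weights m h s' D eq 2≤h 1≤s' W≤D
              (subst₂ (λ k l → k + W ≤ l * B) (+-identityʳ D) a'≡4 (around' x 1 valency≡3))
        in tight-sum valency≡3 a'≡4 (cong (λ k → suc k * h) s'≡1) W≡ D≤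

  not-cubic : (∀ v → valency v ≡ 3) → ⊥
  not-cubic cubic with handshake (λ v u → ⟦ adjacent? v u ⟧) symmetric (λ v → ⟦⟧-no (adjacent? v v) irreflexive)
    where
    irreflexive : ∀ {v} → ¬ 1 ≤ w v v
    irreflexive {v} adj = case subst (1 ≤_) (w-irrefl v) adj of λ ()
    symmetric : ∀ v u → ⟦ adjacent? v u ⟧ ≡ ⟦ adjacent? u v ⟧
    symmetric v u = ≤-antisym (⟦⟧-mono (adjacent? v u) (adjacent? u v) (subst (1 ≤_) (w-sym v u)))
                              (⟦⟧-mono (adjacent? u v) (adjacent? v u) (subst (1 ≤_) (w-sym u v)))
  ... | e , eq = even≢odd e (3 * m + 1) (trans (cong (e +_) (+-identityʳ e)) (trans (sym eq)
        (trans (∑-cong (λ v → trans (sym (valency-∑ v)) (cubic v))) (trans (∑-const t 3) (odd m)))))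
    where
    odd : ∀ m → suc (m + m) * 3 ≡ suc (2 * (3 * m + 1))
    odd = solve-∀

  -- For h = 2 and h = 3 the counting leaves only cubic graphs, which have an even number of vertices.
  valency≤2 : ∀ v → valency v ≤ 2
  valency≤2 v with valency v ≤? 2
  ... | yes p = p
  ... | no p = ⊥-elim (contradict v (≰⇒> p))
    where
    split : ∀ {n} → 3 ≤ n → n ≡ 3 + (n ∸ 3)
    split (s≤s (s≤s (s≤s _))) = refl
    contradict : ∀ x → 3 ≤ valency x → ⊥
    contradict x valency≥3 with h ≤? 2
    ... | yes h≤2 = not-cubic cubic
      where
      h≡2 : h ≡ 2
      h≡2 = ≤-antisym h≤2 2≤h
      bounds : ∀ y → 3 ≤ valency y → 4 ≤ m × (valency y ≡ 3 ⊎ 11 ≤ m × valency y ≡ 4)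
      bounds y le = small-arith m (valency y ∸ 3) (valency y) _ (split le) (AtVertex.ball y _ (split le))
        (subst (λ k → (2 + (valency y ∸ 3)) * suc m ≤ length (From.walks y 2) * k) h≡2 (AtVertex.a-large y _ (split le)))
      all≥3 : ∀ y → 3 ≤ valency y
      all≥3 y = valency> 2 y (subst (λ k → 2 * k ≤ m) (sym h≡2) (proj₁ (bounds x valency≥3)))
      cubic : ∀ y → valency y ≡ 3
      -- Valency four needs m ≥ 11, but m is less than valency times h, here 8.
      cubic y = [ id , (λ (m≥11 , eq) → ⊥-elim (<⇒≱ (subst₂ (λ k l → m < k * l) eq h≡2 (m<valency*h y))
        (≤-trans (m≤n+m 8 3) m≥11))) ]′ (proj₂ (bounds y (all≥3 y)))
    ... | no h≰2 with decompose h (≰⇒> h≰2)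
    ...   | b , i , b≤1 , 1≤i , eq = finish
      where
      lb : ∀ y → 3 ≤ valency y → ∀ b → b ≤ 1 → 1 + 2 * b ≤ length (From.walks y b)
      lb y le zero _ = ≤-reflexive (sym (From.length-walks₀ y))
      lb y le (suc zero) _ = ≤-trans le (≤-reflexive (trans (valency-length y) (sym (From.length-walks₁ y))))
      lb y le (suc (suc _)) (s≤s ())
      all≥3 : ∀ y → 2 < valency y
      all≥3 = beyond (AtVertex.large x _ (split valency≥3) b i 1≤i eq (lb x valency≥3 b b≤1)) (suc m ≤? h + h)
        where
        a = length (From.walks x 2)
        beyond : 4 ≤ a × h + h ≤ suc m × (suc m ≤ h + h → a ≤ 4) → Dec (suc m ≤ h + h) → ∀ y → 2 < valency y
        beyond (_ , le , ub) (yes le') = ⊥-elim (AtVertex.tight x _ (split valency≥3) (≤-antisym le' le) (ub le'))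
        beyond (_ , le , ub) (no gt) y =
          valency> 2 y (≤-trans (≤-reflexive (cong (h +_) (+-identityʳ h))) (≤-pred (≰⇒> gt)))
      finish : ⊥
      finish with h ≤? 3
      ... | no h≰3 = big-arith m h (length (From.walks x 2)) (≰⇒> h≰3)
            (≤-trans (AtVertex.layers≥2^n x all≥3 (h ∸ 3)) (≤-trans
              (≤-reflexive (cong (length ∘ From.walks x) (depth h (b + (i + i)) eq (≰⇒> h≰3))))
              (≤-trans (From.last≤alternate x b i) (AtVertex.alternate≤m x b i eq))))
            (≤-trans (*-monoˡ-≤ (suc m) (m≤m+n 2 (valency x ∸ 3))) (AtVertex.a-large x _ (split valency≥3)))
        where
        depth : ∀ h r → suc r ≡ h → 4 ≤ h → 2 + (h ∸ 3) ≡ r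
        depth _ (suc (suc r)) refl _ = refl
        depth _ zero refl (s≤s ())
        depth _ (suc zero) refl (s≤s (s≤s ()))
      ... | yes h≤3 = not-cubic λ y → three-arith m (valency y ∸ 3) (valency y) _ (split (all≥3 y))
            (≤-trans (≤-trans (≤-reflexive (cong₂ _+_ (sym (From.length-walks₀ y)) (sym (+-identityʳ _)))) (From.length-alternate y 0 1 _ (AtVertex.layers≥a y))) (AtVertex.alternate≤m y 0 1 (sym h≡3)))
            (subst (λ k → (2 + (valency y ∸ 3)) * suc m ≤ length (From.walks y 2) * k) h≡3 (AtVertex.a-large y _ (split (all≥3 y))))
        where
        h≡3 : h ≡ 3
        h≡3 = ≤-antisym h≤3 (≰⇒> h≰2)

  no-three-neighbours : ∀ v a b c → a ≢ b → a ≢ c → b ≢ c → 1 ≤ w v a → 1 ≤ w v b → 1 ≤ w v c → ⊥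
  no-three-neighbours v a b c a≢b a≢c b≢c wa wb wc = <⇒≱ (unique-⊆-length (a ∷ b ∷ c ∷ []) (N v)
      ((a≢b ∷ a≢c ∷ []) ∷ (b≢c ∷ []) ∷ [] ∷ []) λ where
        (here refl) → N∈ wa
        (there (here refl)) → N∈ wb
        (there (there (here refl))) → N∈ wc)
    (≤-trans (≤-reflexive (sym (valency-length v))) (valency≤2 v))

-- Cyclic orders

unique-lookup : ∀ {A : Set} {xs : List A} → Unique xs → Injective _≡_ _≡_ (lookup xs)
unique-lookup {xs = v ∷ xs} (v∉ ∷ u) {zero} {zero} e = refl
unique-lookup {xs = v ∷ xs} (v∉ ∷ u) {zero} {suc j} e = ⊥-elim (All.lookup v∉ (∈-lookup {xs = xs} j) e)
unique-lookup {xs = v ∷ xs} (v∉ ∷ u) {suc i} {zero} e = ⊥-elim (All.lookup v∉ (∈-lookup {xs = xs} i) (sym e))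
unique-lookup {xs = v ∷ xs} (v∉ ∷ u) {suc i} {suc j} e = cong suc (unique-lookup u e)

module _ {A : Set} {R : A → A → Set} where

  linked-step : ∀ u pre {z} → Linked R (u ∷ pre ++ [ z ]) → ∀ i (p : toℕ i < length pre) →
    R (lookup (u ∷ pre) i) (lookup (u ∷ pre) (fromℕ< (s≤s p)))
  linked-step u (v ∷ pre) (r ∷ l) zero p = r
  linked-step u (v ∷ pre) (r ∷ l) (suc i) (s≤s p) = linked-step v pre l i p

  linked-last : ∀ u pre {z} → Linked R (u ∷ pre ++ [ z ]) → ∀ i → ¬ toℕ i < length pre →
    R (lookup (u ∷ pre) i) z
  linked-last u [] (r ∷ l) zero p = r
  linked-last u (v ∷ pre) (r ∷ l) zero p = ⊥-elim (p (s≤s z≤n))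
  linked-last u (v ∷ pre) (r ∷ l) (suc i) p = linked-last v pre l i (λ q → p (s≤s q))

  linked-next : ∀ u pre → Linked R (u ∷ pre ++ [ u ]) → ∀ i →
    R (lookup (u ∷ pre) i) (lookup (u ∷ pre) (next i))
  linked-next u pre l i with toℕ i <? length pre
  ... | yes p = linked-step u pre l i p
  ... | no p = linked-last u pre l i p

cycle-of-list : ∀ G u pre → Unique (u ∷ pre) → Linked (Adjacent G) (u ∷ pre ++ [ u ]) →
                HasCycleOfLength G (suc (length pre))
cycle-of-list G u pre uq l = lookup (u ∷ pre) , unique-lookup uq , linked-next u pre l

next-toℕ : ∀ {ℓ} (i : Fin (suc ℓ)) → toℕ (next i) ≡ suc (toℕ i) ⊎ (toℕ i ≡ ℓ × toℕ (next i) ≡ 0)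
next-toℕ {ℓ} i with toℕ i <? ℓ
... | yes p = inj₁ (toℕ-fromℕ< (s≤s p))
... | no p = inj₂ (≤-antisym (≤-pred (toℕ<n i)) (≮⇒≥ p) , refl)

prev : ∀ {ℓ} (i : Fin (suc ℓ)) → ∃[ j ] next j ≡ i
prev {ℓ} zero = fromℕ ℓ , toℕ-injective (at-end (next-toℕ (fromℕ ℓ)))
  where
  at-end : toℕ (next (fromℕ ℓ)) ≡ suc (toℕ (fromℕ ℓ)) ⊎ (toℕ (fromℕ ℓ) ≡ ℓ × toℕ (next (fromℕ ℓ)) ≡ 0) →
           toℕ (next (fromℕ ℓ)) ≡ 0
  at-end (inj₂ (_ , e)) = e
  at-end (inj₁ e) = ⊥-elim (<-irrefl refl (≤-trans (≤-reflexive (cong suc (sym (trans e (cong suc (toℕ-fromℕ ℓ))))))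
                      (toℕ<n (next (fromℕ ℓ)))))
prev {suc ℓ} (suc i) = inject₁ i , toℕ-injective (before (next-toℕ (inject₁ i)))
  where
  before : toℕ (next (inject₁ i)) ≡ suc (toℕ (inject₁ i)) ⊎ (toℕ (inject₁ i) ≡ suc ℓ × toℕ (next (inject₁ i)) ≡ 0) →
           toℕ (next (inject₁ i)) ≡ suc (toℕ i)
  before (inj₁ e) = trans e (cong suc (toℕ-inject₁ i))
  before (inj₂ (e , _)) = ⊥-elim (<⇒≢ (toℕ<n i) (trans (sym (toℕ-inject₁ i)) e))

next-next≢ : ∀ {ℓ} → 2 ≤ ℓ → (i : Fin (suc ℓ)) → next (next i) ≢ i
next-next≢ {ℓ} 2≤ℓ i e with next-toℕ i | next-toℕ (next i)
... | inj₁ p | inj₁ q = m≢1+m+n (toℕ i) (trans (sym (cong toℕ e)) (trans q (trans (cong suc p) (+-comm 1 (suc (toℕ i))))))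
... | inj₁ p | inj₂ (r , q) = <⇒≢ 2≤ℓ (trans (cong suc (trans (sym q) (cong toℕ e))) (trans (sym p) r))
... | inj₂ (r , p) | inj₁ q = <⇒≢ 2≤ℓ (trans (sym (trans q (cong suc p))) (trans (cong toℕ e) r))
... | inj₂ (r , p) | inj₂ (r' , q) = <⇒≢ (≤-trans (s≤s z≤n) 2≤ℓ) (trans (sym p) r')

-- A vertex of the cycle is related to its successor and its predecessor, which differ; a further
-- neighbour would be a third.
cycle-neighbours : ∀ {ℓ nv} (p : Fin (suc ℓ) → Fin nv) → Injective _≡_ _≡_ p → 2 ≤ ℓ →
  (R : Fin nv → Fin nv → Set) → (∀ {u v} → R u v → R v u) → (∀ i → R (p i) (p (next i))) →
  (∀ {u a b c} → a ≢ b → a ≢ c → b ≢ c → R u a → R u b → R u c → ⊥) →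
  ∀ {i z} → R (p i) z → ∃[ j ] (z ≡ p j × (j ≡ next i ⊎ i ≡ next j))
cycle-neighbours p inj 2≤ℓ R R-sym R-next three {i} {z} r with z ≟ᶠ p (next i) | prev i
... | yes e | _ = next i , e , inj₁ refl
... | no e | h , refl with z ≟ᶠ p h
...   | yes e' = h , e' , inj₂ refl
...   | no e' = ⊥-elim (three (λ q → e (sym q)) (λ q → next-next≢ 2≤ℓ h (inj q)) e'
                  (R-next (next h)) r (R-sym (R-next h)))

-- Counting coloured edges

≤1∧≥1 : ∀ {n} → n ≤ 1 → 1 ≤ n → n ≡ 1
≤1∧≥1 (s≤s z≤n) (s≤s z≤n) = refl

∑-deficient : ∀ {n} {f : Fin n → ℕ} → (∀ i j → f i ≡ 0 → f j ≡ 0 → i ≡ j) → n ≤ 1 + ∑ f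
∑-deficient {n} {f} one = begin
  n ≡⟨ sym (trans (∑-const n 1) (*-identityʳ n)) ⟩
  ∑ {n} (λ _ → 1) ≤⟨ ∑-mono pointwise ⟩
  ∑ (λ i → ⟦ f i ≟ 0 ⟧ + f i) ≡⟨ ∑-distrib-+ (λ i → ⟦ f i ≟ 0 ⟧) f ⟩
  ∑ (λ i → ⟦ f i ≟ 0 ⟧) + ∑ f ≤⟨ +-monoˡ-≤ (∑ f) (∑≤1 (λ i → ⟦⟧≤1 (f i ≟ 0))
      (λ i j p q → one i j (⟦⟧≥1 (f i ≟ 0) p) (⟦⟧≥1 (f j ≟ 0) q))) ⟩
  1 + ∑ f ∎
  where
  open ≤-Reasoning
  pointwise : ∀ i → 1 ≤ ⟦ f i ≟ 0 ⟧ + f i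
  pointwise i with f i
  ... | zero = ≤-refl
  ... | suc _ = s≤s z≤n

∑-by-class : ∀ {n k} (φ : Fin n → Fin k) (K : Fin k → ℕ) (r : Fin n → ℕ) →
  ∑ (λ f → K (φ f) * r f) ≡ ∑ (λ c → K c * ∑ (λ f → ⟦ φ f ≟ᶠ c ⟧ * r f))
∑-by-class φ K r = begin
  ∑ (λ f → K (φ f) * r f) ≡⟨ ∑-cong (λ f → sym (trans (∑-cong (λ c → cong (_* (K c * r f)) (flip (φ f) c)))
      (∑-point (φ f) (λ c → K c * r f)))) ⟩
  ∑ (λ f → ∑ (λ c → ⟦ φ f ≟ᶠ c ⟧ * (K c * r f))) ≡⟨ ∑-swap (λ f c → ⟦ φ f ≟ᶠ c ⟧ * (K c * r f)) ⟩
  ∑ (λ c → ∑ (λ f → ⟦ φ f ≟ᶠ c ⟧ * (K c * r f))) ≡⟨ ∑-cong (λ c → trans (∑-cong (λ f → regroup ⟦ φ f ≟ᶠ c ⟧ (K c) (r f)))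
      (∑-*ˡ (K c) (λ f → ⟦ φ f ≟ᶠ c ⟧ * r f))) ⟩
  ∑ (λ c → K c * ∑ (λ f → ⟦ φ f ≟ᶠ c ⟧ * r f)) ∎
  where
  open ≡-Reasoning
  regroup : ∀ a b c → a * (b * c) ≡ b * (a * c)
  regroup = solve-∀
  flip : ∀ {k} (a b : Fin k) → ⟦ a ≟ᶠ b ⟧ ≡ ⟦ b ≟ᶠ a ⟧
  flip a b = ≤-antisym (⟦⟧-mono (a ≟ᶠ b) (b ≟ᶠ a) sym) (⟦⟧-mono (b ≟ᶠ a) (a ≟ᶠ b) sym)

module Incidence (G : Multigraph) where

  opaque
    inc? : ∀ f v → Dec (Incident G f v)
    inc? f v = (src G f ≟ᶠ v) ⊎-dec (tgt G f ≟ᶠ v)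

    joins? : ∀ f u v → Dec (Joins G f u v)
    joins? f u v = ((src G f ≟ᶠ u) ×-dec (tgt G f ≟ᶠ v)) ⊎-dec ((src G f ≟ᶠ v) ×-dec (tgt G f ≟ᶠ u))

    deg-∑ : ∀ v → deg G v ≡ ∑ (λ f → ⟦ inc? f v ⟧)
    deg-∑ v = length-filter (λ f → T? (does (inc? f v))) id

    mult-∑ : ∀ u v → mult G u v ≡ ∑ (λ f → ⟦ joins? f u v ⟧)
    mult-∑ u v = length-filter (λ f → T? (does (joins? f u v))) id

  ⟦joins⟧-sym : ∀ f u v → ⟦ joins? f u v ⟧ ≡ ⟦ joins? f v u ⟧
  ⟦joins⟧-sym f u v = ≤-antisym (⟦⟧-mono (joins? f u v) (joins? f v u) (Colourings.joins-sym G 0 {f}))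
    (⟦⟧-mono (joins? f v u) (joins? f u v) (Colourings.joins-sym G 0 {f}))

  row≤inc : ∀ {t} (pt : Fin t → Vert G) → Injective _≡_ _≡_ pt → ∀ f u →
            ∑ (λ j → ⟦ joins? f u (pt j) ⟧) ≤ ⟦ inc? f u ⟧
  row≤inc pt inj f u with inc? f u
  ... | no ¬i = ≤-reflexive (∑-zero (λ j → ⟦⟧-no (joins? f u (pt j)) (¬i ∘ Colourings.joins-incˡ G 0 {f})))
  ... | yes _ = ∑≤1 (λ j → ⟦⟧≤1 (joins? f u (pt j))) (λ i j p q → inj (Colourings.joins-functional G 0 {f}
          (⟦⟧≥1 (joins? f u (pt i)) p) (⟦⟧≥1 (joins? f u (pt j)) q)))

  -- Ordered pairs are counted, so an edge between two of the points contributes 2 and parity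
  -- arguments apply directly.
  pairs : ∀ {t} → (Fin t → Vert G) → Edge G → ℕ
  pairs pt f = ∑ (λ i → ∑ (λ j → ⟦ joins? f (pt i) (pt j) ⟧))

  pairs≥2 : ∀ {t} (pt : Fin t → Vert G) f i₁ i₂ → pt i₁ ≡ src G f → pt i₂ ≡ tgt G f → 2 ≤ pairs pt f
  pairs≥2 pt f i₁ i₂ e₁ e₂ = ≤-trans (≤-reflexive (sym (trans (∑-distrib-+ (λ i → ⟦ i ≟ᶠ i₁ ⟧) (λ i → ⟦ i ≟ᶠ i₂ ⟧))
    (cong₂ _+_ (∑-point₁ i₁) (∑-point₁ i₂))))) (∑-mono pointwise)
    where
    entry : ∀ i j → Joins G f (pt i) (pt j) → 1 ≤ ∑ (λ j → ⟦ joins? f (pt i) (pt j) ⟧)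
    entry i j jn = ≤-trans (≤-reflexive (sym (⟦⟧-yes (joins? f (pt i) (pt j)) jn)))
      (term≤∑ (λ j → ⟦ joins? f (pt i) (pt j) ⟧) j)
    pointwise : ∀ i → ⟦ i ≟ᶠ i₁ ⟧ + ⟦ i ≟ᶠ i₂ ⟧ ≤ ∑ (λ j → ⟦ joins? f (pt i) (pt j) ⟧)
    pointwise i with i ≟ᶠ i₁ | i ≟ᶠ i₂
    ... | yes refl | yes refl = ⊥-elim (loopless G f (trans (sym e₁) e₂))
    ... | yes refl | no _ = entry i i₂ (inj₁ (sym e₁ , sym e₂))
    ... | no _ | yes refl = entry i i₁ (inj₂ (sym e₁ , sym e₂))
    ... | no _ | no _ = z≤n

  pairs≤2 : ∀ {t} (pt : Fin t → Vert G) → Injective _≡_ _≡_ pt → ∀ f → pairs pt f ≤ 2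
  pairs≤2 pt inj f = begin
    pairs pt f ≤⟨ ∑-mono (λ i → row≤inc pt inj f (pt i)) ⟩
    ∑ (λ i → ⟦ inc? f (pt i) ⟧) ≤⟨ ∑-mono split ⟩
    ∑ (λ i → ⟦ src G f ≟ᶠ pt i ⟧ + ⟦ tgt G f ≟ᶠ pt i ⟧) ≡⟨ ∑-distrib-+ (λ i → ⟦ src G f ≟ᶠ pt i ⟧) (λ i → ⟦ tgt G f ≟ᶠ pt i ⟧) ⟩
    ∑ (λ i → ⟦ src G f ≟ᶠ pt i ⟧) + ∑ (λ i → ⟦ tgt G f ≟ᶠ pt i ⟧) ≤⟨ +-mono-≤ (at-most-one (src G f)) (at-most-one (tgt G f)) ⟩
    2 ∎
    where
    open ≤-Reasoning
    split : ∀ i → ⟦ inc? f (pt i) ⟧ ≤ ⟦ src G f ≟ᶠ pt i ⟧ + ⟦ tgt G f ≟ᶠ pt i ⟧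
    split i with inc? f (pt i)
    ... | no _ = z≤n
    ... | yes (inj₁ e) = ≤-trans (≤-reflexive (sym (⟦⟧-yes (src G f ≟ᶠ pt i) e))) (m≤m+n _ _)
    ... | yes (inj₂ e) = ≤-trans (≤-reflexive (sym (⟦⟧-yes (tgt G f ≟ᶠ pt i) e))) (m≤n+m _ ⟦ src G f ≟ᶠ pt i ⟧)
    at-most-one : ∀ v → ∑ (λ i → ⟦ v ≟ᶠ pt i ⟧) ≤ 1
    at-most-one v = ∑≤1 (λ i → ⟦⟧≤1 (v ≟ᶠ pt i)) (λ i j p q →
      inj (trans (sym (⟦⟧≥1 (v ≟ᶠ pt i) p)) (⟦⟧≥1 (v ≟ᶠ pt j) q)))

  pairs≥1 : ∀ {t} (pt : Fin t → Vert G) f → 1 ≤ pairs pt f → ∃[ i ] ∃[ j ] Joins G f (pt i) (pt j)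
  pairs≥1 pt f le with ∑≥1 (λ i → ∑ (λ j → ⟦ joins? f (pt i) (pt j) ⟧)) le
  ... | i , le' with ∑≥1 (λ j → ⟦ joins? f (pt i) (pt j) ⟧) le'
  ...   | j , le'' = i , j , ⟦⟧≥1 (joins? f (pt i) (pt j)) le''

module ColourCount (H : Multigraph) (k : ℕ) (φ : Edge H → Fin k) (proper : ProperEdgeColouring H k φ) where
  open Colourings H k
  open Incidence H

  at : Colour → V → ℕ
  at c v = ∑ (λ f → ⟦ φ f ≟ᶠ c ⟧ * ⟦ inc? f v ⟧)

  misses : V → ℕ
  misses v = ∑ (λ c → ⟦ miss? φ c v ⟧)

  product≥1 : ∀ {P Q : Set} (p : Dec P) (q : Dec Q) → 1 ≤ ⟦ p ⟧ * ⟦ q ⟧ → P × Q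
  product≥1 (yes p) (yes q) _ = p , q
  product≥1 (yes _) (no _) ()
  product≥1 (no _) _ ()

  product≤1 : ∀ {P Q : Set} (p : Dec P) (q : Dec Q) → ⟦ p ⟧ * ⟦ q ⟧ ≤ 1
  product≤1 (yes _) q = ≤-trans (≤-reflexive (+-identityʳ _)) (⟦⟧≤1 q)
  product≤1 (no _) q = z≤n

  at≤1 : ∀ c v → at c v ≤ 1
  at≤1 c v = ∑≤1 (λ f → product≤1 (φ f ≟ᶠ c) (inc? f v)) λ f f' p q →
    let e , i = product≥1 (φ f ≟ᶠ c) (inc? f v) p
        e' , i' = product≥1 (φ f' ≟ᶠ c) (inc? f' v) q
    in same-edge proper i i' (trans e (sym e'))

  at+miss : ∀ c v → at c v + ⟦ miss? φ c v ⟧ ≡ 1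
  at+miss c v with miss⊎sees φ c v
  ... | inj₁ m = cong₂ _+_ (∑-zero zero-at) (⟦⟧-yes (miss? φ c v) m)
    where
    zero-at : ∀ f → ⟦ φ f ≟ᶠ c ⟧ * ⟦ inc? f v ⟧ ≡ 0
    zero-at f with φ f ≟ᶠ c | inc? f v
    ... | no _ | _ = refl
    ... | yes e | yes i = ⊥-elim (m f i e)
    ... | yes e | no _ = refl
  ... | inj₂ (f , i , e) = trans (cong (at c v +_) (⟦⟧-no (miss? φ c v) (λ m → m f i e))) (trans (+-identityʳ _) (≤1∧≥1 (at≤1 c v) (≤-trans
          (≤-reflexive (sym (cong₂ _*_ (⟦⟧-yes (φ f ≟ᶠ c) e) (⟦⟧-yes (inc? f v) i))))
          (term≤∑ (λ f → ⟦ φ f ≟ᶠ c ⟧ * ⟦ inc? f v ⟧) f))))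

  selected-count : ∀ {K : Colour → Set} (K? : ∀ c → Dec (K c)) v → (∀ c → Miss φ c v → K c) →
    ∑ (λ c → ⟦ K? c ⟧) ≡ ∑ (λ f → ⟦ K? (φ f) ⟧ * ⟦ inc? f v ⟧) + misses v
  selected-count K? v mK = begin
    ∑ (λ c → ⟦ K? c ⟧) ≡⟨ ∑-cong (λ c → sym (trans (sym (*-distribˡ-+ ⟦ K? c ⟧ (at c v) ⟦ miss? φ c v ⟧))
        (trans (cong (⟦ K? c ⟧ *_) (at+miss c v)) (*-identityʳ _)))) ⟩
    ∑ (λ c → ⟦ K? c ⟧ * at c v + ⟦ K? c ⟧ * ⟦ miss? φ c v ⟧) ≡⟨ ∑-distrib-+ (λ c → ⟦ K? c ⟧ * at c v) (λ c → ⟦ K? c ⟧ * ⟦ miss? φ c v ⟧) ⟩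
    ∑ (λ c → ⟦ K? c ⟧ * at c v) + ∑ (λ c → ⟦ K? c ⟧ * ⟦ miss? φ c v ⟧)
      ≡⟨ cong₂ _+_ (sym (∑-by-class φ (λ c → ⟦ K? c ⟧) (λ f → ⟦ inc? f v ⟧))) (∑-cong absorb) ⟩
    ∑ (λ f → ⟦ K? (φ f) ⟧ * ⟦ inc? f v ⟧) + misses v ∎
    where
    open ≡-Reasoning
    absorb : ∀ c → ⟦ K? c ⟧ * ⟦ miss? φ c v ⟧ ≡ ⟦ miss? φ c v ⟧
    absorb c with miss? φ c v
    ... | no _ = *-zeroʳ ⟦ K? c ⟧
    ... | yes m = trans (*-identityʳ _) (⟦⟧-yes (K? c) (mK c m))

  degree-count : ∀ v → k ≡ deg H v + misses v
  degree-count v = trans (sym (trans (∑-const k 1) (*-identityʳ k)))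
    (trans (selected-count {K = λ _ → V} (λ _ → yes v) v (λ _ _ → v))
      (cong (_+ misses v) (trans (∑-cong (λ f → +-identityʳ _)) (sym (deg-∑ v)))))

  module Points {t : ℕ} (pt : Fin t → V) (inj : Injective _≡_ _≡_ pt) where

    matched : Colour → Fin t → Fin t → ℕ
    matched c i j = ∑ (λ f → ⟦ φ f ≟ᶠ c ⟧ * ⟦ joins? f (pt i) (pt j) ⟧)

    row : Colour → Fin t → ℕ
    row c i = ∑ (matched c i)

    row-edges : ∀ c i → row c i ≡ ∑ (λ f → ⟦ φ f ≟ᶠ c ⟧ * ∑ (λ j → ⟦ joins? f (pt i) (pt j) ⟧))
    row-edges c i = trans (∑-swap (λ j f → ⟦ φ f ≟ᶠ c ⟧ * ⟦ joins? f (pt i) (pt j) ⟧))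
      (∑-cong (λ f → ∑-*ˡ ⟦ φ f ≟ᶠ c ⟧ (λ j → ⟦ joins? f (pt i) (pt j) ⟧)))

    row≤1 : ∀ c i → row c i ≤ 1
    row≤1 c i = ≤-trans (≤-reflexive (row-edges c i)) (≤-trans
      (∑-mono (λ f → *-monoʳ-≤ ⟦ φ f ≟ᶠ c ⟧ (row≤inc pt inj f (pt i)))) (at≤1 c (pt i)))

    inside-row : ∀ c i → Inside φ pt c (pt i) → 1 ≤ row c i
    inside-row c i (f , j , jn , e) = ≤-trans (≤-trans
      (≤-reflexive (sym (cong₂ _*_ (⟦⟧-yes (φ f ≟ᶠ c) e) (⟦⟧-yes (joins? f (pt i) (pt j)) jn))))
      (term≤∑ (λ f → ⟦ φ f ≟ᶠ c ⟧ * ⟦ joins? f (pt i) (pt j) ⟧) f)) (term≤∑ (matched c i) j)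

    row-inside : ∀ c i → 1 ≤ row c i → Inside φ pt c (pt i)
    row-inside c i le with ∑≥1 (matched c i) le
    ... | j , le' with ∑≥1 (λ f → ⟦ φ f ≟ᶠ c ⟧ * ⟦ joins? f (pt i) (pt j) ⟧) le'
    ...   | f , le'' with product≥1 (φ f ≟ᶠ c) (joins? f (pt i) (pt j)) le''
    ...     | e , jn = f , j , jn , e

    rows-even : ∀ c → ∃[ e ] ∑ (row c) ≡ e + e
    rows-even c = handshake (matched c)
      (λ i j → ∑-cong (λ f → cong (⟦ φ f ≟ᶠ c ⟧ *_) (⟦joins⟧-sym f (pt i) (pt j))))
      (λ i → ∑-zero (λ f → trans (cong (⟦ φ f ≟ᶠ c ⟧ *_) (⟦⟧-no (joins? f (pt i) (pt i)) (λ jn → joins-≢ jn refl))) (*-zeroʳ ⟦ φ f ≟ᶠ c ⟧)))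

    rows-pairs : ∀ c → ∑ (row c) ≡ ∑ (λ f → ⟦ φ f ≟ᶠ c ⟧ * pairs pt f)
    rows-pairs c = trans (∑-cong (row-edges c))
      (trans (∑-swap (λ i f → ⟦ φ f ≟ᶠ c ⟧ * ∑ (λ j → ⟦ joins? f (pt i) (pt j) ⟧)))
        (∑-cong (λ f → ∑-*ˡ ⟦ φ f ≟ᶠ c ⟧ (λ i → ∑ (λ j → ⟦ joins? f (pt i) (pt j) ⟧)))))

    -- A colour class meets each point at most once, and its number of ordered pairs is even, so 2m
    -- + 1 is out of reach.
    class-small : ∀ m → t ≡ suc (m + m) → ∀ c → ∑ (λ f → ⟦ φ f ≟ᶠ c ⟧ * pairs pt f) ≤ m + m
    class-small m eq c with rows-even c
    ... | e , even = ≤-trans (≤-reflexive (trans (sym (rows-pairs c)) even)) (+-mono-≤ e≤m e≤m)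
      where
      2e≤t : e + e ≤ suc (m + m)
      2e≤t = begin
        e + e ≡⟨ sym even ⟩
        ∑ (row c) ≤⟨ ∑-mono (row≤1 c) ⟩
        ∑ {t} (λ _ → 1) ≡⟨ trans (∑-const t 1) (*-identityʳ t) ⟩
        t ≡⟨ eq ⟩
        suc (m + m) ∎
        where open ≤-Reasoning
      e≤m : e ≤ m
      e≤m with e ≤? m
      ... | yes le = le
      ... | no ¬le = ⊥-elim (<⇒≱ (≤-trans (≤-reflexive (cong suc (sym (+-suc m m)))) (+-mono-≤ (≰⇒> ¬le) (≰⇒> ¬le))) 2e≤t)

    odd-size : ∀ c i₀ → Miss φ c (pt i₀) → (∀ i → i ≢ i₀ → Inside φ pt c (pt i)) → ∃[ m ] t ≡ suc (m + m)
    odd-size c i₀ m ins with rows-even c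
    ... | e , eq = e , (begin
      t ≡⟨ sym (trans (∑-const t 1) (*-identityʳ t)) ⟩
      ∑ {t} (λ _ → 1) ≡⟨ ∑-cong (λ i → sym (pointwise i)) ⟩
      ∑ (λ i → ⟦ i ≟ᶠ i₀ ⟧ + row c i) ≡⟨ ∑-distrib-+ (λ i → ⟦ i ≟ᶠ i₀ ⟧) (row c) ⟩
      ∑ (λ i → ⟦ i ≟ᶠ i₀ ⟧) + ∑ (row c) ≡⟨ cong₂ _+_ (∑-point₁ i₀) eq ⟩
      suc (e + e) ∎)
      where
      open ≡-Reasoning
      pointwise : ∀ i → ⟦ i ≟ᶠ i₀ ⟧ + row c i ≡ 1
      pointwise i with i ≟ᶠ i₀
      ... | no i≢ = ≤1∧≥1 (row≤1 c i) (inside-row c i (ins i i≢))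
      ... | yes refl with row c i in eq'
      ...   | zero = refl
      ...   | suc _ with row-inside c i (subst (1 ≤_) (sym eq') (s≤s z≤n))
      ...     | f , j , jn , e' = ⊥-elim (m f (joins-incˡ jn) e')

    class-inside : ∀ c → (∀ i j → ¬ Inside φ pt c (pt i) → ¬ Inside φ pt c (pt j) → i ≡ j) →
      t ≤ 1 + ∑ (λ f → ⟦ φ f ≟ᶠ c ⟧ * pairs pt f)
    class-inside c one = ≤-trans (∑-deficient (λ i j p q → one i j (not-inside i p) (not-inside j q)))
      (≤-reflexive (cong suc (rows-pairs c)))
      where
      not-inside : ∀ i → row c i ≡ 0 → ¬ Inside φ pt c (pt i)
      not-inside i eq ins = case subst (1 ≤_) eq (inside-row c i ins) of λ ()

-- A graph and the graph without its first edge

module WithEdge (nv n : ℕ) (s t : Fin (suc n) → Fin nv) (s≢t : ∀ e → s e ≢ t e) where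

  G H : Multigraph
  G = record { nV = nv ; nE = suc n ; src = s ; tgt = t ; loopless = s≢t }
  H = record { nV = nv ; nE = n ; src = s ∘ suc ; tgt = t ∘ suc ; loopless = s≢t ∘ suc }

  x y : Fin nv
  x = s zero
  y = t zero

  module IG = Incidence G
  module IH = Incidence H

  deg-split : ∀ v → deg G v ≡ ⟦ IG.inc? zero v ⟧ + deg H v
  deg-split v = trans (IG.deg-∑ v) (trans (∑-suc (λ f → ⟦ IG.inc? f v ⟧)) (cong (⟦ IG.inc? zero v ⟧ +_)
    (trans (∑-cong (λ f → ⟦⟧-cong (IG.inc? (suc f) v) (IH.inc? f v) id id)) (sym (IH.deg-∑ v)))))

  mult-split : ∀ u v → mult G u v ≡ ⟦ IG.joins? zero u v ⟧ + mult H u v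
  mult-split u v = trans (IG.mult-∑ u v) (trans (∑-suc (λ f → ⟦ IG.joins? f u v ⟧)) (cong (⟦ IG.joins? zero u v ⟧ +_)
    (trans (∑-cong (λ f → ⟦⟧-cong (IG.joins? (suc f) u v) (IH.joins? f u v) id id)) (sym (IH.mult-∑ u v)))))

  module _ {k : ℕ} (φ : Edge H → Fin k) (K : Fin k → Set) where

    -- The uncoloured edge always counts: it supplies the excess that makes the selected edges
    -- overfull.
    Selected : Edge G → Set
    Selected zero = ⊤
    Selected (suc f) = K (φ f)

    Linked-by : Vert G → Vert G → Set
    Linked-by u v = ∃[ f ] (Joins G f u v × Selected f)

module Dense-set (nv n : ℕ) (s t : Fin (suc n) → Fin nv) (s≢t : ∀ e → s e ≢ t e) (g h s' Δ' : ℕ)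
  (girth : GirthAtLeast (WithEdge.G nv n s t s≢t) g)
  (deg≤ : ∀ v → deg (WithEdge.G nv n s t s≢t) v ≤ Δ')
  (mult≤ : ∀ u v → mult (WithEdge.G nv n s t s≢t) u v ≤ suc s' * h)
  (1≤s' : 1 ≤ s') (2≤h : 2 ≤ h) (5≤g : 5 ≤ g) (2h≤g : h + h ≤ g)
  (φ : Fin n → Fin (Δ' + s')) (proper : ProperEdgeColouring (WithEdge.H nv n s t s≢t) (Δ' + s') φ)
  where

  open WithEdge nv n s t s≢t

  open Colourings H (Δ' + s')
  open ColourCount H (Δ' + s') φ proper

  -- The degree in G is at most `Δ'`, so at least `s'` colours are missed, and the ends of the
  -- deleted edge miss one more.
  misses-large : ∀ v → s' + ⟦ IG.inc? zero v ⟧ ≤ misses v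
  misses-large v = +-cancelˡ-≤ (deg H v) _ _ (begin
    deg H v + (s' + ⟦ IG.inc? zero v ⟧) ≡⟨ regroup (deg H v) s' ⟦ IG.inc? zero v ⟧ ⟩
    (⟦ IG.inc? zero v ⟧ + deg H v) + s' ≤⟨ +-monoˡ-≤ s' (≤-trans (≤-reflexive (sym (deg-split v))) (deg≤ v)) ⟩
    Δ' + s' ≡⟨ degree-count v ⟩
    deg H v + misses v ∎)
    where
    open ≤-Reasoning
    regroup : ∀ a b c → a + (b + c) ≡ (c + a) + b
    regroup = solve-∀

  module _ {K : Colour → Set} (K? : ∀ c → Dec (K c)) where

    selected? : ∀ f → Dec (Selected φ K f)
    selected? zero = yes tt
    selected? (suc f) = K? (φ f)

    size : ℕ
    size = ∑ (λ c → ⟦ K? c ⟧)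

    joins-suc : ∀ f u v → ⟦ IG.joins? (suc f) u v ⟧ ≡ ⟦ IH.joins? f u v ⟧
    joins-suc f u v = ⟦⟧-cong (IG.joins? (suc f) u v) (IH.joins? f u v) id id

    module OnPoints {m : ℕ} (pt : Fin (suc (m + m)) → V) (inj : Injective _≡_ _≡_ pt)
      (missed : ∀ i c → Miss φ c (pt i) → K c)
      (one : ∀ c → K c → ∀ i j → ¬ Inside φ pt c (pt i) → ¬ Inside φ pt c (pt j) → i ≡ j)
      (ix iy : Fin (suc (m + m))) (ix≡ : pt ix ≡ x) (iy≡ : pt iy ≡ y) (g≤ : g ≤ suc (m + m))
      where

      open Points pt inj

      w : Fin (suc (m + m)) → Fin (suc (m + m)) → ℕ
      w i j = ∑ (λ f → ⟦ selected? f ⟧ * ⟦ IG.joins? f (pt i) (pt j) ⟧)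

      w-sym : ∀ i j → w i j ≡ w j i
      w-sym i j = ∑-cong (λ f → cong (⟦ selected? f ⟧ *_) (IG.⟦joins⟧-sym f (pt i) (pt j)))

      w-irrefl : ∀ i → w i i ≡ 0
      w-irrefl i = ∑-zero (λ f → trans (cong (⟦ selected? f ⟧ *_) (⟦⟧-no (IG.joins? f (pt i) (pt i))
        (λ jn → Colourings.joins-≢ G 0 {f} jn refl))) (*-zeroʳ ⟦ selected? f ⟧))

      w≤ : ∀ i j → w i j ≤ suc s' * h
      w≤ i j = ≤-trans (∑-mono (λ f → ≤-trans (*-monoˡ-≤ ⟦ IG.joins? f (pt i) (pt j) ⟧ (⟦⟧≤1 (selected? f)))
        (≤-reflexive (+-identityʳ _)))) (≤-trans (≤-reflexive (sym (IG.mult-∑ (pt i) (pt j)))) (mult≤ (pt i) (pt j)))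

      row-sum : ∀ i → ∑ (w i) ≡ ∑ (λ f → ⟦ selected? f ⟧ * ∑ (λ j → ⟦ IG.joins? f (pt i) (pt j) ⟧))
      row-sum i = trans (∑-swap (λ j f → ⟦ selected? f ⟧ * ⟦ IG.joins? f (pt i) (pt j) ⟧))
        (∑-cong (λ f → ∑-*ˡ ⟦ selected? f ⟧ (λ j → ⟦ IG.joins? f (pt i) (pt j) ⟧)))

      -- All colours missed at a point are selected, so at least `s'` selected colours are absent
      -- there; at the ends of the uncoloured edge the extra missed colour pays for that edge.
      row-bound : ∀ i → ∑ (w i) + s' ≤ size
      row-bound i = begin
        ∑ (w i) + s' ≡⟨ cong (_+ s') (row-sum i) ⟩
        ∑ (λ f → ⟦ selected? f ⟧ * ∑ (λ j → ⟦ IG.joins? f v (pt j) ⟧)) + s'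
          ≤⟨ +-monoˡ-≤ s' (∑-mono (λ f → *-monoʳ-≤ ⟦ selected? f ⟧ (IG.row≤inc pt inj f v))) ⟩
        ∑ (λ f → ⟦ selected? f ⟧ * ⟦ IG.inc? f v ⟧) + s' ≡⟨ cong (_+ s') (∑-suc (λ f → ⟦ selected? f ⟧ * ⟦ IG.inc? f v ⟧)) ⟩
        (1 * ⟦ IG.inc? zero v ⟧ + ∑ (λ f → ⟦ K? (φ f) ⟧ * ⟦ IG.inc? (suc f) v ⟧)) + s'
          ≡⟨ cong (λ k → (1 * ⟦ IG.inc? zero v ⟧ + k) + s') (∑-cong (λ f → cong (⟦ K? (φ f) ⟧ *_) (⟦⟧-cong (IG.inc? (suc f) v) (IH.inc? f v) id id))) ⟩
        (1 * ⟦ IG.inc? zero v ⟧ + A) + s' ≡⟨ regroup ⟦ IG.inc? zero v ⟧ A s' ⟩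
        A + (s' + ⟦ IG.inc? zero v ⟧) ≤⟨ +-monoʳ-≤ A (misses-large v) ⟩
        A + misses v ≡⟨ sym (selected-count K? v (missed i)) ⟩
        size ∎
        where
        open ≤-Reasoning
        v = pt i
        A = ∑ (λ f → ⟦ K? (φ f) ⟧ * ⟦ IH.inc? f v ⟧)
        regroup : ∀ a b c → (1 * a + b) + c ≡ b + (c + a)
        regroup = solve-∀

      D : ℕ
      D = size ∸ s'

      D+s' : D + s' ≡ size
      D+s' = m∸n+n≡m (≤-trans (m≤n+m s' _) (row-bound zero))

      class-pairs : ∀ c → ⟦ K? c ⟧ * (m + m) ≤
        ⟦ K? c ⟧ * ∑ (λ f → ⟦ φ f ≟ᶠ c ⟧ * IH.pairs pt f)
      class-pairs c with K? c
      ... | no _ = z≤n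
      ... | yes κ = +-monoˡ-≤ 0 (≤-pred (class-inside c (one c κ)))

      total-pairs : ∑ (λ i → ∑ (w i)) ≡ ∑ (λ f → ⟦ selected? f ⟧ * IG.pairs pt f)
      total-pairs = trans (∑-cong row-sum) (trans (∑-swap (λ i f → ⟦ selected? f ⟧ * ∑ (λ j → ⟦ IG.joins? f (pt i) (pt j) ⟧)))
        (∑-cong (λ f → ∑-*ˡ ⟦ selected? f ⟧ (λ i → ∑ (λ j → ⟦ IG.joins? f (pt i) (pt j) ⟧)))))

      -- Each selected colour matches all points but one, which makes 2m ordered pairs; the
      -- uncoloured edge adds two.
      total : (m + m) * size + 2 ≤ ∑ (λ i → ∑ (w i))
      total = begin
        (m + m) * size + 2
          ≡⟨ trans (+-comm _ 2) (cong (2 +_) (trans (*-comm (m + m) size) (sym (∑-*ʳ (λ c → ⟦ K? c ⟧) (m + m))))) ⟩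
        2 + ∑ (λ c → ⟦ K? c ⟧ * (m + m))
          ≤⟨ +-mono-≤ (IG.pairs≥2 pt zero ix iy ix≡ iy≡) (∑-mono class-pairs) ⟩
        IG.pairs pt zero + ∑ (λ c → ⟦ K? c ⟧ * ∑ (λ f → ⟦ φ f ≟ᶠ c ⟧ * IH.pairs pt f))
          ≡⟨ cong₂ _+_ (sym (+-identityʳ _)) (sym (∑-by-class φ (λ c → ⟦ K? c ⟧) (IH.pairs pt))) ⟩
        1 * IG.pairs pt zero + ∑ (λ f → ⟦ K? (φ f) ⟧ * IH.pairs pt f)
          ≡⟨ cong (1 * IG.pairs pt zero +_) (∑-cong (λ f → cong (⟦ K? (φ f) ⟧ *_) (∑-cong (λ i → ∑-cong (λ j → sym (joins-suc f (pt i) (pt j))))))) ⟩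
        1 * IG.pairs pt zero + ∑ (λ f → ⟦ selected? (suc f) ⟧ * IG.pairs pt (suc f))
          ≡⟨ sym (∑-suc (λ f → ⟦ selected? f ⟧ * IG.pairs pt f)) ⟩
        ∑ (λ f → ⟦ selected? f ⟧ * IG.pairs pt f)
          ≡⟨ sym total-pairs ⟩
        ∑ (λ i → ∑ (w i)) ∎
        where open ≤-Reasoning

      w-adjacent : ∀ {i j} → 1 ≤ w i j → Adjacent G (pt i) (pt j)
      w-adjacent {i} {j} le with ∑≥1 (λ f → ⟦ selected? f ⟧ * ⟦ IG.joins? f (pt i) (pt j) ⟧) le
      ... | f , le' = f , proj₂ (product≥1 (selected? f) (IG.joins? f (pt i) (pt j)) le')

      no-cycle : ∀ u (pre : List (Fin (suc (m + m)))) → Unique (u ∷ pre) →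
        Linked (λ a b → 1 ≤ w a b) (u ∷ pre ++ [ u ]) → 2 ≤ length pre → suc (length pre) < g → ⊥
      no-cycle u pre uq l 2≤ lt = girth (suc (length (map pt pre))) (s≤s (subst (2 ≤_) (sym (length-map pt pre)) 2≤))
        (subst (λ k → suc k < g) (sym (length-map pt pre)) lt)
        (cycle-of-list G (pt u) (map pt pre) (unique-map pt (λ _ _ → inj) uq)
          (subst (λ L → Linked (Adjacent G) (pt u ∷ L)) (map-++ pt pre [ u ])
            (Linked.map⁺ (Linked.map w-adjacent l))))

      no-three : ∀ i a b c → a ≢ b → a ≢ c → b ≢ c → Linked-by φ K (pt i) (pt a) → Linked-by φ K (pt i) (pt b) →
                 Linked-by φ K (pt i) (pt c) → ⊥
      no-three i a b c a≢b a≢c b≢c la lb lc = Dense.no-three-neighbours {m} s' h D g w w-sym w-irrefl w≤ 1≤s' 2≤h 5≤g 2h≤g g≤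
        (λ i → m+n≤o⇒m≤o∸n (∑ (w i)) (row-bound i))
        (subst (λ k → (m + m) * k + 2 ≤ ∑ (λ i → ∑ (w i))) (sym D+s') total) no-cycle
        i a b c a≢b a≢c b≢c (heavy la) (heavy lb) (heavy lc)
        where
        heavy : ∀ {j} → Linked-by φ K (pt i) (pt j) → 1 ≤ w i j
        heavy {j} (f , jn , sel) = ≤-trans (≤-reflexive (sym (cong₂ _*_ (⟦⟧-yes (selected? f) sel)
          (⟦⟧-yes (IG.joins? f (pt i) (pt j)) jn)))) (term≤∑ (λ f → ⟦ selected? f ⟧ * ⟦ IG.joins? f (pt i) (pt j) ⟧) f)

    opaque
      -- The number of points is odd because a colour missed at `x` is selected and matches all the
      -- other points among themselves.
      conclude : ∀ {t} (pt : Fin t → V) (inj : Injective _≡_ _≡_ pt) → (∀ i c → Miss φ c (pt i) → K c) →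
        (∀ c → K c → ∀ i j → ¬ Inside φ pt c (pt i) → ¬ Inside φ pt c (pt j) → i ≡ j) →
        ∀ ix iy → pt ix ≡ x → pt iy ≡ y → g ≤ t → ∀ c₀ → Miss φ c₀ x →
        (∀ i a b c → a ≢ b → a ≢ c → b ≢ c → Linked-by φ K (pt i) (pt a) → Linked-by φ K (pt i) (pt b) →
           Linked-by φ K (pt i) (pt c) → ⊥) ×
        ∃[ m ] (t ≡ suc (m + m) ×
          (m + m) * size + 2 ≤ ∑ (IG.pairs pt))
      conclude {t} pt inj missed one ix iy ix≡ iy≡ g≤t c₀ m₀ with Points.odd-size pt inj c₀ ix m-ix others
        where
        m-ix : Miss φ c₀ (pt ix)
        m-ix = subst (Miss φ c₀) (sym ix≡) m₀
        others : ∀ i → i ≢ ix → Inside φ pt c₀ (pt i)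
        others i i≢ with 1 ≤? Points.row pt inj c₀ i
        ... | yes le = Points.row-inside pt inj c₀ i le
        ... | no ¬le = ⊥-elim (i≢ (one c₀ (missed ix c₀ m-ix) i ix (λ ins → ¬le (Points.inside-row pt inj c₀ i ins))
                (λ (f , j , jn , e) → m-ix f (joins-incˡ jn) e)))
      ... | m , refl = OnPoints.no-three {m} pt inj missed one ix iy ix≡ iy≡ g≤t , m , refl ,
            ≤-trans (OnPoints.total {m} pt inj missed one ix iy ix≡ iy≡ g≤t) (≤-trans
              (≤-reflexive (OnPoints.total-pairs {m} pt inj missed one ix iy ix≡ iy≡ g≤t))
              (∑-mono (λ f → ≤-trans (*-monoˡ-≤ (IG.pairs pt f) (⟦⟧≤1 (selected? f))) (≤-reflexive (+-identityʳ _)))))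

-- The extremal tree

two-of : ∀ {n} {P : Fin n → Set} (P? : ∀ i → Dec (P i)) → 2 ≤ ∑ (λ i → ⟦ P? i ⟧) →
         ∃[ i ] ∃[ j ] (i ≢ j × P i × P j)
two-of P? le with ∑≥1 (λ i → ⟦ P? i ⟧) (≤-trans (n≤1+n 1) le)
... | i , le' with any? (λ j → ¬? (i ≟ᶠ j) ×-dec P? j)
...   | yes (j , i≢j , p) = i , j , i≢j , ⟦⟧≥1 (P? i) le' , p
...   | no none = ⊥-elim (<⇒≱ le (∑≤1 (λ i → ⟦⟧≤1 (P? i)) (λ a b p q →
          trans (sym (only (⟦⟧≥1 (P? a) p))) (only (⟦⟧≥1 (P? b) q)))))
  where
  only : ∀ {j} → _ → i ≡ j
  only {j} p with i ≟ᶠ j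
  ... | yes e = e
  ... | no i≢j = ⊥-elim (none (j , i≢j , p))

linked-close : ∀ {A : Set} {R : A → A → Set} {us z w} → Linked R us → EndsIn z us → R z w → Linked R (us ++ [ w ])
linked-close [-] end r = r ∷ [-]
linked-close (s ∷ l) (skip e) r = s ∷ linked-close l e r

module Extremal (nv n : ℕ) (s t : Fin (suc n) → Fin nv) (s≢t : ∀ e → s e ≢ t e) (g h s' Δ' : ℕ)
  (girth : GirthAtLeast (WithEdge.G nv n s t s≢t) g)
  (deg≤ : ∀ v → deg (WithEdge.G nv n s t s≢t) v ≤ Δ')
  (mult≤ : ∀ u v → mult (WithEdge.G nv n s t s≢t) u v ≤ suc s' * h)
  (1≤s' : 1 ≤ s') (2≤h : 2 ≤ h) (5≤g : 5 ≤ g) (2h≤g : h + h ≤ g)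
  (uncolourable : ¬ Colourable (WithEdge.G nv n s t s≢t) (Δ' + s'))
  where

  open WithEdge nv n s t s≢t

  k : ℕ
  k = Δ' + s'

  open Colourings H k
  open TashkinovTrees H k x y (s≢t zero)

  misses-large : ∀ φ → Proper φ → ∀ v → s' + ⟦ IG.inc? zero v ⟧ ≤ ∑ (λ c → ⟦ miss? φ c v ⟧)
  misses-large = Dense-set.misses-large nv n s t s≢t g h s' Δ' girth deg≤ mult≤ 1≤s' 2≤h 5≤g 2h≤g

  opaque
    some : ∀ φ → Proper φ → ∀ v → ∃[ c ] Miss φ c v
    some φ pr v with ∑≥1 (λ c → ⟦ miss? φ c v ⟧) (≤-trans 1≤s' (≤-trans (m≤m+n s' _) (misses-large φ pr v)))
    ... | c , le = c , ⟦⟧≥1 (miss? φ c v) le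

  opaque
    two : ∀ φ → Proper φ → ∀ v → v ∈ x ∷ y ∷ [] → ∃[ c ] ∃[ d ] (c ≢ d × Miss φ c v × Miss φ d v)
    two φ pr v v∈ = two-of (λ c → miss? φ c v) (≤-trans (+-mono-≤ 1≤s'
        (≤-reflexive (sym (⟦⟧-yes (IG.inc? zero v) (at-root v∈))))) (misses-large φ pr v))
      where
      at-root : v ∈ x ∷ y ∷ [] → Incident G zero v
      at-root (here refl) = inj₁ refl
      at-root (there (here refl)) = inj₂ refl

  -- Such a colour could be given to the deleted edge. This starts the induction in Tashkinov's
  -- theorem.
  no-common : ∀ φ → Proper φ → ∀ c → Miss φ c x → Miss φ c y → ⊥
  no-common φ pr c mx my = uncolourable (ψ , ψ-proper)
    where
    ψ : Edge G → Fin k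
    ψ zero = c
    ψ (suc f) = φ f
    clash : ∀ f v → Incident G zero v → Incident G (suc f) v → φ f ≢ c
    clash f v (inj₁ refl) i = mx f i
    clash f v (inj₂ refl) i = my f i
    ψ-proper : ProperEdgeColouring G k ψ
    ψ-proper zero zero v ne _ _ = ⊥-elim (ne refl)
    ψ-proper zero (suc f) v ne i i' e = clash f v i i' (sym e)
    ψ-proper (suc f) zero v ne i i' e = clash f v i' i e
    ψ-proper (suc f) (suc f') v ne i i' = pr f f' v (ne ∘ cong suc) i i'

  tashkinov : ∀ {φ} T → Proper φ → Tash φ T → Elementary φ T
  tashkinov = TashkinovTheorem.tashkinov H k x y (s≢t zero) some two no-common

  Covered : (E → Colour) → List V → Colour → V → Set
  Covered φ X c u = ∃[ f ] ∃[ z ] (Joins H f u z × z ∈ X × φ f ≡ c)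

  opaque
    -- `K` will be the set of colours missed by a closed tree, and later the set of all colours.
    dense : ∀ φ → Proper φ → ∀ {K : Colour → Set} (K? : ∀ c → Dec (K c)) X → Unique X →
      (∀ {v c} → v ∈ X → Miss φ c v → K c) →
      (∀ {c u v} → K c → u ∈ X → v ∈ X → ¬ Covered φ X c u → ¬ Covered φ X c v → u ≡ v) →
      x ∈ X → y ∈ X → g ≤ length X →
      (∀ {u a b c} → u ∈ X → a ∈ X → b ∈ X → c ∈ X → a ≢ b → a ≢ c → b ≢ c →
         Linked-by φ K u a → Linked-by φ K u b → Linked-by φ K u c → ⊥) ×
      ∃[ m ] (length X ≡ suc (m + m) × (m + m) * ∑ (λ c → ⟦ K? c ⟧) + 2 ≤ ∑ (IG.pairs (lookup X)))
    dense φ pr {K} K? X uq missed one x∈X y∈X g≤ =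
      (λ u∈ a∈ b∈ c∈ p q r la lb lc → proj₁ result (index u∈) (index a∈) (index b∈) (index c∈)
        (apart a∈ b∈ p) (apart a∈ c∈ q) (apart b∈ c∈ r) (reindex u∈ a∈ la) (reindex u∈ b∈ lb) (reindex u∈ c∈ lc)) ,
      proj₂ result
      where
      pt : Fin (length X) → V
      pt = lookup X
      pt∈ : ∀ i → pt i ∈ X
      pt∈ i = ∈-lookup {xs = X} i
      uncovered : ∀ {c i} → ¬ Inside φ pt c (pt i) → ¬ Covered φ X c (pt i)
      uncovered {i = i} ¬ins (f , z , jn , z∈ , e) = ¬ins (f , index z∈ , subst (Joins H f (pt i)) (lookup-index z∈) jn , e)
      result : (∀ i a b c → a ≢ b → a ≢ c → b ≢ c → Linked-by φ K (pt i) (pt a) → Linked-by φ K (pt i) (pt b) →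
          Linked-by φ K (pt i) (pt c) → ⊥) ×
        ∃[ m ] (length X ≡ suc (m + m) × (m + m) * ∑ (λ c → ⟦ K? c ⟧) + 2 ≤ ∑ (IG.pairs pt))
      result = Dense-set.conclude nv n s t s≢t g h s' Δ' girth deg≤ mult≤ 1≤s' 2≤h 5≤g 2h≤g φ pr K? pt (unique-lookup uq)
        (λ i c → missed (pt∈ i)) (λ c κ i j ¬i ¬j → unique-lookup uq (one κ (pt∈ i) (pt∈ j) (uncovered ¬i) (uncovered ¬j)))
        (index x∈X) (index y∈X) (sym (lookup-index x∈X)) (sym (lookup-index y∈X)) g≤
        (proj₁ (some φ pr x)) (proj₂ (some φ pr x))
      apart : ∀ {a b} (a∈ : a ∈ X) (b∈ : b ∈ X) → a ≢ b → index a∈ ≢ index b∈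
      apart a∈ b∈ ne e = ne (trans (lookup-index a∈) (trans (cong pt e) (sym (lookup-index b∈))))
      reindex : ∀ {u a} (u∈ : u ∈ X) (a∈ : a ∈ X) → Linked-by φ K u a → Linked-by φ K (pt (index u∈)) (pt (index a∈))
      reindex u∈ a∈ = subst₂ (Linked-by φ K) (lookup-index u∈) (lookup-index a∈)

  Bigger : ℕ → Set
  Bigger l = ∃[ φ ] ∃[ T ] (Proper φ × Tash φ T × l < length T)

  missedBy? : ∀ φ T c → Dec (MissedBy φ T c)
  missedBy? φ T c = any? (λ v → (v ∈? verts T) ×-dec miss? φ c v)

  ClosedTree : (E → Colour) → List Item → Set
  ClosedTree φ T = ∀ {f u v} → Joins H f u v → u ∈ verts T → MissedBy φ T (φ f) → v ∈ verts T

  closed-or-bigger : ∀ {φ} T → Proper φ → Tash φ T → ClosedTree φ T ⊎ Bigger (length T)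
  closed-or-bigger {φ} T pr tash with any? (λ f → any? (λ u → any? (λ v →
      IH.joins? f u v ×-dec (u ∈? verts T) ×-dec ¬? (v ∈? verts T) ×-dec missedBy? φ T (φ f))))
  ... | yes (f , u , v , jn , u∈ , v∉ , m) = inj₂ (φ , item u f v ∷ T , pr , add u∈ v∉ jn m tash , ≤-refl)
  ... | no none = inj₁ closed
    where
    closed : ClosedTree φ T
    closed {f} {u} {v} jn u∈ m with v ∈? verts T
    ... | yes v∈ = v∈
    ... | no v∉ = ⊥-elim (none (f , u , v , jn , u∈ , v∉ , m))

  verts-closed : ∀ {φ} {P : V → Set} T → Tash φ T → P x → P y →
    (∀ {i} → i ∈ T → P (parent i) → P (vertex i)) → ∀ {v} → v ∈ verts T → P v
  verts-closed [] tash px py step (here refl) = px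
  verts-closed [] tash px py step (there (here refl)) = py
  verts-closed (i ∷ T) (add p∈ _ _ _ tash) px py step (here refl) =
    step (here refl) (verts-closed T tash px py (step ∘ there) p∈)
  verts-closed (i ∷ T) (add _ _ _ _ tash) px py step (there v∈) = verts-closed T tash px py (step ∘ there) v∈

  -- The cycle C consists of the uncoloured edge xy and an (α,β)-chain, and T is the same chain
  -- as a tree, so that every colour other than α and β remains unused.
  record AlternatingCycle : Set where
    field
      φ : E → Colour
      proper : Proper φ
      α β : Colour
      mα : Miss φ α x
      mβ : Miss φ β y
      first : V
      rest : List V
    C : List V
    C = first ∷ rest
    field
      unique : Unique C
      long : 2 ≤ length rest
      girth≤ : g ≤ length C
      consecutive : ∀ i → Adjacent G (lookup C i) (lookup C (next i))
      x∈C : x ∈ C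
      y∈C : y ∈ C
      elementary : ∀ {u v c} → u ∈ C → v ∈ C → Miss φ c u → Miss φ c v → u ≡ v
      closed : ∀ {f u v z} → Joins H f u z → u ∈ C → v ∈ C → Miss φ (φ f) v → z ∈ C
      T : List Item
      tash : Tash φ T
      T⊆C : ∀ {v} → v ∈ verts T → v ∈ C
      C⊆T : ∀ {v} → v ∈ C → v ∈ verts T
      used : All (λ i → One-of α β (φ (edge i))) T

  -- The alternating cycle of a closed tree

  module OfClosedTree {φ : E → Colour} (T : List Item) (pr : Proper φ) (tash : Tash φ T)
                      (cl : ClosedTree φ T) where

    X = verts T

    el : Elementary φ T
    el = tashkinov T pr tash

    α β : Colour
    α = proj₁ (some φ pr x)
    β = proj₁ (some φ pr y)
    mα : Miss φ α x
    mα = proj₂ (some φ pr x)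
    mβ : Miss φ β y
    mβ = proj₂ (some φ pr y)

    α≢β : α ≢ β
    α≢β e = no-common φ pr α mα (subst (λ c → Miss φ c y) (sym e) mβ)

    ch : Chain φ α β x
    ch = chain pr α≢β mα

    open Chain ch using (last; body; start; unique; linked)

    C : List V
    C = last ∷ body

    -- Otherwise the exchange along the chain would make `x` miss β, which `y` still misses.
    last≡y : last ≡ y
    last≡y with last ≟ᶠ y
    ... | yes e = e
    ... | no last≢y = ⊥-elim (no-common swapped (swapped-proper pr) β
            (miss-insideˡ (ends-∈ start) mα) (miss-outside y∉ mβ))
      where
      open SwapOn φ α β (Chain.in? ch) (Chain.closed ch)
      y∉ : y ∉ C
      y∉ y∈ with Chain.ends ch y∈ (inj₂ mβ)
      ... | inj₁ e = s≢t zero (sym e)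
      ... | inj₂ e = last≢y (sym e)

    αβ-missed : ∀ {c} → One-of α β c → MissedBy φ T c
    αβ-missed (inj₁ refl) = x , x∈ T , mα
    αβ-missed (inj₂ refl) = y , y∈ T , mβ

    C⊆X : ∀ {v} → v ∈ C → v ∈ X
    C⊆X = linked-closed (λ f u v jn o u∈ → cl jn u∈ (αβ-missed o)) linked (here refl)
            (subst (_∈ X) (sym last≡y) (y∈ T))

    long : 2 ≤ length body
    long = at-least last body last≡y start linked
      where
      at-least : ∀ l b → l ≡ y → EndsIn x (l ∷ b) → Linked (Step φ α β) (l ∷ b) → 2 ≤ length b
      at-least _ [] l≡y end _ = ⊥-elim (s≢t zero l≡y)
      at-least _ (_ ∷ []) _ (skip end) ((f , jn , inj₁ e) ∷ _) = ⊥-elim (mα f (joins-incʳ jn) e)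
      at-least _ (_ ∷ []) refl (skip end) ((f , jn , inj₂ e) ∷ _) = ⊥-elim (mβ f (joins-incˡ jn) e)
      at-least _ (_ ∷ _ ∷ b) _ _ _ = s≤s (s≤s z≤n)

    cyclic : Linked (Adjacent G) (C ++ [ last ])
    cyclic = linked-close (Linked.map (λ (f , jn , _) → suc f , jn) linked) start (zero , inj₁ (refl , sym last≡y))

    girth≤C : g ≤ length C
    girth≤C with g ≤? length C
    ... | yes le = le
    ... | no ¬le = ⊥-elim (girth (length C) (s≤s long) (≰⇒> ¬le) (cycle-of-list G last body unique cyclic))

    C≤X : length C ≤ length X
    C≤X = unique-⊆-length C X unique C⊆X

    Link : V → V → Set
    Link = Linked-by φ (MissedBy φ T)

    no-three : ∀ {u a b c} → u ∈ X → a ∈ X → b ∈ X → c ∈ X → a ≢ b → a ≢ c → b ≢ c → Link u a → Link u b → Link u c → ⊥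
    no-three = proj₁ (dense φ pr (missedBy? φ T) X (verts-unique tash) (λ v∈ m → _ , v∈ , m)
        (λ m u∈ v∈ ¬u ¬v → el u∈ v∈ (misses-it m u∈ ¬u) (misses-it m v∈ ¬v)) (x∈ T) (y∈ T) (≤-trans girth≤C C≤X))
      where
      misses-it : ∀ {c u} → MissedBy φ T c → u ∈ X → ¬ Covered φ X c u → Miss φ c u
      misses-it m u∈ ¬u f inc refl = ¬u (f , _ , proj₂ (other inc) , cl (proj₂ (other inc)) u∈ m , refl)

    R : V → V → Set
    R u v = u ∈ X × v ∈ X × Link u v

    -- A vertex of `C` already has two neighbours along the cycle by selected edges, so a selected
    -- edge to any other vertex would give a third.
    C-closed : ∀ {f u z} → Joins H f u z → u ∈ C → MissedBy φ T (φ f) → z ∈ C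
    C-closed {f} {u} {z} jn u∈ m =
      let j , e , _ = neighbours {index u∈} {z} (C⊆X (∈-lookup {xs = C} (index u∈)) , cl jn (C⊆X u∈) m ,
            suc f , subst (λ v → Joins H f v z) (lookup-index u∈) jn , m)
      in subst (_∈ C) (sym e) (∈-lookup {xs = C} j)
      where
      linked-cycle : Linked Link (C ++ [ last ])
      linked-cycle = linked-close (Linked.map (λ (f , jn , o) → suc f , jn , αβ-missed o) linked) start
        (zero , inj₁ (refl , sym last≡y) , tt)
      R-sym : ∀ {u v} → R u v → R v u
      R-sym (u∈ , v∈ , f , jn , sel) = v∈ , u∈ , f , Colourings.joins-sym G 0 {f} jn , sel
      R-next : ∀ i → R (lookup C i) (lookup C (next i))
      R-next i = C⊆X (∈-lookup {xs = C} i) , C⊆X (∈-lookup {xs = C} (next i)) , linked-next last body linked-cycle i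
      neighbours : ∀ {i z} → R (lookup C i) z → ∃[ j ] (z ≡ lookup C j × (j ≡ next i ⊎ i ≡ next j))
      neighbours = cycle-neighbours (lookup C) (unique-lookup unique) long R R-sym R-next
        (λ { p q r (u∈ , a∈ , la) (_ , b∈ , lb) (_ , c∈ , lc) → no-three u∈ a∈ b∈ c∈ p q r la lb lc })

    y∈C : y ∈ C
    y∈C = here (sym last≡y)

    X⊆C : ∀ {v} → v ∈ X → v ∈ C
    X⊆C = verts-closed T tash (ends-∈ start) y∈C (λ i∈ p∈ →
      C-closed (proj₂ (proj₂ (item-joins tash i∈))) p∈ (item-colour tash i∈))

    record Traced : Set where
      field
        tree   : List Item
        tashᵗ  : Tash φ tree
        usedᵗ  : All (λ i → One-of α β (φ (edge i))) tree
        covers : ∀ {v} → v ∈ C → v ∈ verts tree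

    -- The chain is attached to the root from `y` onwards. It stops at `x`, which belongs to the
    -- root already.
    trace : ∀ S {p ts} → Tash φ S → All (λ i → One-of α β (φ (edge i))) S → p ∈ verts S →
      Linked (Step φ α β) (p ∷ ts) → Unique (p ∷ ts) → EndsIn x (p ∷ ts) →
      (∀ {v} → v ∈ ts → v ≢ x → v ∉ verts S) →
      ∃[ S' ] (Tash φ S' × All (λ i → One-of α β (φ (edge i))) S' × (∀ {v} → v ∈ p ∷ ts ⊎ v ∈ verts S → v ∈ verts S'))
    trace S tS us p∈ [-] _ _ _ = S , tS , us , λ { (inj₁ (here refl)) → p∈ ; (inj₂ v∈) → v∈ }
    trace S {p} {q ∷ ts} tS us p∈ ((f , jn , o) ∷ l) (p∉ ∷ uq) (skip e) fresh with q ≟ᶠ x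
    ... | no q≢x with trace (item p f q ∷ S) (add p∈ (fresh (here refl) q≢x) jn (missed o) tS) (o ∷ us) (here refl) l uq e
            (λ { v∈ v≢x (here refl) → case uq of λ { (q∉ ∷ _) → All.lookup q∉ v∈ refl }
               ; v∈ v≢x (there v∈S) → fresh (there v∈) v≢x v∈S })
      where
      missed : ∀ {c} → One-of α β c → MissedBy φ S c
      missed (inj₁ refl) = x , x∈ S , mα
      missed (inj₂ refl) = y , y∈ S , mβ
    ...   | S' , tS' , us' , cov = S' , tS' , us' , λ where
              (inj₁ (here refl)) → cov (inj₂ (there p∈))
              (inj₁ (there v∈)) → cov (inj₁ v∈)
              (inj₂ v∈) → cov (inj₂ (there v∈))
    trace S {p} {q ∷ ts} tS us p∈ ((f , jn , o) ∷ l) (p∉ ∷ uq) (skip e) fresh | yes refl with ts | e | uq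
    ... | [] | _ | _ = S , tS , us , λ where
              (inj₁ (here refl)) → p∈
              (inj₁ (there (here refl))) → x∈ S
              (inj₂ v∈) → v∈
    ... | _ ∷ _ | skip e' | q∉ ∷ _ = ⊥-elim (All.lookup q∉ (ends-∈ e') refl)

    opaque
      traced : Traced
      traced with trace [] [] [] (subst (_∈ verts []) (sym last≡y) (there (here refl))) linked unique start
          (λ { v∈ v≢x (here refl) → v≢x refl
             ; v∈ v≢x (there (here refl)) → case unique of λ { (l∉ ∷ _) → All.lookup l∉ v∈ last≡y } })
      ... | S , tS , us , cov = record { tree = S ; tashᵗ = tS ; usedᵗ = us ; covers = cov ∘ inj₁ }

    open Traced traced

    cycle : AlternatingCycle
    cycle = record
      { φ = φ ; proper = pr ; α = α ; β = β ; mα = mα ; mβ = mβ ; first = last ; rest = body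
      ; unique = unique ; long = long ; girth≤ = girth≤C
      ; consecutive = linked-next last body cyclic
      ; x∈C = ends-∈ start ; y∈C = y∈C
      ; elementary = λ u∈ v∈ → el (C⊆X u∈) (C⊆X v∈)
      ; closed = λ jn u∈ v∈ m → C-closed jn u∈ (_ , C⊆X v∈ , m)
      ; T = tree ; tash = tashᵗ
      ; T⊆C = verts-closed tree tashᵗ (ends-∈ start) y∈C (λ i∈ p∈ →
          C-closed (proj₂ (proj₂ (item-joins tashᵗ i∈))) p∈ (αβ-missed (All.lookup usedᵗ i∈)))
      ; C⊆T = covers ; used = usedᵗ }

    -- Both trees span the cycle, so a tree bigger than the rebuilt one is also bigger than `T`.
    no-shorter : length T ≤ length tree
    no-shorter = +-cancelʳ-≤ 2 _ _ (subst₂ _≤_ (verts-length T) (verts-length tree)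
      (unique-⊆-length (verts T) (verts tree) (verts-unique tash) (covers ∘ X⊆C)))

  -- Kempe changes around the alternating cycle

  module OnCycle (cyc : AlternatingCycle) where
    open AlternatingCycle cyc

    -- The ends of the uncoloured edge miss a second colour; on the remaining vertices α and β are
    -- not missed, since `x` and `y` miss them.
    free : ∀ {u} → u ∈ C → ∃[ γ ] (Miss φ γ u × γ ≢ α × γ ≢ β)
    free {u} u∈ with u ≟ᶠ x | u ≟ᶠ y
    ... | yes refl | _ = let γ , m , γ≢α = TashkinovTheorem.second H k x y (s≢t zero) some two no-common φ proper x (here refl) α in
            γ , m , γ≢α , λ { refl → no-common φ proper β m mβ }
    ... | no _ | yes refl = let γ , m , γ≢β = TashkinovTheorem.second H k x y (s≢t zero) some two no-common φ proper y (there (here refl)) β in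
            γ , m , (λ { refl → no-common φ proper α mα m }) , γ≢β
    ... | no u≢x | no u≢y = let γ , m = some φ proper u in
            γ , m , (λ { refl → u≢x (elementary u∈ x∈C m mα) }) , (λ { refl → u≢y (elementary u∈ y∈C m mβ) })

    unused-colour : ∀ {c} → c ≢ α → c ≢ β → Unused φ c T
    unused-colour c≢α c≢β = All.map (λ { (inj₁ e) q → c≢α (trans (sym q) e) ; (inj₂ e) q → c≢β (trans (sym q) e) }) used

    enlarge : ∀ {ψ δ f u v z} → Proper ψ → Tash ψ T → v ∈ C → Miss ψ δ v → u ∈ C → Joins H f u z → z ∉ C →
              ψ f ≡ δ → Bigger (length T)
    enlarge {ψ} {f = f} {u} {v} {z} pr tash' v∈ mv u∈ jn z∉ refl =
      ψ , item u f z ∷ T , pr , add (C⊆T u∈) (z∉ ∘ T⊆C) jn (v , C⊆T v∈ , mv) tash' , ≤-refl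

    Exit : Colour → V → Set
    Exit δ u = ∃[ f ] ∃[ z ] (Joins H f u z × z ∉ C × φ f ≡ δ)

    -- The aim is a colouring in which some vertex of the cycle misses δ while a δ-edge still leaves
    -- the cycle at another; that edge then extends the tree. The (γ,δ)-chain from `u₁` is used
    -- directly if it avoids `u₂`, and from its far end otherwise.
    module TwoExits (δ : Colour) (δ-seen : ∀ {v} → v ∈ C → ¬ Miss φ δ v) {u₁ u₂ : V} (u₁∈ : u₁ ∈ C) (u₂∈ : u₂ ∈ C)
      (u₁≢u₂ : u₁ ≢ u₂) (exit₁ : Exit δ u₁) (exit₂ : Exit δ u₂) (γ : Colour) (mγ : Miss φ γ u₁) (γ≢α : γ ≢ α) (γ≢β : γ ≢ β)
      where

      δ≢α : δ ≢ α
      δ≢α refl = δ-seen x∈C mα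

      δ≢β : δ ≢ β
      δ≢β refl = δ-seen y∈C mβ

      γ≢δ : γ ≢ δ
      γ≢δ refl = δ-seen u₁∈ mγ

      stays : ∀ {f u z} → Joins H f u z → u ∈ C → φ f ≡ γ → z ∈ C
      stays jn u∈ refl = closed jn u∈ u₁∈ mγ

      -- The chain returns to the cycle at w; after exchanging γ and a colour missed by w off the
      -- cycle, the part beyond w becomes a chain that starts at w and avoids u₁.
      module Return (w : V) (w∈ : w ∈ C) (w≢u₁ : w ≢ u₁) (ts : List V) (avoids : All (_∉ C) ts)
        (before : ∀ f t v → t ∈ ts → Joins H f t v → One-of γ δ (φ f) → v ∈ w ∷ ts)
        (enters : ∀ f v → Joins H f w v → φ f ≡ δ → v ∈ ts)
        (γ* : Colour) (mγ* : Miss φ γ* w) (γ*≢α : γ* ≢ α) (γ*≢β : γ* ≢ β) where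

        -- Both colours are missed on the cycle, so their edges do not leave it, and they may be
        -- exchanged everywhere outside.
        closed₁ : Closed φ γ γ* (λ v → ¬ v ∈ C)
        closed₁ f u v jn (inj₁ e) u∉ v∈ = u∉ (stays (joins-sym jn) v∈ e)
        closed₁ f u v jn (inj₂ e) u∉ v∈ = u∉ (closed (joins-sym jn) v∈ w∈ (subst (λ c → Miss φ c w) (sym e) mγ*))

        module S₁ = SwapOn φ γ γ* (λ v → ¬? (v ∈? C)) closed₁

        ψ = S₁.swapped

        on-C : ∀ {f u} → Incident H f u → u ∈ C → ψ f ≡ φ f
        on-C i u∈ = S₁.outside i (λ u∉ → u∉ u∈)

        -- Off the cycle the new γ*-edges are the old γ-edges, so the segment beyond `w` keeps its
        -- edges under the new name.
        off-C : ∀ {f u} → Incident H f u → u ∉ C → One-of γ* δ (ψ f) → One-of γ δ (φ f)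
        off-C {f} i u∉ o = by-colour (φ f ≟ᶠ γ) (φ f ≟ᶠ γ*)
          where
          γ≢γ* : γ ≢ γ*
          γ≢γ* e = w≢u₁ (elementary w∈ u₁∈ mγ* (subst (λ c → Miss φ c u₁) e mγ))
          by-colour : Dec (φ f ≡ γ) → Dec (φ f ≡ γ*) → One-of γ δ (φ f)
          by-colour (yes e) _ = inj₁ e
          by-colour (no _) (yes e) = ⊥-elim ([ (λ e' → γ≢γ* (trans (sym moved) e')) , (λ e' → γ≢δ (trans (sym moved) e')) ]′ o)
            where
            moved : ψ f ≡ γ
            moved = trans (S₁.inside i u∉) (trans (cong (transpose γ γ*) e) (transpose-ʳ γ γ*))
          by-colour (no p) (no q) = [ (λ e → ⊥-elim (q (trans (sym same) e))) , (λ e → inj₂ (trans (sym same) e)) ]′ o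
            where
            same : ψ f ≡ φ f
            same = agree S₁.similar f p q

        closed₂ : Closed ψ γ* δ (_∈ w ∷ ts)
        closed₂ f t v jn o (there t∈) = before f t v t∈ jn (off-C (joins-incˡ jn) (All.lookup avoids t∈) o)
        closed₂ f _ v jn (inj₁ e) (here refl) = ⊥-elim (mγ* f (joins-incˡ jn) (trans (sym (on-C (joins-incˡ jn) w∈)) e))
        closed₂ f _ v jn (inj₂ e) (here refl) = there (enters f v jn (trans (sym (on-C (joins-incˡ jn) w∈)) e))

        module S₂ = SwapOn ψ γ* δ (λ v → v ∈? (w ∷ ts)) closed₂

        T-same : All (λ i → ψ (edge i) ≡ φ (edge i)) T
        T-same = similar-unused S₁.similar (unused-colour γ≢α γ≢β) (unused-colour γ*≢α γ*≢β)

        u₁∉ : u₁ ∉ w ∷ ts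
        u₁∉ (here e) = w≢u₁ (sym e)
        u₁∉ (there u₁∈ts) = All.lookup avoids u₁∈ts u₁∈

        bigger : Bigger (length T)
        bigger = let f , z , jn , z∉ , e = exit₁ in
          enlarge (S₂.swapped-proper (S₁.swapped-proper proper))
            (tash-similar S₂.similar (unused-cong T-same (unused-colour γ*≢α γ*≢β)) (unused-cong T-same (unused-colour δ≢α δ≢β))
              (tash-similar S₁.similar (unused-colour γ≢α γ≢β) (unused-colour γ*≢α γ*≢β) tash))
            w∈ (S₂.miss-insideˡ (here refl) (S₁.miss-outside (λ w∉ → w∉ w∈) mγ*))
            u₁∈ jn z∉ (trans (S₂.outside (joins-incˡ jn) u₁∉) (trans (on-C (joins-incˡ jn) u₁∈) e))

      module Along (ch : Chain φ γ δ u₁) where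
        open Chain ch renaming (last to far; closed to ch-closed; unique to ch-unique)

        bigger-off : u₂ ∉ far ∷ body → Bigger (length T)
        bigger-off u₂∉ = let f , z , jn , z∉ , e = exit₂ in
            enlarge (swapped-proper proper) (tash-similar similar (unused-colour γ≢α γ≢β) (unused-colour δ≢α δ≢β) tash)
              u₁∈ (miss-insideˡ (ends-∈ start) mγ) u₂∈ jn z∉ (trans (outside (joins-incˡ jn) u₂∉) e)
          where open SwapOn φ γ δ in? ch-closed

        -- On the cycle δ is never missed, and γ only by `u₁`; a chain that ended at `u₁` would
        -- consist of that vertex alone and could not contain `u₂`.
        h∉C : u₂ ∈ far ∷ body → far ∉ C
        h∉C u₂∈ch h∈ with last-misses
        ... | inj₂ m = δ-seen h∈ m
        ... | inj₁ m with elementary h∈ u₁∈ m mγ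
        ...   | refl = single body start ch-unique u₂∈ch
          where
          single : ∀ b → EndsIn far (far ∷ b) → Unique (far ∷ b) → u₂ ∈ far ∷ b → ⊥
          single [] _ _ (here e) = u₁≢u₂ (sym e)
          single (v ∷ b) (skip e) (h∉ ∷ _) _ = All.lookup h∉ (ends-∈ e) refl

        -- The chain is followed backwards from its other end until it meets the cycle.
        module Back (a b : Colour) (to : ∀ {c} → One-of a b c → One-of γ δ c) (from : ∀ {c} → One-of γ δ c → One-of a b c)
          (a≢b : a ≢ b) (ma : Miss φ a far) (u₂∈ch : u₂ ∈ far ∷ body) where

          whole : ∀ {P : V → Set} → Closed φ a b P → P far → ∀ {v} → v ∈ far ∷ body → P v
          whole cl ph = linked-closed (λ f u v jn o → cl f u v jn (from o)) linked (here refl) ph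

          open Grow {Q = _∈ C} (_∈? C) φ proper a b a≢b far

          bigger-back : Stopped → Bigger (length T)
          bigger-back (h' , ts , c , d , F , inj₂ (h'∉ , mc)) = ⊥-elim (off (whole (front-closed F mc) (ends-∈ (Front.start F)) (ends-∈ start)) u₁∈)
            where
            off : ∀ {v} → v ∈ h' ∷ ts → v ∉ C
            off (here refl) = h'∉
            off (there v∈) = All.lookup (Front.avoids F) v∈
          bigger-back (w , [] , c , d , F , inj₁ w∈) with Front.start F
          ... | end = ⊥-elim (h∉C u₂∈ch w∈)
          bigger-back (w , t₁ ∷ ts , c , d , F , inj₁ w∈) = by-cases (w ≟ᶠ u₁)
            where
            open Front F renaming (linked to f-linked; avoids to f-avoids; before to f-before; enters to f-enters;
              entered to f-entered; start to f-start)
            first-step : Linked (Step φ a b) (w ∷ t₁ ∷ ts) → Step φ a b w t₁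
            first-step (st ∷ _) = st
            -- The γ-edges at `w` stay on the cycle while `t₁` lies off it, so the segment reaches
            -- `w` by a δ-edge.
            d≡δ : d ≡ δ
            d≡δ with first-step f-linked
            ... | f , jn , o with to o | f-entered f t₁ (here refl) jn o
            ...   | inj₂ e | e' = trans (sym e') e
            ...   | inj₁ e | _ = ⊥-elim (All.lookup f-avoids (here refl) (stays jn w∈ e))
            c≡γ : c ≡ γ
            c≡γ with to next-colour | colours
            ... | inj₁ e | _ = e
            ... | inj₂ e | inj₁ (p , q) = ⊥-elim (a≢b (trans (sym p) (trans (trans e (sym d≡δ)) q)))
            ... | inj₂ e | inj₂ (p , q) = ⊥-elim (a≢b (sym (trans (sym p) (trans (trans e (sym d≡δ)) q))))
            by-cases : Dec (w ≡ u₁) → Bigger (length T)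
            -- As `u₁` misses γ, the segment stops there and is the whole chain; then `u₂` would lie
            -- on its part off the cycle.
            by-cases (yes refl) with whole (front-closed F (subst (λ c → Miss φ c w) (sym c≡γ) mγ)) (ends-∈ f-start) u₂∈ch
            ... | here e = ⊥-elim (u₁≢u₂ (sym e))
            ... | there u₂∈ts = ⊥-elim (All.lookup f-avoids u₂∈ts u₂∈)
            by-cases (no w≢u₁) = let γ* , mγ* , p , q = free w∈ in
              Return.bigger w w∈ w≢u₁ (t₁ ∷ ts) f-avoids (λ f t v t∈ jn o → f-before f t v t∈ jn (from o))
                (λ f v jn e → f-enters f v jn (trans e (sym d≡δ))) γ* mγ* p q

        bigger-chain : Bigger (length T)
        bigger-chain with in? u₂ | last-misses
        ... | no u₂∉ | _ = bigger-off u₂∉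
        ... | yes u₂∈ch | inj₁ m = Back.bigger-back γ δ id id γ≢δ m u₂∈ch (Grow.grow (_∈? C) φ proper γ δ γ≢δ far m)
        ... | yes u₂∈ch | inj₂ m = Back.bigger-back δ γ flip flip (γ≢δ ∘ sym) m u₂∈ch
                (Grow.grow (_∈? C) φ proper δ γ (γ≢δ ∘ sym) far m)
          where
          flip : ∀ {a b c} → One-of a b c → One-of b a c
          flip = [ inj₂ , inj₁ ]′

    seen? : ∀ δ → Dec (∃[ v ] (v ∈ C × Miss φ δ v))
    seen? δ = any? (λ v → (v ∈? C) ×-dec miss? φ δ v)

    exit? : ∀ δ u → Dec (Exit δ u)
    exit? δ u = any? (λ f → any? (λ z → IH.joins? f u z ×-dec ¬? (z ∈? C) ×-dec (φ f ≟ᶠ δ)))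

    OneExit : Set
    OneExit = ∀ δ → ¬ (∃[ v ] (v ∈ C × Miss φ δ v)) → ∀ {u v} → u ∈ C → v ∈ C → Exit δ u → Exit δ v → u ≡ v

    one-exit-or-bigger : OneExit ⊎ Bigger (length T)
    one-exit-or-bigger with any? (λ δ → any? (λ u → any? (λ v → ¬? (seen? δ) ×-dec (u ∈? C) ×-dec (v ∈? C) ×-dec
        ¬? (u ≟ᶠ v) ×-dec exit? δ u ×-dec exit? δ v)))
    ... | yes (δ , u , v , ns , u∈ , v∈ , u≢v , eu , ev) = inj₂ (let γ , mγ , p , q = free u∈ in
            TwoExits.Along.bigger-chain δ (λ {v} v∈ m → ns (v , v∈ , m)) u∈ v∈ u≢v eu ev γ mγ p q
              (chain proper (λ { refl → ns (u , u∈ , mγ) }) mγ))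
    ... | no none = inj₁ at-most-one
      where
      at-most-one : OneExit
      at-most-one δ ns {u} {v} u∈ v∈ eu ev with u ≟ᶠ v
      ... | yes e = e
      ... | no u≢v = ⊥-elim (none (δ , u , v , ns , u∈ , v∈ , u≢v , eu , ev))

    -- The ring graph induced by the cycle

    module Ring (one-exit : OneExit) where

      Link : V → V → Set
      Link = Linked-by φ (λ _ → ⊤)

      ℓ : ℕ
      ℓ = length rest

      pt : Fin (suc ℓ) → V
      pt = lookup C

      pt-inj : Injective _≡_ _≡_ pt
      pt-inj = unique-lookup unique

      pt∈ : ∀ i → pt i ∈ C
      pt∈ i = ∈-lookup {xs = C} i

      -- A colour missed on the cycle stays inside and is missed only once; any other colour fails
      -- to cover a vertex only by leaving the cycle there, which happens at most once by
      -- `one-exit`.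
      one : ∀ {c u v} → ⊤ → u ∈ C → v ∈ C → ¬ Covered φ C c u → ¬ Covered φ C c v → u ≡ v
      one {c} {u} {v} _ u∈ v∈ ¬u ¬v = by-cases (seen? c)
        where
        by-cases : Dec (∃[ w ] (w ∈ C × Miss φ c w)) → u ≡ v
        by-cases (yes (w , w∈ , m)) = elementary u∈ v∈ (misses-it u∈ ¬u) (misses-it v∈ ¬v)
          where
          misses-it : ∀ {u} → u ∈ C → ¬ Covered φ C c u → Miss φ c u
          misses-it u∈ ¬u f inc refl = ¬u (f , _ , proj₂ (other inc) , closed (proj₂ (other inc)) u∈ w∈ m , refl)
        by-cases (no unseen) = one-exit c unseen u∈ v∈ (exits u∈ ¬u) (exits v∈ ¬v)
          where
          exits : ∀ {u} → u ∈ C → ¬ Covered φ C c u → Exit c u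
          exits {u} u∈ ¬u with miss⊎sees φ c u
          ... | inj₁ m = ⊥-elim (unseen (u , u∈ , m))
          ... | inj₂ (f , inc , e) = f , _ , proj₂ (other inc) , (λ z∈ → ¬u (f , _ , proj₂ (other inc) , z∈ , e)) , e

      opaque
        concluded : (∀ {u a b c} → u ∈ C → a ∈ C → b ∈ C → c ∈ C → a ≢ b → a ≢ c → b ≢ c →
            Link u a → Link u b → Link u c → ⊥) ×
          ∃[ m ] (length C ≡ suc (m + m) × (m + m) * ∑ {k} (λ _ → 1) + 2 ≤ ∑ (IG.pairs pt))
        concluded = dense φ proper (λ _ → yes tt) C unique (λ _ _ → tt) one x∈C y∈C girth≤

      both? : ∀ f → Dec (s f ∈ C × t f ∈ C)
      both? f = (s f ∈? C) ×-dec (t f ∈? C)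

      edges : List (Edge G)
      edges = filter both? (allFin (suc n))

      ψ : Fin (length edges) → Edge G
      ψ = lookup edges

      ends-in-C : ∀ e → s (ψ e) ∈ C × t (ψ e) ∈ C
      ends-in-C e = proj₂ (∈-filter⁻ both? {xs = allFin (suc n)} (∈-lookup {xs = edges} e))

      srcᴿ tgtᴿ : Fin (length edges) → Fin (suc ℓ)
      srcᴿ e = index (proj₁ (ends-in-C e))
      tgtᴿ e = index (proj₂ (ends-in-C e))

      pt-src : ∀ e → pt (srcᴿ e) ≡ s (ψ e)
      pt-src e = sym (lookup-index (proj₁ (ends-in-C e)))

      pt-tgt : ∀ e → pt (tgtᴿ e) ≡ t (ψ e)
      pt-tgt e = sym (lookup-index (proj₂ (ends-in-C e)))

      R : Multigraph
      R = record { nV = suc ℓ ; nE = length edges ; src = srcᴿ ; tgt = tgtᴿ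
        ; loopless = λ e eq → s≢t (ψ e) (trans (sym (pt-src e)) (trans (cong pt eq) (pt-tgt e))) }

      subgraph : SubgraphOf R G
      subgraph = pt , ψ , pt-inj , unique-lookup (Unique.filter⁺ both? (Unique.allFin⁺ (suc n))) ,
        λ e → inj₁ (sym (pt-src e) , sym (pt-tgt e))

      joinsᴿ : ∀ e {i j} → Joins G (ψ e) (pt i) (pt j) → Joins R e i j
      joinsᴿ e (inj₁ (p , q)) = inj₁ (pt-inj (trans (pt-src e) p) , pt-inj (trans (pt-tgt e) q))
      joinsᴿ e (inj₂ (p , q)) = inj₂ (pt-inj (trans (pt-src e) p) , pt-inj (trans (pt-tgt e) q))

      adjacentᴿ : ∀ {i j} → Adjacent G (pt i) (pt j) → Adjacent R i j
      adjacentᴿ {i} {j} (f , jn) = index f∈ , joinsᴿ (index f∈) (subst (λ e → Joins G e (pt i) (pt j)) (lookup-index f∈) jn)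
        where
        on-C : Joins G f (pt i) (pt j) → s f ∈ C × t f ∈ C
        on-C (inj₁ (p , q)) = subst (_∈ C) (sym p) (pt∈ i) , subst (_∈ C) (sym q) (pt∈ j)
        on-C (inj₂ (p , q)) = subst (_∈ C) (sym p) (pt∈ j) , subst (_∈ C) (sym q) (pt∈ i)
        f∈ : f ∈ edges
        f∈ = ∈-filter⁺ both? (∈-allFin f) (on-C jn)

      L : V → V → Set
      L u v = u ∈ C × v ∈ C × Adjacent G u v

      L-sym : ∀ {u v} → L u v → L v u
      L-sym (u∈ , v∈ , f , jn) = v∈ , u∈ , f , Colourings.joins-sym G 0 {f} jn

      L-three : ∀ {u a b c} → a ≢ b → a ≢ c → b ≢ c → L u a → L u b → L u c → ⊥
      L-three p q r (u∈ , a∈ , la) (_ , b∈ , lb) (_ , c∈ , lc) =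
          proj₁ concluded u∈ a∈ b∈ c∈ p q r (all-selected la) (all-selected lb) (all-selected lc)
        where
        all-selected : ∀ {u v} → Adjacent G u v → Link u v
        all-selected (zero , jn) = zero , jn , tt
        all-selected (suc f , jn) = suc f , jn , tt

      along-cycle : ∀ e → ∃[ i ] Joins R e i (next i)
      along-cycle e with cycle-neighbours pt pt-inj long L L-sym
          (λ i → pt∈ i , pt∈ (next i) , consecutive i) L-three {srcᴿ e} {pt (tgtᴿ e)}
          (pt∈ (srcᴿ e) , pt∈ (tgtᴿ e) , ψ e , inj₁ (sym (pt-src e) , sym (pt-tgt e)))
      ... | j , eq , inj₁ j≡ = srcᴿ e , inj₁ (refl , trans (pt-inj eq) j≡)
      ... | j , eq , inj₂ i≡ = j , inj₂ (i≡ , pt-inj eq)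

      is-ring : IsRing R
      is-ring = ℓ , long , id , id , (λ i → i , id) , along-cycle , (λ i → adjacentᴿ (consecutive i))

      pairs≤edges : ∑ (IG.pairs pt) ≤ 2 * length edges
      pairs≤edges = ≤-trans (∑-mono pointwise)
        (≤-reflexive (trans (∑-*ˡ 2 (λ f → ⟦ both? f ⟧)) (cong (2 *_) (sym (length-filter both? id)))))
        where
        pointwise : ∀ f → IG.pairs pt f ≤ 2 * ⟦ both? f ⟧
        pointwise f with 1 ≤? IG.pairs pt f
        ... | no ¬le = ≤-trans (≤-reflexive (n<1⇒n≡0 (≰⇒> ¬le))) z≤n
        ... | yes le = ≤-trans (IG.pairs≤2 pt pt-inj f)
                (≤-reflexive (sym (cong (2 *_) (⟦⟧-yes (both? f) (on-C (IG.pairs≥1 pt f le))))))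
          where
          on-C : (∃[ i ] ∃[ j ] Joins G f (pt i) (pt j)) → s f ∈ C × t f ∈ C
          on-C (i , j , inj₁ (p , q)) = subst (_∈ C) (sym p) (pt∈ i) , subst (_∈ C) (sym q) (pt∈ j)
          on-C (i , j , inj₂ (p , q)) = subst (_∈ C) (sym p) (pt∈ j) , subst (_∈ C) (sym q) (pt∈ i)

      -- On 2m + 1 vertices each of the j colours accounts for at most 2m ordered pairs, whereas
      -- overfullness supplies 2mk + 2.
      uncolourableᴿ : ∀ j → j ≤ k → ¬ Colourable R j
      uncolourableᴿ j j≤k (χ , χ-proper) = <-irrefl refl (begin-strict
        (m + m) * k <⟨ m<m+n _ (s≤s z≤n) ⟩
        (m + m) * k + 2 ≡⟨ cong (λ k → (m + m) * k + 2) (sym (trans (∑-const k 1) (*-identityʳ k))) ⟩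
        (m + m) * ∑ {k} (λ _ → 1) + 2 ≤⟨ proj₂ (proj₂ (proj₂ concluded)) ⟩
        ∑ (IG.pairs pt) ≤⟨ pairs≤edges ⟩
        2 * length edges ≡⟨ trans (*-comm 2 (length edges)) (sym (∑-const (length edges) 2)) ⟩
        ∑ {length edges} (λ _ → 2) ≤⟨ ∑-mono (λ e → ≤-trans (pairs≥2 id e (srcᴿ e) (tgtᴿ e) refl refl) (≤-reflexive (sym (+-identityʳ _)))) ⟩
        ∑ (λ e → 1 * pairs e) ≡⟨ ∑-by-class χ (λ _ → 1) pairs ⟩
        ∑ (λ c → 1 * ∑ (λ e → ⟦ χ e ≟ᶠ c ⟧ * pairs e)) ≤⟨ ∑-mono (λ c → ≤-trans (≤-reflexive (+-identityʳ _)) (ColourCount.Points.class-small R j χ χ-proper id id m eq c)) ⟩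
        ∑ {j} (λ _ → m + m) ≡⟨ trans (∑-const j (m + m)) (*-comm j (m + m)) ⟩
        (m + m) * j ≤⟨ *-monoʳ-≤ (m + m) j≤k ⟩
        (m + m) * k ∎)
        where
        open ≤-Reasoning
        open Incidence R using (pairs≥2)
        pairs : Edge R → ℕ
        pairs = Incidence.pairs R id
        m = proj₁ (proj₂ concluded)
        eq = proj₁ (proj₂ (proj₂ concluded))

  Found : Set
  Found = ∃[ R ] (SubgraphOf R G × IsRing R × (∀ j → j ≤ k → ¬ Colourable R j))

  -- A tree has two vertices more than items and at most `nv` vertices, so it can grow only finitely
  -- often.
  search : ∀ fuel {φ} T → Proper φ → Tash φ T → nv < fuel + length T → Found
  search zero T pr tash lt = ⊥-elim (<⇒≱ lt (≤-trans (m≤m+n _ 2) (subst (_≤ nv) (verts-length T)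
    (unique-length (verts T) (verts-unique tash)))))
  search (suc fuel) {φ} T pr tash lt = [ finish , from-bigger ≤-refl ]′ (closed-or-bigger T pr tash)
    where
    from-bigger : ∀ {l} → length T ≤ l → Bigger l → Found
    from-bigger le (ψ , T' , pr' , tash' , lt') = search fuel T' pr' tash'
      (≤-trans lt (≤-trans (≤-reflexive (sym (+-suc fuel (length T)))) (+-monoʳ-≤ fuel (≤-trans (s≤s le) lt'))))
    finish : ClosedTree φ T → Found
    finish cl = [ (λ oe → OnCycle.Ring.R cycle oe , OnCycle.Ring.subgraph cycle oe , OnCycle.Ring.is-ring cycle oe , OnCycle.Ring.uncolourableᴿ cycle oe)
                , from-bigger (OfClosedTree.no-shorter T pr tash cl) ]′ (OnCycle.one-exit-or-bigger cycle)
      where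
      cycle : AlternatingCycle
      cycle = OfClosedTree.cycle T pr tash cl

  found : ∀ {φ} → Proper φ → Found
  found pr = search (suc nv) [] pr [] (m≤m+n (suc nv) 0)

-- The predicate has to respect pointwise equality because a function rebuilt from its values agrees
-- with the original only pointwise.
any-function? : ∀ n {k} {P : (Fin n → Fin k) → Set} → (∀ f → Dec (P f)) →
                (∀ {f g} → (∀ i → f i ≡ g i) → P f → P g) → Dec (∃ P)
any-function? zero {k} P? ext = map′ (λ p → none , p) (λ (f , p) → ext (λ ()) p) (P? none)
  where
  none : Fin 0 → Fin k
  none ()
any-function? (suc n) {k} {P} P? ext = map′
  (λ (c , f , p) → cons c f , p)
  (λ (f , p) → f zero , f ∘ suc , ext (λ { zero → refl ; (suc i) → refl }) p)
  (any? (λ c → any-function? n (λ f → P? (cons c f))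
    (λ eq → ext (λ { zero → refl ; (suc i) → eq i }))))
  where
  cons : Fin k → (Fin n → Fin k) → Fin (suc n) → Fin k
  cons c f zero = c
  cons c f (suc i) = f i

colourable? : ∀ G k → Dec (Colourable G k)
colourable? G k = any-function? (nE G)
  (λ c → all? (λ e → all? (λ e' → all? (λ v → ¬? (e ≟ᶠ e') →-dec (inc? e v →-dec (inc? e' v →-dec ¬? (c e ≟ᶠ c e')))))))
  (λ eq p e e' v ne i i' q → p e e' v ne i i' (trans (eq e) (trans q (sym (eq e')))))
  where open Incidence G

RingIn : Multigraph → ℕ → Set
RingIn G k = ∃[ R ] (SubgraphOf R G × IsRing R × (∀ j → j ≤ k → ¬ Colourable R j))

-- Edges are removed until the graph becomes k-colourable.
ring : ∀ m nv (s t : Fin m → Fin nv) (s≢t : ∀ e → s e ≢ t e) (g h s' Δ' : ℕ) →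
  let G = record { nV = nv ; nE = m ; src = s ; tgt = t ; loopless = s≢t } in
  GirthAtLeast G g → (∀ v → deg G v ≤ Δ') → (∀ u v → mult G u v ≤ suc s' * h) →
  1 ≤ s' → 2 ≤ h → 5 ≤ g → h + h ≤ g → ¬ Colourable G (Δ' + s') → RingIn G (Δ' + s')
ring zero nv s t s≢t g h s' Δ' girth deg≤ mult≤ p q r u unc = ⊥-elim (unc ((λ ()) , λ ()))
ring (suc n) nv s t s≢t g h s' Δ' girth deg≤ mult≤ p q r u unc with colourable? (WithEdge.H nv n s t s≢t) (Δ' + s')
... | yes (φ , proper) = Extremal.found nv n s t s≢t g h s' Δ' girth deg≤ mult≤ p q r u unc proper
... | no uncH with ring n nv (s ∘ suc) (t ∘ suc) (s≢t ∘ suc) g h s' Δ'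
        (λ { (suc ℓ) 3≤ℓ ℓ<g (c , inj , adj) → girth (suc ℓ) 3≤ℓ ℓ<g
               (c , inj , λ i → suc (proj₁ (adj i)) , proj₂ (adj i)) })
        (λ v → ≤-trans (m≤n+m _ _) (≤-trans (≤-reflexive (sym (W.deg-split v))) (deg≤ v)))
        (λ a b → ≤-trans (m≤n+m _ _) (≤-trans (≤-reflexive (sym (W.mult-split a b))) (mult≤ a b)))
        p q r u uncH
  where module W = WithEdge nv n s t s≢t
...   | R , (φ , ψ , φ-inj , ψ-inj , joins) , isR , uncR =
          R , (φ , suc ∘ ψ , φ-inj , ψ-inj ∘ sucᶠ-inj , joins) , isR , uncR
  where
  sucᶠ-inj : ∀ {i j : Fin n} → suc i ≡ suc j → i ≡ j
  sucᶠ-inj refl = refl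

-- The parameters of the theorem

∈⇒≤maxList : ∀ {m ms} → m ∈ ms → m ≤ maxList ms
∈⇒≤maxList {ms = _ ∷ ms} (here refl) = m≤m⊔n _ (maxList ms)
∈⇒≤maxList {ms = l ∷ _} (there m∈) = ≤-trans (∈⇒≤maxList m∈) (m≤n⊔m l _)

deg≤Δ : ∀ G v → deg G v ≤ Δ G
deg≤Δ G v = ∈⇒≤maxList (∈-map⁺ (deg G) (∈-allFin v))

mult≤μ : ∀ G u v → mult G u v ≤ μ G
mult≤μ G u v = ∈⇒≤maxList (∈-concatMap⁺ (λ u → map (mult G u) (allFin (nV G)))
  (lose (∈-allFin u) (∈-map⁺ (mult G u) (∈-allFin v))))

⌈/⌉-upper : ∀ a b → 1 ≤ b → a ≤ ⌈ a / b ⌉ * b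
⌈/⌉-upper a (suc b) _ = +-cancelʳ-≤ b a (⌈ a / suc b ⌉ * suc b) (begin
  a + b ≡⟨ m≡m%n+[m/n]*n (a + b) (suc b) ⟩
  (a + b) % suc b + (a + b) / suc b * suc b ≤⟨ +-monoˡ-≤ _ (≤-pred (m%n<n (a + b) (suc b))) ⟩
  b + (a + b) / suc b * suc b ≡⟨ +-comm b _ ⟩
  ⌈ a / suc b ⌉ * suc b + b ∎)
  where open ≤-Reasoning

⌈/⌉≥2 : ∀ a b → 1 ≤ b → b + 1 ≤ a → 2 ≤ ⌈ a / b ⌉
⌈/⌉≥2 a b 1≤b le with 2 ≤? ⌈ a / b ⌉
... | yes p = p
... | no p = ⊥-elim (<⇒≱ (≤-trans (≤-reflexive (+-comm 1 b)) le)
      (≤-trans (⌈/⌉-upper a b 1≤b) (≤-trans (*-monoˡ-≤ b (≤-pred (≰⇒> p))) (≤-reflexive (+-identityʳ b)))))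

restrict : ∀ {R G k} → SubgraphOf R G → Colourable G k → Colourable R k
restrict {R} {G} (φ , ψ , φ-inj , ψ-inj , joins) (c , proper) =
  c ∘ ψ , λ e e' v ne i i' → proper (ψ e) (ψ e') (φ v) (ne ∘ ψ-inj) (transfer e v i) (transfer e' v i')
  where
  transfer : ∀ e v → Incident R e v → Incident G (ψ e) (φ v)
  transfer e v (inj₁ refl) with joins e
  ... | inj₁ (p , _) = inj₁ p
  ... | inj₂ (_ , q) = inj₂ q
  transfer e v (inj₂ refl) with joins e
  ... | inj₁ (_ , q) = inj₂ q
  ... | inj₂ (p , _) = inj₁ p

theorem1p2 : (g : ℕ) → 5 ≤ g → (G : Multigraph) → GirthAtLeast G g
    → g / 2 + 1 ≤ μ G
    → (χ : ℕ) → IsChromaticIndex G χ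
    → χ ≡ Δ G + ⌈ μ G / (g / 2) ⌉
    → ∃[ R ] (SubgraphOf R G × IsRing R × IsChromaticIndex R χ)
theorem1p2 g 5≤g G girth μ-large χ (colours , least) χ≡ =
    R , sub , isRing , restrict {R} {G} sub colours , minimal
  where
  h s s' : ℕ
  h = g / 2
  s = ⌈ μ G / h ⌉
  s' = s ∸ 1
  2≤h : 2 ≤ h
  -- The quotient `5 / 2` computes to 2.
  2≤h = /-monoˡ-≤ 2 5≤g
  2≤s : 2 ≤ s
  2≤s = ⌈/⌉≥2 (μ G) h (<⇒≤ 2≤h) μ-large
  suc-s' : suc s' ≡ s
  suc-s' = m+[n∸m]≡n {1} (<⇒≤ 2≤s)
  χ≡' : χ ≡ suc (Δ G + s')
  -- Thus χ exceeds the number of colours `Δ G + s'` by exactly one, and a ring that cannot be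
  -- coloured with those has chromatic index χ.
  χ≡' = trans χ≡ (trans (cong (Δ G +_) (sym suc-s')) (+-suc (Δ G) s'))
  found : RingIn G (Δ G + s')
  found = ring (nE G) (nV G) (src G) (tgt G) (loopless G) g h s' (Δ G) girth (deg≤Δ G)
    (λ u v → ≤-trans (mult≤μ G u v) (≤-trans (⌈/⌉-upper (μ G) h (<⇒≤ 2≤h)) (≤-reflexive (cong (_* h) (sym suc-s')))))
    (∸-monoˡ-≤ 1 2≤s) 2≤h 5≤g
    (≤-trans (≤-reflexive (trans (cong (h +_) (sym (+-identityʳ h))) (*-comm 2 h))) (m/n*n≤m g 2))
    (λ col → <⇒≱ (≤-reflexive (sym χ≡')) (least (Δ G + s') col))
  R = proj₁ found
  sub = proj₁ (proj₂ found)
  isRing = proj₁ (proj₂ (proj₂ found))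
  minimal : ∀ j → Colourable R j → χ ≤ j
  minimal j col = ≮⇒≥ λ j<χ → proj₂ (proj₂ (proj₂ found)) j (≤-pred (subst (j <_) χ≡' j<χ)) col
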